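{- Let $W$ be an irreducible $T$-module with endpoint $r$ and diameter $d=D-2r$. Then the following hold for $0\le i,j\le d$ and nonzero vectors $u\in E_rW$, $u^*\in E^*_rW$, $u^{\varepsilon}\in E^{\varepsilon}_rW$. (i) $$\langle E_{r+i}u^*,E^*_{r+j}u\rangle=2^{ -d}\langle u^*,u\rangle\binom{d}{i}\binom{d}{j}\;{}_2F_1\Big({ -i,-j\atop -d};2\Big).$$ (ii) $$\langle E^*_{r+i}u^{\varepsilon},E^{\varepsilon}_{r+j}u^*\rangle=2^{ -d}\langle u^{\varepsilon},u^*\rangle\binom{d}{i}\binom{d}{j}\;{}_2F_1\Big({ -i,-j\atop -d};2\Big).$$ (iii) $$\langle E^{\varepsilon}_{r+i}u,E_{r+j}u^{\varepsilon}\rangle=2^{ -d}\langle u,u^{\varepsilon}\rangle\binom{d}{i}\binom{d}{j}\;{}_2F_1\Big({ -i,-j\atop -d};2\Big).$$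
   Context: Let $D$ be a positive integer and let $Q_D$ be the $D$-cube: the graph with vertex set $X=\{0,1\}^D$, two vertices being adjacent iff they differ in exactly one coordinate; $\partial$ denotes path-length distance. $\mathrm{Mat}_X(\mathbb{C})$ is the algebra of complex matrices with rows and columns indexed by $X$, acting on $V=\mathbb{C}^X$ (column vectors) by left multiplication. $V$ carries the Hermitian inner product $\langle v,w\rangle=v^t\overline{w}$ (linear in the first argument). Write $\mathbf{i}^2=-1$ (the bold $\mathbf{i}$ is the imaginary unit; the plain $i$ is an index). Let $A$ be the adjacency matrix of $Q_D$. Fix $x=(0,0,\ldots,0)\in X$. Let $A^*$ be the diagonal matrix in $\mathrm{Mat}_X(\mathbb{C})$ with $(y,y)$-entry $D-2\partial(x,y)$ for $y\in X$, and let $A^{\varepsilon}=-\mathbf{i}(AA^*-A^*A)/2$. Let $T$ be the subalgebra of $\mathrm{Mat}_X(\mathbb{C})$ generated by $A$ and $A^*$. The eigenvalues of $A$ are $\theta_i=D-2i$ $(0\le i\le D)$. For $0\le i\le D$: $E_i=\prod_{0\le j\le D,\,j\ne i}\frac{A-\theta_jI}{\theta_i-\theta_j}$ is the primitive idempotent of $A$ for $\theta_i$ (the orthogonal projection onto the $\theta_i$-eigenspace of $A$); $E_i^*$ is the diagonal matrix with $(y,y)$-entry $1$ if $\partial(x,y)=i$ and $0$ otherwise; and $E_i^{\varepsilon}=P^{ -1}E_iP$, where $P=P_1^{\otimes D}$ (Kronecker power, $P_{yz}=\prod_{k=1}^D(P_1)_{y_kz_k}$, invertible) with $P_1=\begin{pmatrix}1&1\\-\mathbf{i}&\mathbf{i}\end{pmatrix}$,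 rows and columns indexed by $0,1$ in that order. ($E_i^*$ and $E_i^{\varepsilon}$ are the primitive idempotents of $A^*$ and $A^{\varepsilon}$ for the eigenvalue $D-2i$.) A $T$-module is a subspace $W\subseteq V$ with $BW\subseteq W$ for all $B\in T$; it is irreducible if $W\ne0$ and it contains no $T$-modules other than $0$ and $W$. The endpoint of an irreducible $T$-module $W$ is $r=\min\{i\mid 0\le i\le D,\ E_i^*W\neq0\}$ (it is known that also $r=\min\{i\mid E_iW\ne0\}$), and its diameter is $d=|\{i\mid 0\le i\le D,\ E_i^*W\ne0\}|-1$; it is known that $d=D-2r$ and $0\le r\le D/2$. For $a\in\mathbb{C}$ and an integer $n\ge0$, $(a)_n=a(a+1)\cdots(a+n-1)$ with $(a)_0=1$. For integers $0\le i,j\le d$, ${}_2F_1\big({ -i,-j\atop -d};2\big)=\sum_{n=0}^d\frac{(-i)_n(-j)_n}{(-d)_n\,n!}2^n$. -}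

module Defs where

open import Level using (0ℓ)
open import Algebra.Bundles using (CommutativeRing)
import Algebra.Properties.CommutativeMonoid.Sum as MonoidSum
import Algebra.Properties.Group as GroupProperties
import Algebra.Properties.Semiring.Exp as Exp
import Algebra.Properties.Semiring.Sum as SemiringSum
open import Data.Bool.Base using (if_then_else_)
open import Data.Fin.Base using (Fin; toℕ)
open import Data.Fin.Patterns using (0F; 1F)
import Data.Fin.Properties as Fin
import Data.Fin.Subset as Subset
open import Data.Integer.Base as ℤ using (ℤ; +_)
import Data.Integer.Properties as ℤ
open import Data.List.Base using (foldr; map; upTo)
open import Data.Nat.Base as ℕ using (ℕ; zero; suc; z≤n; s≤s; _!)
import Data.Nat.Properties as ℕ
open import Data.Product.Base using (_×_; _,_; ∃; proj₁; proj₂)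
open import Data.Rational.Base as ℚ using (ℚ; 0ℚ; 1ℚ; ½; ∣_∣; _÷_; 1/_)
import Data.Rational.Properties as ℚ
open import Data.Rational.Solver using (module +-*-Solver)
import Data.Rational.Unnormalised.Base as ℚᵘ
open import Data.Vec.Base using (Vec; []; _∷_; lookup; replicate; count; zip)
open import Data.Vec.Properties using (≡-dec)
open import Function.Base using (_∘_)
open import Function.Bundles using (_⇔_)
open import Relation.Binary.Definitions using (DecidableEquality)
open import Relation.Binary.PropositionalEquality
  using (_≡_; _≢_; refl; sym; trans; cong; cong₂; subst; module ≡-Reasoning)
open import Relation.Nullary using (¬_; Dec; does; yes; no; ¬?)
open import Relation.Nullary.Negation using (contradiction)
open import Relation.Unary using (Pred; _∈_; _⊆_; _≐_)

private
  module ℚS = +-*-Solver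

  half-pos : ∀ {ε} → 0ℚ ℚ.< ε → 0ℚ ℚ.< ½ ℚ.* ε
  half-pos {ε} 0<ε =
    subst (ℚ._< ½ ℚ.* ε) (ℚ.*-zeroʳ ½) (ℚ.*-monoʳ-<-pos ½ 0<ε)

  half+half : ∀ ε → ½ ℚ.* ε ℚ.+ ½ ℚ.* ε ≡ ε
  half+half = ℚS.solve 1 (λ e → h :* e :+ h :* e := e) refl
    where
    open ℚS
    h = con ½

  +-est : ∀ a b c d {δ} → ∣ a ℚ.- c ∣ ℚ.≤ ½ ℚ.* δ → ∣ b ℚ.- d ∣ ℚ.≤ ½ ℚ.* δ →
          ∣ (a ℚ.+ b) ℚ.- (c ℚ.+ d) ∣ ℚ.≤ δ
  +-est a b c d {δ} p q = begin
    ∣ (a ℚ.+ b) ℚ.- (c ℚ.+ d) ∣       ≡⟨ cong ∣_∣ (ℚS.solve 4 (λ a b c d →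
                                           (a :+ b) :- (c :+ d) := (a :- c) :+ (b :- d))
                                           refl a b c d) ⟩
    ∣ (a ℚ.- c) ℚ.+ (b ℚ.- d) ∣       ≤⟨ ℚ.∣p+q∣≤∣p∣+∣q∣ (a ℚ.- c) (b ℚ.- d) ⟩
    ∣ a ℚ.- c ∣ ℚ.+ ∣ b ℚ.- d ∣       ≤⟨ ℚ.+-mono-≤ p q ⟩
    ½ ℚ.* δ ℚ.+ ½ ℚ.* δ               ≡⟨ half+half δ ⟩
    δ                                 ∎
    where
    open ℚ.≤-Reasoning
    open ℚS

  *-mono : ∀ {a b c d} → ∣ a ∣ ℚ.≤ b → ∣ c ∣ ℚ.≤ d → ∣ a ∣ ℚ.* ∣ c ∣ ℚ.≤ b ℚ.* d
  *-mono {a} {b} {c} {d} p q = ℚ.≤-trans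
    (ℚ.*-monoʳ-≤-nonNeg ∣ c ∣ {{ℚ.∣-∣-nonNeg c}} p)
    (ℚ.*-monoˡ-≤-nonNeg b {{ℚ.nonNegative (ℚ.≤-trans (ℚ.0≤∣p∣ a) p)}} q)

  *-est : ∀ a b c d {M N δ} → ∣ a ∣ ℚ.≤ M → ∣ d ∣ ℚ.≤ N →
          ∣ a ℚ.- c ∣ ℚ.≤ δ → ∣ b ℚ.- d ∣ ℚ.≤ δ →
          ∣ a ℚ.* b ℚ.- c ℚ.* d ∣ ℚ.≤ (M ℚ.+ N) ℚ.* δ
  *-est a b c d {M} {N} {δ} p q r s = begin
    ∣ a ℚ.* b ℚ.- c ℚ.* d ∣                               ≡⟨ cong ∣_∣ (ℚS.solve 4 (λ a b c d →
                                                               a :* b :- c :* d :=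
                                                               a :* (b :- d) :+ d :* (a :- c))
                                                               refl a b c d) ⟩
    ∣ a ℚ.* (b ℚ.- d) ℚ.+ d ℚ.* (a ℚ.- c) ∣               ≤⟨ ℚ.∣p+q∣≤∣p∣+∣q∣ (a ℚ.* (b ℚ.- d)) (d ℚ.* (a ℚ.- c)) ⟩
    ∣ a ℚ.* (b ℚ.- d) ∣ ℚ.+ ∣ d ℚ.* (a ℚ.- c) ∣           ≡⟨ cong₂ ℚ._+_ (ℚ.∣p*q∣≡∣p∣*∣q∣ a (b ℚ.- d)) (ℚ.∣p*q∣≡∣p∣*∣q∣ d (a ℚ.- c)) ⟩
    ∣ a ∣ ℚ.* ∣ b ℚ.- d ∣ ℚ.+ ∣ d ∣ ℚ.* ∣ a ℚ.- c ∣       ≤⟨ ℚ.+-mono-≤ (*-mono {a} {c = b ℚ.- d} p s) (*-mono {d} {c = a ℚ.- c} q r) ⟩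
    M ℚ.* δ ℚ.+ N ℚ.* δ                                   ≡⟨ ℚ.*-distribʳ-+ δ M N ⟨
    (M ℚ.+ N) ℚ.* δ                                       ∎
    where
    open ℚ.≤-Reasoning
    open ℚS

  neg-est : ∀ a b → ∣ ℚ.- a ℚ.- ℚ.- b ∣ ≡ ∣ a ℚ.- b ∣
  neg-est a b = trans
    (cong ∣_∣ (ℚS.solve 2 (λ a b → :- a :- :- b := :- (a :- b)) refl a b))
    (ℚ.∣-p∣≡∣p∣ (a ℚ.- b))
    where open ℚS

  sym-est : ∀ a b → ∣ a ℚ.- b ∣ ≡ ∣ b ℚ.- a ∣
  sym-est a b = trans
    (cong ∣_∣ (ℚS.solve 2 (λ a b → a :- b := :- (b :- a)) refl a b))
    (ℚ.∣-p∣≡∣p∣ (b ℚ.- a))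
    where open ℚS

  self-est : ∀ {a b ε} → a ≡ b → 0ℚ ℚ.< ε → ∣ a ℚ.- b ∣ ℚ.≤ ε
  self-est {a} {ε = ε} refl 0<ε =
    subst (λ t → ∣ t ∣ ℚ.≤ ε) (sym (ℚ.+-inverseʳ a)) (ℚ.<⇒≤ 0<ε)

  ⊔-split : ∀ M N {n} → M ℕ.⊔ N ℕ.≤ n → M ℕ.≤ n × N ℕ.≤ n
  ⊔-split M N p = ℕ.≤-trans (ℕ.m≤m⊔n M N) p , ℕ.≤-trans (ℕ.m≤n⊔m M N) p

-- Reals are Cauchy sequences of rationals with a modulus of convergence, up to
-- the equivalence _≈ᵣ_.
--
-- Eta is disabled for ℝ and ℂ, and operations are given by copatterns, only to
-- keep the type checker from unfolding them when it compares expressions.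
record ℝ : Set where
  no-eta-equality
  field
    seq    : ℕ → ℚ
    cauchy : ∀ ε → 0ℚ ℚ.< ε → ∃ λ N → ∀ m n → N ℕ.≤ m → N ℕ.≤ n →
             ∣ seq m ℚ.- seq n ∣ ℚ.≤ ε

open ℝ public

infix 4 _≈ᵣ_

record _≈ᵣ_ (x y : ℝ) : Set where
  constructor mk≈ᵣ
  field
    close : ∀ ε → 0ℚ ℚ.< ε → ∃ λ N → ∀ n → N ℕ.≤ n → ∣ seq x n ℚ.- seq y n ∣ ℚ.≤ ε

open _≈ᵣ_ public

ratᵣ : ℚ → ℝ
seq (ratᵣ q) _ = q
cauchy (ratᵣ q) ε 0<ε = 0 , λ _ _ _ _ → self-est {q} refl 0<ε

pointwise⇒≈ᵣ : ∀ {x y} → (∀ n → seq x n ≡ seq y n) → x ≈ᵣ y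
pointwise⇒≈ᵣ eq = mk≈ᵣ λ ε 0<ε → 0 , λ n _ → self-est (eq n) 0<ε

≈ᵣ-refl : ∀ {x} → x ≈ᵣ x
≈ᵣ-refl = pointwise⇒≈ᵣ λ _ → refl

≈ᵣ-sym : ∀ {x y} → x ≈ᵣ y → y ≈ᵣ x
≈ᵣ-sym {x} {y} p = mk≈ᵣ λ ε 0<ε → let N , f = close p ε 0<ε in
  N , λ n N≤n → subst (ℚ._≤ ε) (sym-est (seq x n) (seq y n)) (f n N≤n)

≈ᵣ-trans : ∀ {x y z} → x ≈ᵣ y → y ≈ᵣ z → x ≈ᵣ z
≈ᵣ-trans {x} {y} {z} p q = mk≈ᵣ λ ε 0<ε →
  let M , f = close p _ (half-pos 0<ε)
      N , g = close q _ (half-pos 0<ε)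
  in M ℕ.⊔ N , λ n le → let lM , lN = ⊔-split M N le in
     subst (λ t → ∣ t ∣ ℚ.≤ ε)
       (ℚS.solve 3 (λ a b c → (a :+ b) :- (b :+ c) := a :- c) refl (seq x n) (seq y n) (seq z n))
       (+-est (seq x n) (seq y n) (seq y n) (seq z n) (f n lM) (g n lN))
  where open ℚS

infixl 6 _+ᵣ_
infixl 7 _*ᵣ_
infix  8 -ᵣ_

_+ᵣ_ : ℝ → ℝ → ℝ
seq (x +ᵣ y) n = seq x n ℚ.+ seq y n
cauchy (x +ᵣ y) ε 0<ε =
  let M , f = cauchy x _ (half-pos 0<ε)
      N , g = cauchy y _ (half-pos 0<ε)
  in M ℕ.⊔ N , λ m n lm ln →
     let mM , mN = ⊔-split M N lm ; nM , nN = ⊔-split M N ln in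
     +-est (seq x m) (seq y m) (seq x n) (seq y n) (f m n mM nM) (g m n mN nN)

-ᵣ_ : ℝ → ℝ
seq (-ᵣ x) n = ℚ.- seq x n
cauchy (-ᵣ x) ε 0<ε = let N , f = cauchy x ε 0<ε in
  N , λ m n lm ln → subst (ℚ._≤ ε) (sym (neg-est (seq x m) (seq x n))) (f m n lm ln)

private
  record Bounded (s : ℕ → ℚ) : Set where
    constructor mkBounded
    field
      bnd   : ℚ
      pos   : 0ℚ ℚ.< bnd
      start : ℕ
      below : ∀ n → start ℕ.≤ n → ∣ s n ∣ ℚ.≤ bnd

  0<1 : 0ℚ ℚ.< 1ℚ
  0<1 = ℚ.*<* (ℤ.+<+ (s≤s z≤n))

  bounded : ∀ x → Bounded (seq x)
  bounded x = mkBounded (1ℚ ℚ.+ ∣ seq x N ∣) (ℚ.+-mono-<-≤ 0<1 (ℚ.0≤∣p∣ (seq x N))) N λ n le →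
    begin
      ∣ seq x n ∣                              ≡⟨ cong ∣_∣ (ℚS.solve 2 (λ a b → a := (a :- b) :+ b) refl (seq x n) (seq x N)) ⟩
      ∣ (seq x n ℚ.- seq x N) ℚ.+ seq x N ∣    ≤⟨ ℚ.∣p+q∣≤∣p∣+∣q∣ (seq x n ℚ.- seq x N) (seq x N) ⟩
      ∣ seq x n ℚ.- seq x N ∣ ℚ.+ ∣ seq x N ∣  ≤⟨ ℚ.+-monoˡ-≤ ∣ seq x N ∣ (f n N le ℕ.≤-refl) ⟩
      1ℚ ℚ.+ ∣ seq x N ∣                       ∎
    where
    open ℚ.≤-Reasoning
    open ℚS
    N = proj₁ (cauchy x 1ℚ 0<1)
    f = proj₂ (cauchy x 1ℚ 0<1)

  module Scale (B ε : ℚ) (0<B : 0ℚ ℚ.< B) (0<ε : 0ℚ ℚ.< ε) where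
    instance
      B-pos : ℚ.Positive B
      B-pos = ℚ.positive 0<B

      B-nz : ℚ.NonZero B
      B-nz = ℚ.pos⇒nonZero B

      1/B-pos : ℚ.Positive (1/ B)
      1/B-pos = ℚ.1/pos⇒pos B

    δ : ℚ
    δ = 1/ B ℚ.* ε

    0<δ : 0ℚ ℚ.< δ
    0<δ = subst (ℚ._< δ) (ℚ.*-zeroʳ (1/ B)) (ℚ.*-monoʳ-<-pos (1/ B) 0<ε)

    B*δ : B ℚ.* δ ≡ ε
    B*δ = trans (sym (ℚ.*-assoc B (1/ B) ε))
            (trans (cong (ℚ._* ε) (ℚ.*-inverseʳ B)) (ℚ.*-identityˡ ε))

_*ᵣ_ : ℝ → ℝ → ℝ
seq (x *ᵣ y) n = seq x n ℚ.* seq y n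
cauchy (x *ᵣ y) ε 0<ε =
  let mkBounded Bx px Kx bx = bounded x
      mkBounded By py Ky by = bounded y
      open Scale (Bx ℚ.+ By) ε (ℚ.+-mono-< px py) 0<ε
      M , f = cauchy x δ 0<δ
      N , g = cauchy y δ 0<δ
  in (Kx ℕ.⊔ Ky) ℕ.⊔ (M ℕ.⊔ N) , λ m n lm ln →
     let mK , mMN = ⊔-split (Kx ℕ.⊔ Ky) (M ℕ.⊔ N) lm
         nK , nMN = ⊔-split (Kx ℕ.⊔ Ky) (M ℕ.⊔ N) ln
         mM , mN = ⊔-split M N mMN
         nM , nN = ⊔-split M N nMN
     in subst (_ ℚ.≤_) B*δ
          (*-est (seq x m) (seq y m) (seq x n) (seq y n)
             (bx m (proj₁ (⊔-split Kx Ky mK))) (by n (proj₂ (⊔-split Kx Ky nK)))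
             (f m n mM nM) (g m n mN nN))

+ᵣ-cong : ∀ {x y u v} → x ≈ᵣ y → u ≈ᵣ v → x +ᵣ u ≈ᵣ y +ᵣ v
+ᵣ-cong {x} {y} {u} {v} p q = mk≈ᵣ λ ε 0<ε →
  let M , f = close p _ (half-pos 0<ε)
      N , g = close q _ (half-pos 0<ε)
  in M ℕ.⊔ N , λ n le → let lM , lN = ⊔-split M N le in
     +-est (seq x n) (seq u n) (seq y n) (seq v n) (f n lM) (g n lN)

-ᵣ-cong : ∀ {x y} → x ≈ᵣ y → -ᵣ x ≈ᵣ -ᵣ y
-ᵣ-cong {x} {y} p = mk≈ᵣ λ ε 0<ε → let N , f = close p ε 0<ε in
  N , λ n le → subst (ℚ._≤ ε) (sym (neg-est (seq x n) (seq y n))) (f n le)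

*ᵣ-cong : ∀ {x y u v} → x ≈ᵣ y → u ≈ᵣ v → x *ᵣ u ≈ᵣ y *ᵣ v
*ᵣ-cong {x} {y} {u} {v} p q = mk≈ᵣ λ ε 0<ε →
  let mkBounded Bx px Kx bx = bounded x
      mkBounded Bv pv Kv bv = bounded v
      open Scale (Bx ℚ.+ Bv) ε (ℚ.+-mono-< px pv) 0<ε
      M , f = close p δ 0<δ
      N , g = close q δ 0<δ
  in (Kx ℕ.⊔ Kv) ℕ.⊔ (M ℕ.⊔ N) , λ n ln →
     let nK , nMN = ⊔-split (Kx ℕ.⊔ Kv) (M ℕ.⊔ N) ln
         nM , nN = ⊔-split M N nMN
     in subst (_ ℚ.≤_) B*δ
          (*-est (seq x n) (seq u n) (seq y n) (seq v n)
             (bx n (proj₁ (⊔-split Kx Kv nK))) (bv n (proj₂ (⊔-split Kx Kv nK)))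
             (f n nM) (g n nN))

record ℂ : Set where
  no-eta-equality
  field
    re im : ℝ

open ℂ public

record _≈ᶜ_ (z w : ℂ) : Set where
  constructor mk≈ᶜ
  field
    re≈ : re z ≈ᵣ re w
    im≈ : im z ≈ᵣ im w

open _≈ᶜ_ public

ι : ℚ → ℂ
re (ι q) = ratᵣ q
im (ι q) = ratᵣ 0ℚ

𝐢 : ℂ
re 𝐢 = ratᵣ 0ℚ
im 𝐢 = ratᵣ 1ℚ

conj : ℂ → ℂ
re (conj z) = re z
im (conj z) = -ᵣ im z

private
  _+ᶜ_ _*ᶜ_ : ℂ → ℂ → ℂ
  re (z +ᶜ w) = re z +ᵣ re w
  im (z +ᶜ w) = im z +ᵣ im w
  re (z *ᶜ w) = re z *ᵣ re w +ᵣ -ᵣ (im z *ᵣ im w)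
  im (z *ᶜ w) = re z *ᵣ im w +ᵣ im z *ᵣ re w

  -ᶜ_ : ℂ → ℂ
  re (-ᶜ z) = -ᵣ re z
  im (-ᶜ z) = -ᵣ im z

  pw : ∀ {z w} → (∀ n → seq (re z) n ≡ seq (re w) n) →
       (∀ n → seq (im z) n ≡ seq (im w) n) → z ≈ᶜ w
  pw p q = mk≈ᶜ (pointwise⇒≈ᵣ p) (pointwise⇒≈ᵣ q)

  +ᶜ-comm : ∀ z w → (z +ᶜ w) ≈ᶜ (w +ᶜ z)
  +ᶜ-comm z w = pw (λ n → ℚ.+-comm (seq (re z) n) (seq (re w) n))
                   (λ n → ℚ.+-comm (seq (im z) n) (seq (im w) n))

  +ᶜ-assoc : ∀ z w v → ((z +ᶜ w) +ᶜ v) ≈ᶜ (z +ᶜ (w +ᶜ v))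
  +ᶜ-assoc z w v =
    pw (λ n → ℚ.+-assoc (seq (re z) n) (seq (re w) n) (seq (re v) n))
       (λ n → ℚ.+-assoc (seq (im z) n) (seq (im w) n) (seq (im v) n))

  *ᶜ-comm : ∀ z w → (z *ᶜ w) ≈ᶜ (w *ᶜ z)
  *ᶜ-comm z w =
    pw (λ n → solve 4 (λ a b c d → a :* c :- b :* d := c :* a :- d :* b) refl
                (seq (re z) n) (seq (im z) n) (seq (re w) n) (seq (im w) n))
       (λ n → solve 4 (λ a b c d → a :* d :+ b :* c := c :* b :+ d :* a) refl
                (seq (re z) n) (seq (im z) n) (seq (re w) n) (seq (im w) n))
    where open ℚS

  *ᶜ-assoc : ∀ z w v → ((z *ᶜ w) *ᶜ v) ≈ᶜ (z *ᶜ (w *ᶜ v))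
  *ᶜ-assoc z w v =
    pw (λ n → solve 6 (λ a b c d e f →
                (a :* c :- b :* d) :* e :- (a :* d :+ b :* c) :* f :=
                a :* (c :* e :- d :* f) :- b :* (c :* f :+ d :* e)) refl
                (seq (re z) n) (seq (im z) n) (seq (re w) n) (seq (im w) n) (seq (re v) n) (seq (im v) n))
       (λ n → solve 6 (λ a b c d e f →
                (a :* c :- b :* d) :* f :+ (a :* d :+ b :* c) :* e :=
                a :* (c :* f :+ d :* e) :+ b :* (c :* e :- d :* f)) refl
                (seq (re z) n) (seq (im z) n) (seq (re w) n) (seq (im w) n) (seq (re v) n) (seq (im v) n))
    where open ℚS

  *ᶜ-distribˡ : ∀ z w v → (z *ᶜ (w +ᶜ v)) ≈ᶜ ((z *ᶜ w) +ᶜ (z *ᶜ v))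
  *ᶜ-distribˡ z w v =
    pw (λ n → solve 6 (λ a b c d e f →
                a :* (c :+ e) :- b :* (d :+ f) :=
                (a :* c :- b :* d) :+ (a :* e :- b :* f)) refl
                (seq (re z) n) (seq (im z) n) (seq (re w) n) (seq (im w) n) (seq (re v) n) (seq (im v) n))
       (λ n → solve 6 (λ a b c d e f →
                a :* (d :+ f) :+ b :* (c :+ e) :=
                (a :* d :+ b :* c) :+ (a :* f :+ b :* e)) refl
                (seq (re z) n) (seq (im z) n) (seq (re w) n) (seq (im w) n) (seq (re v) n) (seq (im v) n))
    where open ℚS

  *ᶜ-identityˡ : ∀ z → (ι 1ℚ *ᶜ z) ≈ᶜ z
  *ᶜ-identityˡ z =
    pw (λ n → solve 2 (λ a b → con 1ℚ :* a :- con 0ℚ :* b := a) refl (seq (re z) n) (seq (im z) n))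
       (λ n → solve 2 (λ a b → con 1ℚ :* b :+ con 0ℚ :* a := b) refl (seq (re z) n) (seq (im z) n))
    where open ℚS

  ≈ᶜ-sym : ∀ {z w} → z ≈ᶜ w → w ≈ᶜ z
  ≈ᶜ-sym (mk≈ᶜ p q) = mk≈ᶜ (≈ᵣ-sym p) (≈ᵣ-sym q)

  ≈ᶜ-trans : ∀ {z w v} → z ≈ᶜ w → w ≈ᶜ v → z ≈ᶜ v
  ≈ᶜ-trans (mk≈ᶜ p q) (mk≈ᶜ r s) = mk≈ᶜ (≈ᵣ-trans p r) (≈ᵣ-trans q s)

  +ᶜ-cong : ∀ {z w u v} → z ≈ᶜ w → u ≈ᶜ v → (z +ᶜ u) ≈ᶜ (w +ᶜ v)
  +ᶜ-cong (mk≈ᶜ p q) (mk≈ᶜ r s) = mk≈ᶜ (+ᵣ-cong p r) (+ᵣ-cong q s)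

  *ᶜ-cong : ∀ {z w u v} → z ≈ᶜ w → u ≈ᶜ v → (z *ᶜ u) ≈ᶜ (w *ᶜ v)
  *ᶜ-cong (mk≈ᶜ p q) (mk≈ᶜ r s) =
    mk≈ᶜ (+ᵣ-cong (*ᵣ-cong p r) (-ᵣ-cong (*ᵣ-cong q s)))
         (+ᵣ-cong (*ᵣ-cong p s) (*ᵣ-cong q r))

  +ᶜ-identityˡ : ∀ z → (ι 0ℚ +ᶜ z) ≈ᶜ z
  +ᶜ-identityˡ z = pw (λ n → ℚ.+-identityˡ (seq (re z) n)) (λ n → ℚ.+-identityˡ (seq (im z) n))

  -ᶜ-inverseˡ : ∀ z → ((-ᶜ z) +ᶜ z) ≈ᶜ ι 0ℚ
  -ᶜ-inverseˡ z = pw (λ n → ℚ.+-inverseˡ (seq (re z) n)) (λ n → ℚ.+-inverseˡ (seq (im z) n))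

  viaComm : ∀ {z w u v} → z ≈ᶜ w → z ≈ᶜ u → w ≈ᶜ v → u ≈ᶜ v
  viaComm p q r = ≈ᶜ-trans (≈ᶜ-sym q) (≈ᶜ-trans p r)

ℂ-commutativeRing : CommutativeRing 0ℓ 0ℓ
ℂ-commutativeRing = record
  { Carrier = ℂ ; _≈_ = _≈ᶜ_ ; _+_ = _+ᶜ_ ; _*_ = _*ᶜ_ ; -_ = -ᶜ_ ; 0# = ι 0ℚ ; 1# = ι 1ℚ
  ; isCommutativeRing = record
    { isRing = record
      { +-isAbelianGroup = record
        { isGroup = record
          { isMonoid = record
            { isSemigroup = record
              { isMagma = record
                { isEquivalence = record
                  { refl = mk≈ᶜ ≈ᵣ-refl ≈ᵣ-refl ; sym = ≈ᶜ-sym ; trans = ≈ᶜ-trans }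
                ; ∙-cong = +ᶜ-cong }
              ; assoc = +ᶜ-assoc }
            ; identity = +ᶜ-identityˡ , λ z → ≈ᶜ-trans (+ᶜ-comm z (ι 0ℚ)) (+ᶜ-identityˡ z) }
          ; inverse = -ᶜ-inverseˡ , λ z → ≈ᶜ-trans (+ᶜ-comm z (-ᶜ z)) (-ᶜ-inverseˡ z)
          ; ⁻¹-cong = λ (mk≈ᶜ p q) → mk≈ᶜ (-ᵣ-cong p) (-ᵣ-cong q) }
        ; comm = +ᶜ-comm }
      ; *-cong = *ᶜ-cong
      ; *-assoc = *ᶜ-assoc
      ; *-identity = *ᶜ-identityˡ , λ z → ≈ᶜ-trans (*ᶜ-comm z (ι 1ℚ)) (*ᶜ-identityˡ z)
      ; distrib = *ᶜ-distribˡ , λ z w v →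
          viaComm (*ᶜ-distribˡ z w v) (*ᶜ-comm z (w +ᶜ v)) (+ᶜ-cong (*ᶜ-comm z w) (*ᶜ-comm z v)) }
    ; *-comm = *ᶜ-comm } }

open CommutativeRing ℂ-commutativeRing public
  using (_≈_; _+_; _*_; _-_; -_; 0#; 1#)

private module R = CommutativeRing ℂ-commutativeRing

open SemiringSum R.semiring public using (sum; sum-syntax)
open MonoidSum R.*-commutativeMonoid public
  using () renaming (sum to prod)
open Exp R.semiring public using (_^_)

ℤ→ℚ : ℤ → ℚ
ℤ→ℚ z = z ℚ./ 1

ℕ→ℚ : ℕ → ℚ
ℕ→ℚ n = ℤ→ℚ (+ n)

X : ℕ → Set
X D = Vec (Fin 2) D

_≟ₓ_ : ∀ {D} → DecidableEquality (X D)
_≟ₓ_ = ≡-dec Fin._≟_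

differences : ∀ {D} → X D → X D → ℕ
differences y z = count (λ (a , b) → ¬? (a Fin.≟ b)) (zip y z)

Adjacent : ∀ {D} → X D → X D → Set
Adjacent y z = differences y z ≡ 1

adjacent? : ∀ {D} (y z : X D) → Dec (Adjacent y z)
adjacent? y z = differences y z ℕ.≟ 1

data Walk {D : ℕ} : X D → X D → ℕ → Set where
  []  : ∀ {y} → Walk y y 0
  _∷_ : ∀ {y z w n} → Adjacent y z → Walk z w n → Walk y w (suc n)

IsDistance : ∀ {D} → X D → X D → ℕ → Set
IsDistance y z n = Walk y z n × (∀ m → Walk y z m → n ℕ.≤ m)

private
  diff-refl : ∀ {D} (y : X D) → differences y y ≡ 0
  diff-refl []       = refl
  diff-refl (a ∷ y) with a Fin.≟ a
  ... | yes _  = diff-refl y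
  ... | no a≢a = contradiction refl a≢a

  diff-triangle : ∀ {D} (y z w : X D) →
                  differences y w ℕ.≤ differences y z ℕ.+ differences z w
  diff-triangle [] [] [] = z≤n
  diff-triangle (a ∷ y) (b ∷ z) (c ∷ w) with a Fin.≟ c | a Fin.≟ b | b Fin.≟ c
  ... | yes _ | yes _  | yes _ = diff-triangle y z w
  ... | yes _ | yes _  | no _  = ℕ.≤-trans (diff-triangle y z w) (ℕ.+-monoʳ-≤ (differences y z) (ℕ.n≤1+n _))
  ... | yes _ | no _   | yes _ = ℕ.m≤n⇒m≤1+n (diff-triangle y z w)
  ... | yes _ | no _   | no _  = ℕ.m≤n⇒m≤1+n (ℕ.≤-trans (diff-triangle y z w) (ℕ.+-monoʳ-≤ (differences y z) (ℕ.n≤1+n _)))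
  ... | no _  | yes _  | no _  = subst (suc (differences y w) ℕ.≤_) (sym (ℕ.+-suc (differences y z) (differences z w))) (s≤s (diff-triangle y z w))
  ... | no _  | no _   | yes _ = s≤s (diff-triangle y z w)
  ... | no _  | no _   | no _  = s≤s (ℕ.≤-trans (diff-triangle y z w) (ℕ.+-monoʳ-≤ (differences y z) (ℕ.n≤1+n _)))
  ... | no p  | yes refl | yes refl = contradiction refl p

  walk-≥ : ∀ {D n} {y z : X D} → Walk y z n → differences y z ℕ.≤ n
  walk-≥ {y = y} [] = ℕ.≤-reflexive (diff-refl y)
  walk-≥ {y = y} {w} (_∷_ {z = z} {n = n} adj p) = ℕ.≤-trans (diff-triangle y z w)
    (subst (λ k → k ℕ.+ differences z w ℕ.≤ suc n) (sym adj) (s≤s (walk-≥ p)))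

  adj-∷ : ∀ {D} a {y z : X D} → Adjacent y z → Adjacent (a ∷ y) (a ∷ z)
  adj-∷ a p with a Fin.≟ a
  ... | yes _  = p
  ... | no a≢a = contradiction refl a≢a

  walk-∷ : ∀ {D n} a {y z : X D} → Walk y z n → Walk (a ∷ y) (a ∷ z) n
  walk-∷ a []      = []
  walk-∷ a {y} (_∷_ {z = z} p ps) = adj-∷ a {y} {z} p ∷ walk-∷ a ps

  adj-head : ∀ {D} {a b} (y : X D) → a ≢ b → Adjacent (a ∷ y) (b ∷ y)
  adj-head {a = a} {b} y a≢b with a Fin.≟ b
  ... | yes a≡b = contradiction a≡b a≢b
  ... | no _    = cong suc (diff-refl y)

  walk : ∀ {D} (y z : X D) → Walk y z (differences y z)
  walk []      []      = []
  walk (a ∷ y) (b ∷ z) with a Fin.≟ b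
  ... | yes refl = walk-∷ a (walk y z)
  ... | no a≢b   = adj-head y a≢b ∷ walk-∷ b (walk y z)

-- Distance is witnessed by shortest walks; its value is the number of
-- differing coordinates.
distance : ∀ {D} (y z : X D) → ∃ (IsDistance y z)
distance y z = differences y z , walk y z , λ _ → walk-≥

∂ : ∀ {D} → X D → X D → ℕ
∂ y z = proj₁ (distance y z)

-- The base vertex x = (0,…,0).
𝟎ₓ : ∀ {D} → X D
𝟎ₓ = replicate _ 0F

∑ₓ : ∀ {D} → (X D → ℂ) → ℂ
∑ₓ {zero}  f = f []
∑ₓ {suc D} f = ∑[ a < 2 ] ∑ₓ (λ y → f (a ∷ y))

V : ℕ → Set
V D = X D → ℂ

Mat : ℕ → Set
Mat D = X D → X D → ℂ

infix 4 _≈ᵥ_ _≈ₘ_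

_≈ᵥ_ : ∀ {D} → V D → V D → Set
v ≈ᵥ w = ∀ y → v y ≈ w y

_≈ₘ_ : ∀ {D} → Mat D → Mat D → Set
M ≈ₘ N = ∀ y z → M y z ≈ N y z

0ᵥ : ∀ {D} → V D
0ᵥ _ = 0#

infixl 6 _+ᵥ_ _+ₘ_ _-ₘ_
infixl 7 _·ₘ_
infixr 7 _•ᵥ_ _•ₘ_
infixr 8 _▹_

_+ᵥ_ : ∀ {D} → V D → V D → V D
(v +ᵥ w) y = v y + w y

_•ᵥ_ : ∀ {D} → ℂ → V D → V D
(c •ᵥ v) y = c * v y

_+ₘ_ _-ₘ_ _·ₘ_ : ∀ {D} → Mat D → Mat D → Mat D
(M +ₘ N) y z = M y z + N y z
(M -ₘ N) y z = M y z - N y z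
(M ·ₘ N) y z = ∑ₓ λ w → M y w * N w z

_•ₘ_ : ∀ {D} → ℂ → Mat D → Mat D
(c •ₘ M) y z = c * M y z

Iₘ : ∀ {D} → Mat D
Iₘ y z = if does (y ≟ₓ z) then 1# else 0#

_▹_ : ∀ {D} → Mat D → V D → V D
(M ▹ v) y = ∑ₓ λ z → M y z * v z

⟨_,_⟩ : ∀ {D} → V D → V D → ℂ
⟨ v , w ⟩ = ∑ₓ λ y → v y * conj (w y)

A : ∀ {D} → Mat D
A y z = if does (adjacent? y z) then 1# else 0#

θ : ℕ → ℕ → ℚ
θ D i = ℤ→ℚ (+ D ℤ.- + (2 ℕ.* i))

A* : ∀ {D} → Mat D
A* {D} y z = if does (y ≟ₓ z) then ι (θ D (∂ 𝟎ₓ y)) else 0#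

private
  ℤ→ℚ-injective : ∀ {a b} → ℤ→ℚ a ≡ ℤ→ℚ b → a ≡ b
  ℤ→ℚ-injective {a} {b} p with ℚ./-injective-≃ (ℚᵘ.mkℚᵘ a 0) (ℚᵘ.mkℚᵘ b 0) p
  ... | ℚᵘ.*≡* q = trans (sym (ℤ.*-identityʳ a)) (trans q (ℤ.*-identityʳ b))

  -‿zero : ∀ {p q} → p ℚ.- q ≡ 0ℚ → p ≡ q
  -‿zero {p} {q} eq = trans
    (ℚS.solve 2 (λ p q → p := (p :- q) :+ q) refl p q)
    (trans (cong (ℚ._+ q) eq) (ℚ.+-identityˡ q))
    where open ℚS

  θ-injective : ∀ D {i j} → θ D i ≡ θ D j → i ≡ j
  θ-injective D {i} {j} p = ℕ.*-cancelˡ-≡ i j 2 (ℤ.+-injective (ℤ.neg-injective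
    (GroupProperties.∙-cancelˡ (CommutativeRing.+-group ℤ.+-*-commutativeRing) (+ D) (ℤ.- + (2 ℕ.* i)) (ℤ.- + (2 ℕ.* j)) (ℤ→ℚ-injective p))))

θ-gap : ∀ D {i j} → i ≢ j → ℚ.NonZero (θ D i ℚ.- θ D j)
θ-gap D i≢j = ℚ.≢-nonZero λ eq → i≢j (θ-injective D (-‿zero eq))

E-factor : ∀ {D} → ℕ → ℕ → Mat D
E-factor {D} i j with i ℕ.≟ j
... | yes _  = Iₘ
... | no i≢j = ι (1/_ (θ D i ℚ.- θ D j) {{θ-gap D i≢j}}) •ₘ (A -ₘ ι (θ D j) •ₘ Iₘ)

-- The index is an arbitrary natural number, so that E (r + i) makes sense
-- before r + i ≤ D is known.  Only the values for i ≤ D are primitive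
-- idempotents.
E : ∀ {D} → ℕ → Mat D
E {D} i = foldr _·ₘ_ Iₘ (map (E-factor i) (upTo (suc D)))

E* : ∀ {D} → ℕ → Mat D
E* i y z = if does (y ≟ₓ z) then (if does (∂ 𝟎ₓ y ℕ.≟ i) then 1# else 0#) else 0#

KronPower : (Fin 2 → Fin 2 → ℂ) → ∀ {D} → Mat D
KronPower M {D} y z = prod {D} λ k → M (lookup y k) (lookup z k)

-- P is the change of basis from A to A^ε: P⁻¹ A P = A^ε = -𝐢(A A* - A* A)/2.
P₁ : Fin 2 → Fin 2 → ℂ
P₁ 0F _  = 1#
P₁ 1F 0F = - 𝐢
P₁ 1F 1F = 𝐢

P₁⁻¹ : Fin 2 → Fin 2 → ℂ
P₁⁻¹ _  0F = ι ½
P₁⁻¹ 0F 1F = ι ½ * 𝐢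
P₁⁻¹ 1F 1F = ι ½ * - 𝐢

P P⁻¹ : ∀ {D} → Mat D
P   = KronPower P₁
P⁻¹ = KronPower P₁⁻¹

private
  I₁ : Fin 2 → Fin 2 → ℂ
  I₁ a b = if does (a Fin.≟ b) then 1# else 0#

  ∑ₓ-cong : ∀ {D} {f g : X D → ℂ} → (∀ y → f y ≈ g y) → ∑ₓ f ≈ ∑ₓ g
  ∑ₓ-cong {zero}  p = p []
  ∑ₓ-cong {suc D} p = SemiringSum.sum-cong-≋ R.semiring {2} λ a → ∑ₓ-cong λ y → p (a ∷ y)

  ∑ₓ-distribˡ : ∀ {D} c (f : X D → ℂ) → ∑ₓ (λ y → c * f y) ≈ c * ∑ₓ f
  ∑ₓ-distribˡ {zero}  c f = R.refl
  ∑ₓ-distribˡ {suc D} c f = R.trans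
    (SemiringSum.sum-cong-≋ R.semiring {2} λ a → ∑ₓ-distribˡ c (f ∘ (a ∷_)))
    (R.sym (SemiringSum.*-distribˡ-sum R.semiring {2} c (λ a → ∑ₓ (f ∘ (a ∷_)))))

  Kron-· : ∀ M N K → (∀ a b → (∑[ c < 2 ] (M a c * N c b)) ≈ K a b) →
           ∀ {D} → KronPower M {D} ·ₘ KronPower N ≈ₘ KronPower K
  Kron-· M N K h [] [] = R.*-identityˡ 1#
  Kron-· M N K h (a ∷ y) (b ∷ z) = R.trans
    (SemiringSum.sum-cong-≋ R.semiring {2} λ c → R.trans
      (∑ₓ-cong λ w → interchange (M a c) (KronPower M y w) (N c b) (KronPower N w z))
      (R.trans (∑ₓ-distribˡ (M a c * N c b) (λ w → KronPower M y w * KronPower N w z))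
               (R.*-congˡ (Kron-· M N K h y z))))
    (R.trans (R.sym (SemiringSum.*-distribʳ-sum R.semiring {2} (KronPower K y z) (λ c → M a c * N c b)))
             (R.*-congʳ (h a b)))
    where
    open import Algebra.Properties.CommutativeSemigroup R.*-commutativeSemigroup using (interchange)

  Kron-I : ∀ {D} → KronPower I₁ {D} ≈ₘ Iₘ
  Kron-I [] [] = R.refl
  Kron-I (a ∷ y) (b ∷ z) with a Fin.≟ b | y ≟ₓ z | Kron-I y z
  ... | yes _ | yes _ | h = R.trans (R.*-identityˡ _) h
  ... | yes _ | no _  | h = R.trans (R.*-identityˡ _) h
  ... | no _  | _     | _ = R.zeroˡ _

  P₁P₁⁻¹ : ∀ a b → (∑[ c < 2 ] (P₁ a c * P₁⁻¹ c b)) ≈ I₁ a b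
  P₁P₁⁻¹ 0F 0F = pw (λ _ → refl) (λ _ → refl)
  P₁P₁⁻¹ 0F 1F = pw (λ _ → refl) (λ _ → refl)
  P₁P₁⁻¹ 1F 0F = pw (λ _ → refl) (λ _ → refl)
  P₁P₁⁻¹ 1F 1F = pw (λ _ → refl) (λ _ → refl)

  P₁⁻¹P₁ : ∀ a b → (∑[ c < 2 ] (P₁⁻¹ a c * P₁ c b)) ≈ I₁ a b
  P₁⁻¹P₁ 0F 0F = pw (λ _ → refl) (λ _ → refl)
  P₁⁻¹P₁ 0F 1F = pw (λ _ → refl) (λ _ → refl)
  P₁⁻¹P₁ 1F 0F = pw (λ _ → refl) (λ _ → refl)
  P₁⁻¹P₁ 1F 1F = pw (λ _ → refl) (λ _ → refl)

P-inverseʳ : ∀ {D} → P ·ₘ P⁻¹ ≈ₘ Iₘ {D}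
P-inverseʳ y z = R.trans (Kron-· P₁ P₁⁻¹ I₁ P₁P₁⁻¹ y z) (Kron-I y z)

P-inverseˡ : ∀ {D} → P⁻¹ ·ₘ P ≈ₘ Iₘ {D}
P-inverseˡ y z = R.trans (Kron-· P₁⁻¹ P₁ I₁ P₁⁻¹P₁ y z) (Kron-I y z)

Eᵋ : ∀ {D} → ℕ → Mat D
Eᵋ i = P⁻¹ ·ₘ E i ·ₘ P

data T {D : ℕ} : Pred (Mat D) 0ℓ where
  A∈T    : T A
  A*∈T   : T A*
  I∈T    : T Iₘ
  +-clos : ∀ {M N} → T M → T N → T (M +ₘ N)
  •-clos : ∀ c {M} → T M → T (c •ₘ M)
  ·-clos : ∀ {M N} → T M → T N → T (M ·ₘ N)
  ≈-clos : ∀ {M N} → M ≈ₘ N → T M → T N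

record IsSubspace {D : ℕ} (W : Pred (V D) 0ℓ) : Set where
  field
    ≈-closed : ∀ {v w} → v ≈ᵥ w → v ∈ W → w ∈ W
    0-closed : 0ᵥ ∈ W
    +-closed : ∀ {v w} → v ∈ W → w ∈ W → v +ᵥ w ∈ W
    •-closed : ∀ c {v} → v ∈ W → c •ᵥ v ∈ W

𝟘 : ∀ {D} → Pred (V D) 0ℓ
𝟘 v = v ≈ᵥ 0ᵥ

record IsTModule {D : ℕ} (W : Pred (V D) 0ℓ) : Set where
  field
    isSubspace : IsSubspace W
    T-closed   : ∀ {B} → B ∈ T → ∀ {w} → w ∈ W → B ▹ w ∈ W

-- "Contains no other T-modules" is a negative statement, and is kept
-- negative: asking for the disjunction U ≐ 𝟘 ⊎ U ≐ W would make excluded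
-- middle a consequence of the existence of an irreducible module.
record IsIrreducible {D : ℕ} (W : Pred (V D) 0ℓ) : Set₁ where
  field
    isTModule : IsTModule W
    nonzero   : ¬ (W ≐ 𝟘)
    minimal   : (U : Pred (V D) 0ℓ) → IsTModule U → U ⊆ W → ¬ (¬ (U ≐ 𝟘) × ¬ (U ≐ W))

infix 9 _⟦_⟧

_⟦_⟧ : ∀ {D} → Mat D → Pred (V D) 0ℓ → Pred (V D) 0ℓ
(M ⟦ W ⟧) v = ∃ λ w → w ∈ W × v ≈ᵥ M ▹ w

record IsEndpoint {D : ℕ} (W : Pred (V D) 0ℓ) (r : ℕ) : Set where
  field
    r≤D     : r ℕ.≤ D
    nonzero : ¬ (E* r ⟦ W ⟧ ≐ 𝟘)
    least   : ∀ i → i ℕ.≤ D → ¬ (E* i ⟦ W ⟧ ≐ 𝟘) → r ℕ.≤ i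

record IsDiameter {D : ℕ} (W : Pred (V D) 0ℓ) (d : ℕ) : Set where
  field
    support  : Subset.Subset (suc D)
    spec     : ∀ i → i Subset.∈ support ⇔ (¬ (E* (toℕ i) ⟦ W ⟧ ≐ 𝟘))
    size     : Subset.∣ support ∣ ≡ suc d

pochhammer : ℚ → ℕ → ℚ
pochhammer a zero    = 1ℚ
pochhammer a (suc n) = pochhammer a n ℚ.* (a ℚ.+ ℕ→ℚ n)

private
  *-nz : ∀ {p q} → p ≢ 0ℚ → q ≢ 0ℚ → p ℚ.* q ≢ 0ℚ
  *-nz {p} {q} p≢0 q≢0 eq = q≢0 (begin
    q                   ≡⟨ ℚ.*-identityˡ q ⟨
    1ℚ ℚ.* q            ≡⟨ cong (ℚ._* q) (ℚ.*-inverseˡ p) ⟨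
    1/ p ℚ.* p ℚ.* q    ≡⟨ ℚ.*-assoc (1/ p) p q ⟩
    1/ p ℚ.* (p ℚ.* q)  ≡⟨ cong (1/ p ℚ.*_) eq ⟩
    1/ p ℚ.* 0ℚ         ≡⟨ ℚ.*-zeroʳ (1/ p) ⟩
    0ℚ                  ∎)
    where
    open ≡-Reasoning
    instance _ = ℚ.≢-nonZero p≢0

  ℕ→ℚ-injective : ∀ {m n} → ℕ→ℚ m ≡ ℕ→ℚ n → m ≡ n
  ℕ→ℚ-injective p = ℤ.+-injective (ℤ→ℚ-injective p)

  pochhammer-nz : ∀ d n → n ℕ.≤ d → pochhammer (ℚ.- ℕ→ℚ d) n ≢ 0ℚ
  pochhammer-nz d zero    _   = λ ()
  pochhammer-nz d (suc n) n<d = *-nz (pochhammer-nz d n (ℕ.<⇒≤ n<d)) λ eq →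
    ℕ.<⇒≢ n<d (ℕ→ℚ-injective (-‿zero
      (trans (ℚ.+-comm (ℕ→ℚ n) (ℚ.- ℕ→ℚ d)) eq)))

denominator : ℕ → ℕ → ℚ
denominator d n = pochhammer (ℚ.- ℕ→ℚ d) n ℚ.* ℕ→ℚ (n !)

denominator-nz : ∀ d (n : Fin (suc d)) → ℚ.NonZero (denominator d (toℕ n))
denominator-nz d n = ℚ.≢-nonZero (*-nz
  (pochhammer-nz d (toℕ n) (ℕ.≤-pred (Fin.toℕ<n n)))
  (λ eq → ℕ.≢-nonZero⁻¹ (toℕ n !) {{ℕ._!≢0 (toℕ n)}} (ℕ→ℚ-injective eq)))

-- ₂F₁ i j d is the terminating series with upper parameters -i, -j, lower
-- parameter -d and argument 2, summed over 0 ≤ n ≤ d.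
₂F₁ : ℕ → ℕ → ℕ → ℂ
₂F₁ i j d = ∑[ n < suc d ] ι (
  (_÷_ (pochhammer (ℚ.- ℕ→ℚ i) (toℕ n) ℚ.* pochhammer (ℚ.- ℕ→ℚ j) (toℕ n))
       (denominator d (toℕ n)) {{denominator-nz d n}})
  ℚ.* ℕ→ℚ (2 ℕ.^ toℕ n))

{-# OPTIONS --safe #-}

-- The operators A, A* and Aᵋ span a copy of sl₂ acting on V = (ℂ²)^⊗D by derivations,
-- and P permutes them cyclically; hence all three formulas are one statement about
-- the pair A, A*, read in the frames 1, P⁻¹ and P.
--
-- The Casimir operator Ω = A² + A*² + (Aᵋ)² commutes with T and with P.  On a vector
-- of E*ᵣW, which the lowering operator kills, it acts as m(m + 2), where m = D - 2r;
-- by Schur's lemma it does so on W, which forces m = d.  In any frame, a vector of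
-- weight m on which Ω acts as m(m + 2) is killed by the lowering operator, so that the
-- transported vectors x again generate a ladder x, Rx, R²x/2!, …, ending at step d.
-- On the ladder the eigenvectors of A are Σⱼ F(i,j) Rʲx/j!, because F = ₂F₁ satisfies
-- the three-term recurrence in j, and x = 2⁻ᵈ Σᵢ (d choose i) Σⱼ F(i,j) Rʲx/j!.
-- Finally ⟨Rʲx/j!, w⟩ = (d choose j) ⟨x, w⟩ for every w with Aw = dw.
--
-- Equality in ℂ is stable under double negation, so classical case distinctions are
-- available in the proof of any equation.
module Submission where

open import Level using (0ℓ)
open import Algebra.Bundles using (CommutativeRing)
import Algebra.Properties.Monoid.Sum as MonoidSum
import Algebra.Solver.Ring
import Algebra.Solver.Ring.AlmostCommutativeRing as ACR
open import Data.Bool.Base using (if_then_else_)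
open import Data.Fin.Base as Fin using (Fin; toℕ; fromℕ; inject₁; fromℕ<)
open import Data.Fin.Patterns using (0F; 1F)
import Data.Fin.Properties as Fin
import Data.Fin.Subset as Subset
open import Data.Fin.Subset.Properties using (drop-there)
open import Data.Integer.Base as ℤ using (+_)
import Data.Integer.Properties as ℤ
open import Data.List.Base using (List; []; _∷_; foldr; map; upTo)
import Data.List.Membership.Propositional as List
open import Data.List.Membership.Propositional.Properties using (∈-upTo⁺)
open import Data.List.Relation.Unary.Any using (here; there)
open import Data.Maybe.Base using (just; nothing)
open import Data.Nat.Base as ℕ using (ℕ; zero; suc; NonZero; _≤_; _!)
open import Data.Nat.Combinatorics using (_C_; nCk+nC[k+1]≡[n+1]C[k+1]; k>n⇒nCk≡0; nC1≡n)
import Data.Nat.Properties as ℕ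
open import Data.Product.Base using (_×_; _,_; ∃; proj₁; proj₂)
open import Data.Rational.Base as ℚ using (ℚ; 0ℚ; 1ℚ; ½; ∣_∣; 1/_)
import Data.Rational.Properties as ℚ
open import Data.Rational.Solver using (module +-*-Solver)
import Data.Rational.Unnormalised.Base as ℚᵘ
import Data.Rational.Unnormalised.Properties as ℚᵘ
open import Data.Vec.Base using ([]; _∷_; here; there)
open import Function.Base using (_∘_)
open import Function.Bundles using (Equivalence; _⇔_; mk⇔)
open import Relation.Binary.Definitions using (WeaklyDecidable)
open import Relation.Binary.PropositionalEquality
  using (_≡_; _≢_; refl; sym; trans; cong; cong₂; subst; subst₂; module ≡-Reasoning)
open import Relation.Nullary using (¬_; Dec; yes; no; does)
open import Relation.Nullary.Decidable using (decidable-stable)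
open import Relation.Nullary.Negation using (contradiction)
open import Relation.Unary using (Pred; _∈_; _≐_)
open import Defs

-- Complex scalars

-- Stability of `W` under `P` is never established, so the minimality of the endpoint, which speaks
-- of `W`, gives no direct hold on the transported vectors. What does survive a change of frame is
-- an eigenvalue equation, and the one for `Ω` is strong enough to replace the missing minimality.
-- Derivations and group-like maps reduce every operator identity to a check on 2×2 matrices:
-- commutators, intertwining relations and the isometry property are all settled in one tensor
-- factor. The series enters through the matrix of `A` on divided powers: `A` sends rung `j` to
-- `(d - j + 1)` times rung `j - 1` plus `(j + 1)` times rung `j + 1`. Comparing coefficients of
-- rung `j` in an eigenvector for `d - 2i` gives `j F(j - 1) + (d - j) F(j + 1) = (d - 2i)
-- F(j)`, which is the recurrence proved for `F`. The relation `D = 2r + d` is derived: the diameter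
-- is given only as a cardinality.

module R = CommutativeRing ℂ-commutativeRing
module ℚS = +-*-Solver

two : ℚ
two = ℕ→ℚ 2

≈-pointwise : ∀ {z w} → (∀ n → seq (re z) n ≡ seq (re w) n) →
              (∀ n → seq (im z) n ≡ seq (im w) n) → z ≈ w
≈-pointwise p q = mk≈ᶜ (pointwise⇒≈ᵣ p) (pointwise⇒≈ᵣ q)

-- The index comes from the moduli of `x` and `y` alone, before the double negation is opened. What
-- remains is a comparison of rationals, which is decidable, and there a later index `k` supplied by
-- `p` may serve as an intermediary.
≈ᵣ-stable : ∀ {x y} → ¬ ¬ (x ≈ᵣ y) → x ≈ᵣ y
≈ᵣ-stable {x} {y} ¬¬p = mk≈ᵣ λ ε 0<ε →
  -- Three errors have to be added. A quarter is obtained by halving twice, and `split` pads the sum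
  -- with a fourth quarter.
  let η    = ½ ℚ.* (½ ℚ.* ε)
      0<η  = half-pos (half-pos 0<ε)
      M , f = cauchy x η 0<η
      N , g = cauchy y η 0<η
  in M ℕ.⊔ N , λ n le → decidable-stable (_ ℚ.≤? ε) λ ¬le → ¬¬p λ p →
     let K , h = close p η 0<η
         k     = (M ℕ.⊔ N) ℕ.⊔ K
         M≤ = ℕ.m≤m⊔n M N
         N≤ = ℕ.m≤n⊔m M N
         MN≤k = ℕ.m≤m⊔n (M ℕ.⊔ N) K
     in ¬le (split ε (seq x n) (seq x k) (seq y k) (seq y n)
          (f n k (ℕ.≤-trans M≤ le) (ℕ.≤-trans M≤ MN≤k))
          (h k (ℕ.m≤n⊔m (M ℕ.⊔ N) K))
          (g k n (ℕ.≤-trans N≤ MN≤k) (ℕ.≤-trans N≤ le))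
          (ℚ.<⇒≤ 0<η))
  where
  half-pos : ∀ {ε} → 0ℚ ℚ.< ε → 0ℚ ℚ.< ½ ℚ.* ε
  half-pos {ε} 0<ε = subst (ℚ._< ½ ℚ.* ε) (ℚ.*-zeroʳ ½) (ℚ.*-monoʳ-<-pos ½ 0<ε)

  split : ∀ ε a b c d → let η = ½ ℚ.* (½ ℚ.* ε) in
          ∣ a ℚ.- b ∣ ℚ.≤ η → ∣ b ℚ.- c ∣ ℚ.≤ η → ∣ c ℚ.- d ∣ ℚ.≤ η → 0ℚ ℚ.≤ η → ∣ a ℚ.- d ∣ ℚ.≤ ε
  split ε a b c d p q r 0≤η = begin
    ∣ a ℚ.- d ∣
      ≡⟨ cong ∣_∣ (solve 4 (λ a b c d → a :- d := ((a :- b) :+ (b :- c)) :+ (c :- d)) refl a b c d) ⟩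
    ∣ ((a ℚ.- b) ℚ.+ (b ℚ.- c)) ℚ.+ (c ℚ.- d) ∣
      ≤⟨ ℚ.∣p+q∣≤∣p∣+∣q∣ ((a ℚ.- b) ℚ.+ (b ℚ.- c)) (c ℚ.- d) ⟩
    ∣ (a ℚ.- b) ℚ.+ (b ℚ.- c) ∣ ℚ.+ ∣ c ℚ.- d ∣
      ≤⟨ ℚ.+-monoˡ-≤ _ (ℚ.∣p+q∣≤∣p∣+∣q∣ (a ℚ.- b) (b ℚ.- c)) ⟩
    ∣ a ℚ.- b ∣ ℚ.+ ∣ b ℚ.- c ∣ ℚ.+ ∣ c ℚ.- d ∣
      ≤⟨ ℚ.+-mono-≤ (ℚ.+-mono-≤ p q) r ⟩
    η ℚ.+ η ℚ.+ η
      ≡⟨ ℚ.+-identityʳ _ ⟨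
    η ℚ.+ η ℚ.+ η ℚ.+ 0ℚ
      ≤⟨ ℚ.+-monoʳ-≤ (η ℚ.+ η ℚ.+ η) 0≤η ⟩
    η ℚ.+ η ℚ.+ η ℚ.+ η
      ≡⟨ solve 1 (λ e → let h = con ½ :* (con ½ :* e) in h :+ h :+ h :+ h := e) refl ε ⟩
    ε ∎
    where
    open ℚ.≤-Reasoning
    open ℚS
    η = ½ ℚ.* (½ ℚ.* ε)

≈-stable : ∀ {z w} → ¬ ¬ (z ≈ w) → z ≈ w
≈-stable ¬¬p = mk≈ᶜ (≈ᵣ-stable λ k → ¬¬p (k ∘ re≈)) (≈ᵣ-stable λ k → ¬¬p (k ∘ im≈))

ι-cong : ∀ {p q} → p ≡ q → ι p ≈ ι q
ι-cong refl = R.refl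

ι-+ : ∀ p q → ι (p ℚ.+ q) ≈ ι p + ι q
ι-+ p q = ≈-pointwise (λ _ → refl) (λ _ → refl)

ι-* : ∀ p q → ι (p ℚ.* q) ≈ ι p * ι q
ι-* p q = ≈-pointwise
  (λ _ → ℚS.solve 2 (λ p q → p :* q := p :* q :- con 0ℚ :* con 0ℚ) refl p q)
  (λ _ → ℚS.solve 2 (λ p q → con 0ℚ := p :* con 0ℚ :+ con 0ℚ :* q) refl p q)
  where open ℚS

ι-neg : ∀ p → ι (ℚ.- p) ≈ - ι p
ι-neg p = ≈-pointwise (λ _ → refl) (λ _ → refl)

ℂ-almostCommutativeRing : ACR.AlmostCommutativeRing 0ℓ 0ℓ
ℂ-almostCommutativeRing = ACR.fromCommutativeRing ℂ-commutativeRing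

ℚ-rawRing = ACR.AlmostCommutativeRing.rawRing (ACR.fromCommutativeRing ℚ.+-*-commutativeRing)

ι-morphism : ℚ-rawRing ACR.-Raw-AlmostCommutative⟶ ℂ-almostCommutativeRing
ι-morphism = record
  { ⟦_⟧ = ι ; +-homo = ι-+ ; *-homo = ι-* ; -‿homo = ι-neg ; 0-homo = R.refl ; 1-homo = R.refl }

ι-weakly≟ : WeaklyDecidable (ACR.Induced-equivalence ι-morphism)
ι-weakly≟ p q with p ℚ.≟ q
... | yes p≡q = just (ι-cong p≡q)
... | no _    = nothing

-- A solver for ℂ with rational coefficients: constants such as `con ½` are computed with instead of
-- being treated as variables.
module ℂS = Algebra.Solver.Ring ℚ-rawRing ℂ-almostCommutativeRing ι-morphism ι-weakly≟

ι-cancel : ∀ {q z} → q ≢ 0ℚ → ι q * z ≈ 0# → z ≈ 0#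
ι-cancel {q} {z} q≢0 eq = begin
  z                      ≈⟨ R.*-identityˡ z ⟨
  1# * z                 ≈⟨ R.*-congʳ (ι-cong (ℚ.*-inverseˡ q)) ⟨
  ι (1/ q ℚ.* q) * z     ≈⟨ R.*-congʳ (ι-* (1/ q) q) ⟩
  ι (1/ q) * ι q * z     ≈⟨ R.*-assoc _ _ _ ⟩
  ι (1/ q) * (ι q * z)   ≈⟨ R.*-congˡ eq ⟩
  ι (1/ q) * 0#          ≈⟨ R.zeroʳ _ ⟩
  0#                     ∎
  where
  open import Relation.Binary.Reasoning.Setoid R.setoid
  instance _ = ℚ.≢-nonZero q≢0

-- Reduction to lowest terms does not compute on variables. Unnormalised fractions avoid it, and the
-- homomorphism laws that follow become identities of integers.
ℤ→ℚ-toℚᵘ : ∀ a → ℚ.toℚᵘ (ℤ→ℚ a) ℚᵘ.≃ ℚᵘ.mkℚᵘ a 0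
ℤ→ℚ-toℚᵘ a = ℚ.toℚᵘ-fromℚᵘ (ℚᵘ.mkℚᵘ a 0)

ℤ→ℚ-+ : ∀ a b → ℤ→ℚ (a ℤ.+ b) ≡ ℤ→ℚ a ℚ.+ ℤ→ℚ b
ℤ→ℚ-+ a b = ℚ.toℚᵘ-injective (begin
  ℚ.toℚᵘ (ℤ→ℚ (a ℤ.+ b))                     ≈⟨ ℤ→ℚ-toℚᵘ (a ℤ.+ b) ⟩
  ℚᵘ.mkℚᵘ (a ℤ.+ b) 0                        ≈⟨ ℚᵘ.*≡* (cong (ℤ._* + 1) (cong₂ ℤ._+_ (sym (ℤ.*-identityʳ a)) (sym (ℤ.*-identityʳ b)))) ⟩
  ℚᵘ.mkℚᵘ a 0 ℚᵘ.+ ℚᵘ.mkℚᵘ b 0               ≈⟨ ℚᵘ.+-cong (ℤ→ℚ-toℚᵘ a) (ℤ→ℚ-toℚᵘ b) ⟨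
  ℚ.toℚᵘ (ℤ→ℚ a) ℚᵘ.+ ℚ.toℚᵘ (ℤ→ℚ b)         ≈⟨ ℚ.toℚᵘ-homo-+ (ℤ→ℚ a) (ℤ→ℚ b) ⟨
  ℚ.toℚᵘ (ℤ→ℚ a ℚ.+ ℤ→ℚ b)                   ∎)
  where open import Relation.Binary.Reasoning.Setoid ℚᵘ.≃-setoid

ℤ→ℚ-* : ∀ a b → ℤ→ℚ (a ℤ.* b) ≡ ℤ→ℚ a ℚ.* ℤ→ℚ b
ℤ→ℚ-* a b = ℚ.toℚᵘ-injective (begin
  ℚ.toℚᵘ (ℤ→ℚ (a ℤ.* b))                     ≈⟨ ℤ→ℚ-toℚᵘ (a ℤ.* b) ⟩
  ℚᵘ.mkℚᵘ a 0 ℚᵘ.* ℚᵘ.mkℚᵘ b 0               ≈⟨ ℚᵘ.*-cong (ℤ→ℚ-toℚᵘ a) (ℤ→ℚ-toℚᵘ b) ⟨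
  ℚ.toℚᵘ (ℤ→ℚ a) ℚᵘ.* ℚ.toℚᵘ (ℤ→ℚ b)         ≈⟨ ℚ.toℚᵘ-homo-* (ℤ→ℚ a) (ℤ→ℚ b) ⟨
  ℚ.toℚᵘ (ℤ→ℚ a ℚ.* ℤ→ℚ b)                   ∎)
  where open import Relation.Binary.Reasoning.Setoid ℚᵘ.≃-setoid

ℤ→ℚ-neg : ∀ a → ℤ→ℚ (ℤ.- a) ≡ ℚ.- ℤ→ℚ a
ℤ→ℚ-neg a = ℚ.toℚᵘ-injective (begin
  ℚ.toℚᵘ (ℤ→ℚ (ℤ.- a))       ≈⟨ ℤ→ℚ-toℚᵘ (ℤ.- a) ⟩
  ℚᵘ.- ℚᵘ.mkℚᵘ a 0           ≈⟨ ℚᵘ.-‿cong (ℤ→ℚ-toℚᵘ a) ⟨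
  ℚᵘ.- ℚ.toℚᵘ (ℤ→ℚ a)        ≈⟨ ℚ.toℚᵘ-homo‿- (ℤ→ℚ a) ⟨
  ℚ.toℚᵘ (ℚ.- ℤ→ℚ a)         ∎)
  where open import Relation.Binary.Reasoning.Setoid ℚᵘ.≃-setoid

ℤ→ℚ-injective : ∀ {a b} → ℤ→ℚ a ≡ ℤ→ℚ b → a ≡ b
ℤ→ℚ-injective {a} {b} p with ℚ./-injective-≃ (ℚᵘ.mkℚᵘ a 0) (ℚᵘ.mkℚᵘ b 0) p
... | ℚᵘ.*≡* q = trans (sym (ℤ.*-identityʳ a)) (trans q (ℤ.*-identityʳ b))

ℕ→ℚ-+ : ∀ m n → ℕ→ℚ (m ℕ.+ n) ≡ ℕ→ℚ m ℚ.+ ℕ→ℚ n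
ℕ→ℚ-+ m n = ℤ→ℚ-+ (+ m) (+ n)

ℕ→ℚ-* : ∀ m n → ℕ→ℚ (m ℕ.* n) ≡ ℕ→ℚ m ℚ.* ℕ→ℚ n
ℕ→ℚ-* m n = trans (cong ℤ→ℚ (ℤ.pos-* m n)) (ℤ→ℚ-* (+ m) (+ n))

ℕ→ℚ-suc : ∀ n → ℕ→ℚ (suc n) ≡ 1ℚ ℚ.+ ℕ→ℚ n
ℕ→ℚ-suc n = ℕ→ℚ-+ 1 n

ℕ→ℚ-suc≢0 : ∀ n → ℕ→ℚ (suc n) ≢ 0ℚ
ℕ→ℚ-suc≢0 n p with () ← ℤ→ℚ-injective {+ suc n} {+ 0} p

θ-ℕ : ∀ D i → θ D i ≡ ℕ→ℚ D ℚ.- two ℚ.* ℕ→ℚ i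
θ-ℕ D i = begin
  ℤ→ℚ (+ D ℤ.- + (2 ℕ.* i))               ≡⟨ ℤ→ℚ-+ (+ D) (ℤ.- + (2 ℕ.* i)) ⟩
  ℕ→ℚ D ℚ.+ ℤ→ℚ (ℤ.- + (2 ℕ.* i))         ≡⟨ cong (ℕ→ℚ D ℚ.+_) (ℤ→ℚ-neg (+ (2 ℕ.* i))) ⟩
  ℕ→ℚ D ℚ.- ℕ→ℚ (2 ℕ.* i)                 ≡⟨ cong (λ t → ℕ→ℚ D ℚ.- t) (ℕ→ℚ-* 2 i) ⟩
  ℕ→ℚ D ℚ.- two ℚ.* ℕ→ℚ i               ∎
  where open ≡-Reasoning

ℚ-cancel : ∀ {p q} → p ≢ 0ℚ → p ℚ.* q ≡ 0ℚ → q ≡ 0ℚ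
ℚ-cancel {p} {q} p≢0 eq = begin
  q                   ≡⟨ ℚ.*-identityˡ q ⟨
  1ℚ ℚ.* q            ≡⟨ cong (ℚ._* q) (ℚ.*-inverseˡ p) ⟨
  1/ p ℚ.* p ℚ.* q    ≡⟨ ℚ.*-assoc (1/ p) p q ⟩
  1/ p ℚ.* (p ℚ.* q)  ≡⟨ cong (1/ p ℚ.*_) eq ⟩
  1/ p ℚ.* 0ℚ         ≡⟨ ℚ.*-zeroʳ (1/ p) ⟩
  0ℚ                  ∎
  where
  open ≡-Reasoning
  instance _ = ℚ.≢-nonZero p≢0

-- The hypergeometric sum

-- The last term is split off, so that identities for partial sums telescope by induction on the
-- upper limit. `₂F₁-F` makes the link to the sum over `Fin`.
Σℚ : ℕ → (ℕ → ℚ) → ℚ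
Σℚ zero    f = 0ℚ
Σℚ (suc n) f = Σℚ n f ℚ.+ f n

Σℚ-cong : ∀ n {f g} → (∀ k → k ℕ.< n → f k ≡ g k) → Σℚ n f ≡ Σℚ n g
Σℚ-cong zero    h = refl
Σℚ-cong (suc n) h = cong₂ ℚ._+_ (Σℚ-cong n λ k k<n → h k (ℕ.m<n⇒m<1+n k<n)) (h n ℕ.≤-refl)

-- inv 0 = 0.
inv : ℚ → ℚ
inv q with q ℚ.≟ 0ℚ
... | yes _  = 0ℚ
... | no q≢0 = 1/_ q {{ℚ.≢-nonZero q≢0}}

inv-1/ : ∀ q .{{_ : ℚ.NonZero q}} → inv q ≡ 1/ q
inv-1/ q {{nz}} with q ℚ.≟ 0ℚ
-- At `0ℚ` the instance reduces to `ℕ.NonZero 0`, through the numerator.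
... | yes refl = contradiction refl (ℕ.≢-nonZero⁻¹ 0 {{nz}})
... | no _     = refl

*-inv : ∀ q → ℚ.NonZero q → q ℚ.* inv q ≡ 1ℚ
*-inv q nz = trans (cong (q ℚ.*_) (inv-1/ q {{nz}})) (ℚ.*-inverseʳ q {{nz}})

denominator-nonZero : ∀ {d n} → n ≤ d → ℚ.NonZero (denominator d n)
denominator-nonZero {d} {n} n≤d =
  subst (λ k → ℚ.NonZero (denominator d k)) (Fin.toℕ-fromℕ< (ℕ.s≤s n≤d)) (denominator-nz d (fromℕ< (ℕ.s≤s n≤d)))

denominator-suc : ∀ d n → denominator d (suc n) ≡
                  denominator d n ℚ.* ((ℕ→ℚ n ℚ.- ℕ→ℚ d) ℚ.* (1ℚ ℚ.+ ℕ→ℚ n))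
denominator-suc d n = begin
  p ℚ.* (ℚ.- ℕ→ℚ d ℚ.+ ℕ→ℚ n) ℚ.* ℕ→ℚ (suc n !)
    ≡⟨ cong (p ℚ.* (ℚ.- ℕ→ℚ d ℚ.+ ℕ→ℚ n) ℚ.*_) (trans (ℕ→ℚ-* (suc n) (n !)) (cong (ℚ._* ℕ→ℚ (n !)) (ℕ→ℚ-suc n))) ⟩
  p ℚ.* (ℚ.- ℕ→ℚ d ℚ.+ ℕ→ℚ n) ℚ.* ((1ℚ ℚ.+ ℕ→ℚ n) ℚ.* ℕ→ℚ (n !))
    ≡⟨ solve 4 (λ p d n f → p :* (:- d :+ n) :* ((con 1ℚ :+ n) :* f) := p :* f :* ((n :- d) :* (con 1ℚ :+ n)))
         refl p (ℕ→ℚ d) (ℕ→ℚ n) (ℕ→ℚ (n !)) ⟩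
  p ℚ.* ℕ→ℚ (n !) ℚ.* ((ℕ→ℚ n ℚ.- ℕ→ℚ d) ℚ.* (1ℚ ℚ.+ ℕ→ℚ n)) ∎
  where
  open ≡-Reasoning
  open ℚS
  p = pochhammer (ℚ.- ℕ→ℚ d) n

-- The ratio of consecutive denominators with the division cleared. In the telescoping argument the
-- inverse is then a mere variable for the ring solver.
inv-denominator-suc : ∀ d n → n ℕ.< d →
  inv (denominator d (suc n)) ℚ.* ((ℕ→ℚ n ℚ.- ℕ→ℚ d) ℚ.* (1ℚ ℚ.+ ℕ→ℚ n)) ≡ inv (denominator d n)
inv-denominator-suc d n n<d = begin
  e′ ℚ.* c                    ≡⟨ ℚ.*-identityˡ _ ⟨
  1ℚ ℚ.* (e′ ℚ.* c)           ≡⟨ cong (ℚ._* (e′ ℚ.* c)) (*-inv b (denominator-nonZero (ℕ.<⇒≤ n<d))) ⟨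
  b ℚ.* e ℚ.* (e′ ℚ.* c)      ≡⟨ solve 4 (λ b e e′ c → b :* e :* (e′ :* c) := b :* c :* e′ :* e) refl b e e′ c ⟩
  b ℚ.* c ℚ.* e′ ℚ.* e        ≡⟨ cong (λ t → t ℚ.* e′ ℚ.* e) (denominator-suc d n) ⟨
  denominator d (suc n) ℚ.* e′ ℚ.* e  ≡⟨ cong (ℚ._* e) (*-inv (denominator d (suc n)) (denominator-nonZero n<d)) ⟩
  1ℚ ℚ.* e                    ≡⟨ ℚ.*-identityˡ e ⟩
  e                           ∎
  where
  open ≡-Reasoning
  open ℚS
  b  = denominator d n
  e  = inv b
  e′ = inv (denominator d (suc n))
  c  = (ℕ→ℚ n ℚ.- ℕ→ℚ d) ℚ.* (1ℚ ℚ.+ ℕ→ℚ n)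

-[_]_ : ℕ → ℕ → ℚ
-[ i ] n = pochhammer (ℚ.- ℕ→ℚ i) n

F-term : ℕ → ℕ → ℕ → ℕ → ℚ
F-term d i j n = (-[ i ] n ℚ.* -[ j ] n) ℚ.* inv (denominator d n) ℚ.* ℕ→ℚ (2 ℕ.^ n)

F : ℕ → ℕ → ℕ → ℚ
F d i j = Σℚ (suc d) (F-term d i j)

F-sym : ∀ d i j → F d i j ≡ F d j i
F-sym d i j = Σℚ-cong (suc d) λ n _ →
  cong (λ t → t ℚ.* inv (denominator d n) ℚ.* ℕ→ℚ (2 ℕ.^ n)) (ℚ.*-comm (-[ i ] n) (-[ j ] n))

pochhammer-vanish : ∀ i n → i ℕ.< n → -[ i ] n ≡ 0ℚ
pochhammer-vanish i (suc n) i<1+n with i ℕ.≟ n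
... | yes refl = trans (cong (-[ i ] n ℚ.*_) (ℚ.+-inverseˡ (ℕ→ℚ n))) (ℚ.*-zeroʳ (-[ i ] n))
... | no i≢n   = trans (cong (ℚ._* (ℚ.- ℕ→ℚ i ℚ.+ ℕ→ℚ n)) (pochhammer-vanish i n (ℕ.≤∧≢⇒< (ℕ.≤-pred i<1+n) i≢n)))
                       (ℚ.*-zeroˡ (ℚ.- ℕ→ℚ i ℚ.+ ℕ→ℚ n))

-- This is minus the symbol of length `d + 1`, which contains a zero factor because `i ≤ d`. It
-- disposes of the boundary term in `F-recurrence`.
pochhammer-top : ∀ {d i} → i ≤ d → (ℕ→ℚ i ℚ.- ℕ→ℚ d) ℚ.* -[ i ] d ≡ 0ℚ
pochhammer-top {d} {i} i≤d = begin
  (ℕ→ℚ i ℚ.- ℕ→ℚ d) ℚ.* -[ i ] d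
    ≡⟨ solve 3 (λ i d p → (i :- d) :* p := :- (p :* (:- i :+ d))) refl (ℕ→ℚ i) (ℕ→ℚ d) (-[ i ] d) ⟩
  ℚ.- (-[ i ] (suc d))
    ≡⟨ cong ℚ.-_ (pochhammer-vanish i (suc d) (ℕ.s≤s i≤d)) ⟩
  0ℚ ∎
  where
  open ≡-Reasoning
  open ℚS

-- Peels off the first factor of the rising product, where the definition peels off the last.
pochhammer-shift : ∀ j n → -[ suc j ] (suc n) ≡ (ℚ.- ℕ→ℚ j ℚ.- 1ℚ) ℚ.* -[ j ] n
pochhammer-shift j zero rewrite ℕ→ℚ-suc j = solve 1 (λ j → con 1ℚ :* (:- (con 1ℚ :+ j) :+ con 0ℚ) := (:- j :- con 1ℚ) :* con 1ℚ) refl (ℕ→ℚ j)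
  where open ℚS
pochhammer-shift j (suc n) = begin
  -[ suc j ] (suc n) ℚ.* (ℚ.- ℕ→ℚ (suc j) ℚ.+ ℕ→ℚ (suc n))
    ≡⟨ cong₂ ℚ._*_ (pochhammer-shift j n) (cong₂ (λ s t → ℚ.- s ℚ.+ t) (ℕ→ℚ-suc j) (ℕ→ℚ-suc n)) ⟩
  (ℚ.- ℕ→ℚ j ℚ.- 1ℚ) ℚ.* p ℚ.* (ℚ.- (1ℚ ℚ.+ ℕ→ℚ j) ℚ.+ (1ℚ ℚ.+ ℕ→ℚ n))
    ≡⟨ solve 3 (λ j n p → (:- j :- con 1ℚ) :* p :* (:- (con 1ℚ :+ j) :+ (con 1ℚ :+ n)) := (:- j :- con 1ℚ) :* (p :* (:- j :+ n))) refl (ℕ→ℚ j) (ℕ→ℚ n) p ⟩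
  (ℚ.- ℕ→ℚ j ℚ.- 1ℚ) ℚ.* (p ℚ.* (ℚ.- ℕ→ℚ j ℚ.+ ℕ→ℚ n)) ∎
  where
  open ≡-Reasoning
  open ℚS
  p = -[ j ] n

-- At `j = 0` both sides vanish, the left one through its factor and the right one because `n = 0`
-- or the symbol is zero. This admits `ℕ.pred` and a recurrence uniform in `j`.
pochhammer-pred : ∀ j n → ℕ→ℚ j ℚ.* -[ ℕ.pred j ] n ≡ (ℕ→ℚ j ℚ.- ℕ→ℚ n) ℚ.* -[ j ] n
pochhammer-pred zero zero = refl
pochhammer-pred zero (suc n) = begin
  0ℚ ℚ.* -[ 0 ] (suc n)                    ≡⟨ ℚ.*-zeroˡ (-[ 0 ] (suc n)) ⟩
  0ℚ                                       ≡⟨ ℚ.*-zeroʳ (0ℚ ℚ.- ℕ→ℚ (suc n)) ⟨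
  (0ℚ ℚ.- ℕ→ℚ (suc n)) ℚ.* 0ℚ              ≡⟨ cong ((0ℚ ℚ.- ℕ→ℚ (suc n)) ℚ.*_) (pochhammer-vanish 0 (suc n) (ℕ.s≤s ℕ.z≤n)) ⟨
  (0ℚ ℚ.- ℕ→ℚ (suc n)) ℚ.* -[ 0 ] (suc n)  ∎
  where open ≡-Reasoning
pochhammer-pred (suc j) n = begin
  ℕ→ℚ (suc j) ℚ.* -[ j ] n                          ≡⟨ cong (ℚ._* -[ j ] n) (ℕ→ℚ-suc j) ⟩
  (1ℚ ℚ.+ ℕ→ℚ j) ℚ.* -[ j ] n                       ≡⟨ solve 2 (λ j p → (con 1ℚ :+ j) :* p := :- ((:- j :- con 1ℚ) :* p)) refl (ℕ→ℚ j) (-[ j ] n) ⟩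
  ℚ.- ((ℚ.- ℕ→ℚ j ℚ.- 1ℚ) ℚ.* -[ j ] n)             ≡⟨ cong ℚ.-_ (pochhammer-shift j n) ⟨
  ℚ.- (-[ suc j ] n ℚ.* (ℚ.- ℕ→ℚ (suc j) ℚ.+ ℕ→ℚ n)) ≡⟨ solve 3 (λ j n p → :- (p :* (:- j :+ n)) := (j :- n) :* p) refl (ℕ→ℚ (suc j)) (ℕ→ℚ n) (-[ suc j ] n) ⟩
  (ℕ→ℚ (suc j) ℚ.- ℕ→ℚ n) ℚ.* -[ suc j ] n          ∎
  where
  open ≡-Reasoning
  open ℚS

-- The defect of the three-term recurrence telescopes over the terms of the series.
F-partial-recurrence : ∀ d i j N → N ≤ d →
  ℕ→ℚ j ℚ.* Σℚ (suc N) (F-term d i (ℕ.pred j)) ℚ.+ (ℕ→ℚ d ℚ.- ℕ→ℚ j) ℚ.* Σℚ (suc N) (F-term d i (suc j)) ≡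
  (ℕ→ℚ d ℚ.- two ℚ.* ℕ→ℚ i) ℚ.* Σℚ (suc N) (F-term d i j) ℚ.+ two ℚ.* (ℕ→ℚ i ℚ.- ℕ→ℚ N) ℚ.* F-term d i j N
F-partial-recurrence d i j zero _ =
  solve 4 (λ i j d e → let t = con 1ℚ :* con 1ℚ :* e :* con 1ℚ; s = con 0ℚ :+ t in
    j :* s :+ (d :- j) :* s := (d :- con two :* i) :* s :+ con two :* (i :- con 0ℚ) :* t)
    refl (ℕ→ℚ i) (ℕ→ℚ j) (ℕ→ℚ d) (inv (denominator d 0))
  where open ℚS
F-partial-recurrence d i j (suc N) N<d = begin
  j′ ℚ.* (S₋ ℚ.+ T₋) ℚ.+ (d′ ℚ.- j′) ℚ.* (S₊ ℚ.+ T₊)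
    ≡⟨ solve 6 (λ j d a b x y → j :* (a :+ x) :+ (d :- j) :* (b :+ y) := (j :* a :+ (d :- j) :* b) :+ (j :* x :+ (d :- j) :* y)) refl j′ d′ S₋ S₊ T₋ T₊ ⟩
  (j′ ℚ.* S₋ ℚ.+ (d′ ℚ.- j′) ℚ.* S₊) ℚ.+ (j′ ℚ.* T₋ ℚ.+ (d′ ℚ.- j′) ℚ.* T₊)
    ≡⟨ cong₂ ℚ._+_ (F-partial-recurrence d i j N (ℕ.<⇒≤ N<d)) step ⟩
  ((d′ ℚ.- two ℚ.* i′) ℚ.* S ℚ.+ two ℚ.* (i′ ℚ.- N′) ℚ.* U) ℚ.+
  ((d′ ℚ.- two ℚ.* i′) ℚ.* T′ ℚ.+ two ℚ.* (i′ ℚ.- (1ℚ ℚ.+ N′)) ℚ.* T′ ℚ.- two ℚ.* (i′ ℚ.- N′) ℚ.* U)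
    ≡⟨ solve 6 (λ i d n s t u → let two = con two in
         ((d :- two :* i) :* s :+ two :* (i :- n) :* u) :+ ((d :- two :* i) :* t :+ two :* (i :- (con 1ℚ :+ n)) :* t :- two :* (i :- n) :* u)
         := (d :- two :* i) :* (s :+ t) :+ two :* (i :- (con 1ℚ :+ n)) :* t) refl i′ d′ N′ S T′ U ⟩
  (d′ ℚ.- two ℚ.* i′) ℚ.* (S ℚ.+ T′) ℚ.+ two ℚ.* (i′ ℚ.- (1ℚ ℚ.+ N′)) ℚ.* T′
    ≡⟨ cong (λ n → (d′ ℚ.- two ℚ.* i′) ℚ.* (S ℚ.+ T′) ℚ.+ two ℚ.* (i′ ℚ.- n) ℚ.* T′) (ℕ→ℚ-suc N) ⟨
  (d′ ℚ.- two ℚ.* i′) ℚ.* (S ℚ.+ T′) ℚ.+ two ℚ.* (i′ ℚ.- ℕ→ℚ (suc N)) ℚ.* T′ ∎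
  where
  open ≡-Reasoning
  open ℚS
  i′ = ℕ→ℚ i
  j′ = ℕ→ℚ j
  d′ = ℕ→ℚ d
  N′ = ℕ→ℚ N
  S₋ = Σℚ (suc N) (F-term d i (ℕ.pred j))
  S₊ = Σℚ (suc N) (F-term d i (suc j))
  S  = Σℚ (suc N) (F-term d i j)
  T₋ = F-term d i (ℕ.pred j) (suc N)
  T₊ = F-term d i (suc j) (suc N)
  T′ = F-term d i j (suc N)
  U  = F-term d i j N
  a  = -[ i ] N
  b  = -[ j ] N
  e  = inv (denominator d N)
  e′ = inv (denominator d (suc N))
  w  = ℕ→ℚ (2 ℕ.^ N)
  w′ = ℕ→ℚ (2 ℕ.^ suc N)
  w≡ : w′ ≡ two ℚ.* w
  w≡ = ℕ→ℚ-* 2 (2 ℕ.^ N)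
  e≡ : e′ ℚ.* ((N′ ℚ.- d′) ℚ.* (1ℚ ℚ.+ N′)) ≡ e
  e≡ = inv-denominator-suc d N N<d

  step : j′ ℚ.* T₋ ℚ.+ (d′ ℚ.- j′) ℚ.* T₊ ≡
         (d′ ℚ.- two ℚ.* i′) ℚ.* T′ ℚ.+ two ℚ.* (i′ ℚ.- (1ℚ ℚ.+ N′)) ℚ.* T′ ℚ.- two ℚ.* (i′ ℚ.- N′) ℚ.* U
  step = begin
    j′ ℚ.* (a₁ ℚ.* -[ ℕ.pred j ] (suc N) ℚ.* e′ ℚ.* w′) ℚ.+ (d′ ℚ.- j′) ℚ.* (a₁ ℚ.* -[ suc j ] (suc N) ℚ.* e′ ℚ.* w′)
      ≡⟨ solve 7 (λ j a p e w d q → j :* (a :* p :* e :* w) :+ (d :- j) :* (a :* q :* e :* w) := a :* e :* w :* (j :* p :+ (d :- j) :* q))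
           refl j′ a₁ (-[ ℕ.pred j ] (suc N)) e′ w′ d′ (-[ suc j ] (suc N)) ⟩
    a₁ ℚ.* e′ ℚ.* w′ ℚ.* (j′ ℚ.* -[ ℕ.pred j ] (suc N) ℚ.+ (d′ ℚ.- j′) ℚ.* -[ suc j ] (suc N))
      -- Both neighbours in `j` become multiples of `b`: lowering `j` changes the last factors of
      -- the product, raising it adds a first factor.
      ≡⟨ cong₂ (λ s t → a₁ ℚ.* e′ ℚ.* w′ ℚ.* (s ℚ.+ (d′ ℚ.- j′) ℚ.* t))
           (trans (pochhammer-pred j (suc N)) (cong (λ n → (j′ ℚ.- n) ℚ.* (b ℚ.* (ℚ.- j′ ℚ.+ N′))) (ℕ→ℚ-suc N))) (pochhammer-shift j N) ⟩
    a₁ ℚ.* e′ ℚ.* w′ ℚ.* ((j′ ℚ.- (1ℚ ℚ.+ N′)) ℚ.* (b ℚ.* (ℚ.- j′ ℚ.+ N′)) ℚ.+ (d′ ℚ.- j′) ℚ.* ((ℚ.- j′ ℚ.- 1ℚ) ℚ.* b))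
      ≡⟨ cong (λ w′ → a₁ ℚ.* e′ ℚ.* w′ ℚ.* ((j′ ℚ.- (1ℚ ℚ.+ N′)) ℚ.* (b ℚ.* (ℚ.- j′ ℚ.+ N′)) ℚ.+ (d′ ℚ.- j′) ℚ.* ((ℚ.- j′ ℚ.- 1ℚ) ℚ.* b))) w≡ ⟩
    a₁ ℚ.* e′ ℚ.* (two ℚ.* w) ℚ.* ((j′ ℚ.- (1ℚ ℚ.+ N′)) ℚ.* (b ℚ.* (ℚ.- j′ ℚ.+ N′)) ℚ.+ (d′ ℚ.- j′) ℚ.* ((ℚ.- j′ ℚ.- 1ℚ) ℚ.* b))
      ≡⟨ solve 8 (λ i j d n a b e w → let two = con two ; one = con 1ℚ ; a₁ = a :* (:- i :+ n) ; b₁ = b :* (:- j :+ n) ; t = a₁ :* b₁ :* e :* (two :* w) in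
           a₁ :* e :* (two :* w) :* ((j :- (one :+ n)) :* b₁ :+ (d :- j) :* ((:- j :- one) :* b))
           := (d :- two :* i) :* t :+ two :* (i :- (one :+ n)) :* t :- two :* (i :- n) :* (a :* b :* (e :* ((n :- d) :* (one :+ n))) :* w))
           refl i′ j′ d′ N′ a b e′ w ⟩
    (d′ ℚ.- two ℚ.* i′) ℚ.* T″ ℚ.+ two ℚ.* (i′ ℚ.- (1ℚ ℚ.+ N′)) ℚ.* T″ ℚ.- two ℚ.* (i′ ℚ.- N′) ℚ.* (a ℚ.* b ℚ.* (e′ ℚ.* ((N′ ℚ.- d′) ℚ.* (1ℚ ℚ.+ N′))) ℚ.* w)
      ≡⟨ cong₂ (λ v e → let t = a₁ ℚ.* (b ℚ.* (ℚ.- j′ ℚ.+ N′)) ℚ.* e′ ℚ.* v in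
           (d′ ℚ.- two ℚ.* i′) ℚ.* t ℚ.+ two ℚ.* (i′ ℚ.- (1ℚ ℚ.+ N′)) ℚ.* t ℚ.- two ℚ.* (i′ ℚ.- N′) ℚ.* (a ℚ.* b ℚ.* e ℚ.* w)) (sym w≡) e≡ ⟩
    (d′ ℚ.- two ℚ.* i′) ℚ.* T′ ℚ.+ two ℚ.* (i′ ℚ.- (1ℚ ℚ.+ N′)) ℚ.* T′ ℚ.- two ℚ.* (i′ ℚ.- N′) ℚ.* U ∎
    where
    a₁ = a ℚ.* (ℚ.- i′ ℚ.+ N′)
    T″ = a₁ ℚ.* (b ℚ.* (ℚ.- j′ ℚ.+ N′)) ℚ.* e′ ℚ.* (two ℚ.* w)

-- The three-term recurrence of the symmetric Krawtchouk polynomials. The partial recurrence at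
-- `N = d` leaves a boundary term proportional to `(i - d)` times `-[ i ] d`.
F-recurrence : ∀ d i j → i ≤ d →
  ℕ→ℚ j ℚ.* F d i (ℕ.pred j) ℚ.+ (ℕ→ℚ d ℚ.- ℕ→ℚ j) ℚ.* F d i (suc j) ≡ (ℕ→ℚ d ℚ.- two ℚ.* ℕ→ℚ i) ℚ.* F d i j
F-recurrence d i j i≤d = begin
  _ ≡⟨ F-partial-recurrence d i j d ℕ.≤-refl ⟩
  s ℚ.+ two ℚ.* (i′ ℚ.- d′) ℚ.* (a ℚ.* b ℚ.* e ℚ.* w)
    ≡⟨ solve 7 (λ s i d a b e w → s :+ con two :* (i :- d) :* (a :* b :* e :* w) := s :+ con two :* ((i :- d) :* a) :* (b :* e :* w))
         refl s i′ d′ a b e w ⟩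
  s ℚ.+ two ℚ.* ((i′ ℚ.- d′) ℚ.* a) ℚ.* (b ℚ.* e ℚ.* w)
    ≡⟨ cong (λ t → s ℚ.+ two ℚ.* t ℚ.* (b ℚ.* e ℚ.* w)) (pochhammer-top i≤d) ⟩
  s ℚ.+ two ℚ.* 0ℚ ℚ.* (b ℚ.* e ℚ.* w)
    ≡⟨ solve 2 (λ s x → s :+ con two :* con 0ℚ :* x := s) refl s (b ℚ.* e ℚ.* w) ⟩
  s ∎
  where
  open ≡-Reasoning
  open ℚS
  i′ = ℕ→ℚ i
  d′ = ℕ→ℚ d
  s  = (d′ ℚ.- two ℚ.* i′) ℚ.* F d i j
  a  = -[ i ] d
  b  = -[ j ] d
  e  = inv (denominator d d)
  w  = ℕ→ℚ (2 ℕ.^ d)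

Σℚ-head : ∀ n f → (∀ k → f (suc k) ≡ 0ℚ) → Σℚ (suc n) f ≡ f 0
Σℚ-head zero    f h = ℚ.+-identityˡ (f 0)
Σℚ-head (suc n) f h = trans (cong₂ ℚ._+_ (Σℚ-head n f h) (h n)) (ℚ.+-identityʳ (f 0))

F-zeroʳ : ∀ d i → F d i 0 ≡ 1ℚ
F-zeroʳ d i = trans (Σℚ-head d (F-term d i 0) λ n → begin
    -[ i ] (suc n) ℚ.* -[ 0 ] (suc n) ℚ.* e n ℚ.* w n
      ≡⟨ cong (λ t → -[ i ] (suc n) ℚ.* t ℚ.* e n ℚ.* w n) (pochhammer-vanish 0 (suc n) (ℕ.s≤s ℕ.z≤n)) ⟩
    -[ i ] (suc n) ℚ.* 0ℚ ℚ.* e n ℚ.* w n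
      ≡⟨ solve 3 (λ a e w → a :* con 0ℚ :* e :* w := con 0ℚ) refl (-[ i ] (suc n)) (e n) (w n) ⟩
    0ℚ ∎)
  refl
  where
  open ≡-Reasoning
  open ℚS
  e = λ n → inv (denominator d (suc n))
  w = λ n → ℕ→ℚ (2 ℕ.^ suc n)

-- Binomial sums of the hypergeometric values.

Cℚ : ℕ → ℕ → ℚ
Cℚ n k = ℕ→ℚ (n C k)

Cℚ-pascal : ∀ n k → Cℚ (suc n) (suc k) ≡ Cℚ n k ℚ.+ Cℚ n (suc k)
Cℚ-pascal n k = trans (cong ℕ→ℚ (sym (nCk+nC[k+1]≡[n+1]C[k+1] n k))) (ℕ→ℚ-+ (n C k) (n C suc k))

Cℚ-absorb : ∀ n k → (1ℚ ℚ.+ ℕ→ℚ k) ℚ.* Cℚ n (suc k) ≡ (ℕ→ℚ n ℚ.- ℕ→ℚ k) ℚ.* Cℚ n k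
Cℚ-absorb zero zero = refl
Cℚ-absorb zero (suc k) = trans (ℚ.*-zeroʳ (1ℚ ℚ.+ ℕ→ℚ (suc k))) (sym (ℚ.*-zeroʳ (0ℚ ℚ.- ℕ→ℚ (suc k))))
Cℚ-absorb (suc n) zero = trans (cong (λ m → (1ℚ ℚ.+ ℕ→ℚ 0) ℚ.* ℕ→ℚ m) (nC1≡n (suc n)))
  (solve 1 (λ n → (con 1ℚ :+ con 0ℚ) :* n := (n :- con 0ℚ) :* con 1ℚ) refl (ℕ→ℚ (suc n)))
  where open ℚS
Cℚ-absorb (suc n) (suc k) = begin
  (1ℚ ℚ.+ ℕ→ℚ (suc k)) ℚ.* Cℚ (suc n) (suc (suc k))
    ≡⟨ cong ((1ℚ ℚ.+ ℕ→ℚ (suc k)) ℚ.*_) (Cℚ-pascal n (suc k)) ⟩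
  (1ℚ ℚ.+ ℕ→ℚ (suc k)) ℚ.* (c₁ ℚ.+ c₂)
    ≡⟨ ℚ.*-distribˡ-+ (1ℚ ℚ.+ ℕ→ℚ (suc k)) c₁ c₂ ⟩
  (1ℚ ℚ.+ ℕ→ℚ (suc k)) ℚ.* c₁ ℚ.+ (1ℚ ℚ.+ ℕ→ℚ (suc k)) ℚ.* c₂
    ≡⟨ cong ((1ℚ ℚ.+ ℕ→ℚ (suc k)) ℚ.* c₁ ℚ.+_) (Cℚ-absorb n (suc k)) ⟩
  (1ℚ ℚ.+ ℕ→ℚ (suc k)) ℚ.* c₁ ℚ.+ (ℕ→ℚ n ℚ.- ℕ→ℚ (suc k)) ℚ.* c₁
    ≡⟨ cong (λ t → (1ℚ ℚ.+ t) ℚ.* c₁ ℚ.+ (ℕ→ℚ n ℚ.- t) ℚ.* c₁) (ℕ→ℚ-suc k) ⟩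
  (1ℚ ℚ.+ (1ℚ ℚ.+ ℕ→ℚ k)) ℚ.* c₁ ℚ.+ (ℕ→ℚ n ℚ.- (1ℚ ℚ.+ ℕ→ℚ k)) ℚ.* c₁
    ≡⟨ solve 3 (λ n k c → (con 1ℚ :+ (con 1ℚ :+ k)) :* c :+ (n :- (con 1ℚ :+ k)) :* c := (con 1ℚ :+ k) :* c :+ (n :- k) :* c) refl (ℕ→ℚ n) (ℕ→ℚ k) c₁ ⟩
  (1ℚ ℚ.+ ℕ→ℚ k) ℚ.* c₁ ℚ.+ (ℕ→ℚ n ℚ.- ℕ→ℚ k) ℚ.* c₁
    ≡⟨ cong (ℚ._+ (ℕ→ℚ n ℚ.- ℕ→ℚ k) ℚ.* c₁) (Cℚ-absorb n k) ⟩
  (ℕ→ℚ n ℚ.- ℕ→ℚ k) ℚ.* c₀ ℚ.+ (ℕ→ℚ n ℚ.- ℕ→ℚ k) ℚ.* c₁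
    ≡⟨ solve 4 (λ n k a b → (n :- k) :* a :+ (n :- k) :* b := ((con 1ℚ :+ n) :- (con 1ℚ :+ k)) :* (a :+ b)) refl (ℕ→ℚ n) (ℕ→ℚ k) c₀ c₁ ⟩
  ((1ℚ ℚ.+ ℕ→ℚ n) ℚ.- (1ℚ ℚ.+ ℕ→ℚ k)) ℚ.* (c₀ ℚ.+ c₁)
    ≡⟨ cong₂ ℚ._*_ (cong₂ ℚ._-_ (ℕ→ℚ-suc n) (ℕ→ℚ-suc k)) (Cℚ-pascal n k) ⟨
  (ℕ→ℚ (suc n) ℚ.- ℕ→ℚ (suc k)) ℚ.* Cℚ (suc n) (suc k) ∎
  where
  open ≡-Reasoning
  open ℚS
  c₀ = Cℚ n k
  c₁ = Cℚ n (suc k)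
  c₂ = Cℚ n (suc (suc k))

Σ-Cℚ-pascal : ∀ m N → Σℚ (suc N) (Cℚ (suc m)) ≡ Σℚ (suc N) (Cℚ m) ℚ.+ Σℚ N (Cℚ m)
Σ-Cℚ-pascal m zero    = refl
Σ-Cℚ-pascal m (suc N) = trans (cong₂ ℚ._+_ (Σ-Cℚ-pascal m N) (Cℚ-pascal m N))
  (solve 4 (λ a b c d → (a :+ b) :+ (c :+ d) := (a :+ d) :+ (b :+ c)) refl
    (Σℚ (suc N) (Cℚ m)) (Σℚ N (Cℚ m)) (Cℚ m N) (Cℚ m (suc N)))
  where open ℚS

Σ-Cℚ : ∀ m → Σℚ (suc m) (Cℚ m) ≡ ℕ→ℚ (2 ℕ.^ m)
Σ-Cℚ zero    = refl
Σ-Cℚ (suc m) = begin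
  Σℚ (suc (suc m)) (Cℚ (suc m))                 ≡⟨ Σ-Cℚ-pascal m (suc m) ⟩
  s ℚ.+ Cℚ m (suc m) ℚ.+ s                      ≡⟨ cong (λ c → s ℚ.+ ℕ→ℚ c ℚ.+ s) (k>n⇒nCk≡0 {m} ℕ.≤-refl) ⟩
  s ℚ.+ 0ℚ ℚ.+ s                                ≡⟨ solve 1 (λ s → s :+ con 0ℚ :+ s := con two :* s) refl s ⟩
  two ℚ.* s                                   ≡⟨ cong (two ℚ.*_) (Σ-Cℚ m) ⟩
  two ℚ.* ℕ→ℚ (2 ℕ.^ m)                       ≡⟨ ℕ→ℚ-* 2 (2 ℕ.^ m) ⟨
  ℕ→ℚ (2 ℕ.^ suc m)                             ∎
  where
  open ≡-Reasoning
  open ℚS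
  s = Σℚ (suc m) (Cℚ m)

-- Writing `2j = d - (d - 2j)`, the recurrence in the first argument (available by `F-sym`) rewrites
-- `(d - 2j) F`, and `Cℚ-absorb` makes neighbouring weights cancel. At `N = d` the boundary factor
-- `d - N` is zero.
Σ-C-F-partial : ∀ d j N → N ≤ d → j ≤ d →
  two ℚ.* ℕ→ℚ j ℚ.* Σℚ (suc N) (λ i → Cℚ d i ℚ.* F d i j) ≡
  (ℕ→ℚ d ℚ.- ℕ→ℚ N) ℚ.* Cℚ d N ℚ.* (F d N j ℚ.- F d (suc N) j)
Σ-C-F-partial d j zero _ j≤d = begin
  two ℚ.* j′ ℚ.* (0ℚ ℚ.+ 1ℚ ℚ.* f₀)
    ≡⟨ solve 3 (λ j d f → con two :* j :* (con 0ℚ :+ con 1ℚ :* f) := d :* f :- ((d :- con two :* j) :* f)) refl j′ d′ f₀ ⟩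
  d′ ℚ.* f₀ ℚ.- ((d′ ℚ.- two ℚ.* j′) ℚ.* f₀)
    ≡⟨ cong (λ t → d′ ℚ.* f₀ ℚ.- t) (trans (cong ((d′ ℚ.- two ℚ.* j′) ℚ.*_) (F-sym d 0 j)) (sym (F-recurrence d j 0 j≤d))) ⟩
  d′ ℚ.* f₀ ℚ.- (0ℚ ℚ.* F d j 0 ℚ.+ (d′ ℚ.- 0ℚ) ℚ.* F d j 1)
    ≡⟨ cong (λ t → d′ ℚ.* f₀ ℚ.- (0ℚ ℚ.* F d j 0 ℚ.+ (d′ ℚ.- 0ℚ) ℚ.* t)) (F-sym d j 1) ⟩
  d′ ℚ.* f₀ ℚ.- (0ℚ ℚ.* F d j 0 ℚ.+ (d′ ℚ.- 0ℚ) ℚ.* f₁)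
    ≡⟨ solve 4 (λ d f g h → d :* f :- (con 0ℚ :* g :+ (d :- con 0ℚ) :* h) := (d :- con 0ℚ) :* con 1ℚ :* (f :- h)) refl d′ f₀ (F d j 0) f₁ ⟩
  (d′ ℚ.- 0ℚ) ℚ.* 1ℚ ℚ.* (f₀ ℚ.- f₁) ∎
  where
  open ≡-Reasoning
  open ℚS
  j′ = ℕ→ℚ j
  d′ = ℕ→ℚ d
  f₀ = F d 0 j
  f₁ = F d 1 j
Σ-C-F-partial d j (suc N) N<d j≤d = begin
  two ℚ.* j′ ℚ.* (s ℚ.+ c₁ ℚ.* f₁)
    ≡⟨ solve 5 (λ d j s c f → con two :* j :* (s :+ c :* f) := con two :* j :* s :+ c :* (d :* f :- (d :- con two :* j) :* f)) refl d′ j′ s c₁ f₁ ⟩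
  two ℚ.* j′ ℚ.* s ℚ.+ c₁ ℚ.* (d′ ℚ.* f₁ ℚ.- (d′ ℚ.- two ℚ.* j′) ℚ.* f₁)
    ≡⟨ cong₂ (λ a b → a ℚ.+ c₁ ℚ.* (d′ ℚ.* f₁ ℚ.- b)) (Σ-C-F-partial d j N (ℕ.<⇒≤ N<d) j≤d) rec ⟩
  (d′ ℚ.- N′) ℚ.* c₀ ℚ.* (f₀ ℚ.- f₁) ℚ.+ c₁ ℚ.* (d′ ℚ.* f₁ ℚ.- ((1ℚ ℚ.+ N′) ℚ.* f₀ ℚ.+ (d′ ℚ.- (1ℚ ℚ.+ N′)) ℚ.* f₂))
    ≡⟨ cong (λ t → t ℚ.* (f₀ ℚ.- f₁) ℚ.+ c₁ ℚ.* (d′ ℚ.* f₁ ℚ.- ((1ℚ ℚ.+ N′) ℚ.* f₀ ℚ.+ (d′ ℚ.- (1ℚ ℚ.+ N′)) ℚ.* f₂))) (Cℚ-absorb d N) ⟨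
  (1ℚ ℚ.+ N′) ℚ.* c₁ ℚ.* (f₀ ℚ.- f₁) ℚ.+ c₁ ℚ.* (d′ ℚ.* f₁ ℚ.- ((1ℚ ℚ.+ N′) ℚ.* f₀ ℚ.+ (d′ ℚ.- (1ℚ ℚ.+ N′)) ℚ.* f₂))
    ≡⟨ solve 6 (λ d n c f g h → (con 1ℚ :+ n) :* c :* (f :- g) :+ c :* (d :* g :- ((con 1ℚ :+ n) :* f :+ (d :- (con 1ℚ :+ n)) :* h)) := (d :- (con 1ℚ :+ n)) :* c :* (g :- h)) refl d′ N′ c₁ f₀ f₁ f₂ ⟩
  (d′ ℚ.- (1ℚ ℚ.+ N′)) ℚ.* c₁ ℚ.* (f₁ ℚ.- f₂)
    ≡⟨ cong (λ n → (d′ ℚ.- n) ℚ.* c₁ ℚ.* (f₁ ℚ.- f₂)) (ℕ→ℚ-suc N) ⟨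
  (d′ ℚ.- ℕ→ℚ (suc N)) ℚ.* c₁ ℚ.* (f₁ ℚ.- f₂) ∎
  where
  open ≡-Reasoning
  open ℚS
  j′ = ℕ→ℚ j
  d′ = ℕ→ℚ d
  N′ = ℕ→ℚ N
  s  = Σℚ (suc N) (λ i → Cℚ d i ℚ.* F d i j)
  c₀ = Cℚ d N
  c₁ = Cℚ d (suc N)
  f₀ = F d N j
  f₁ = F d (suc N) j
  f₂ = F d (suc (suc N)) j
  rec : (d′ ℚ.- two ℚ.* j′) ℚ.* f₁ ≡ (1ℚ ℚ.+ N′) ℚ.* f₀ ℚ.+ (d′ ℚ.- (1ℚ ℚ.+ N′)) ℚ.* f₂
  rec = begin
    (d′ ℚ.- two ℚ.* j′) ℚ.* f₁                                      ≡⟨ cong ((d′ ℚ.- two ℚ.* j′) ℚ.*_) (F-sym d (suc N) j) ⟩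
    (d′ ℚ.- two ℚ.* j′) ℚ.* F d j (suc N)                           ≡⟨ F-recurrence d j (suc N) j≤d ⟨
    ℕ→ℚ (suc N) ℚ.* F d j N ℚ.+ (d′ ℚ.- ℕ→ℚ (suc N)) ℚ.* F d j (suc (suc N))
      ≡⟨ cong₂ (λ a b → ℕ→ℚ (suc N) ℚ.* a ℚ.+ (d′ ℚ.- ℕ→ℚ (suc N)) ℚ.* b) (F-sym d j N) (F-sym d j (suc (suc N))) ⟩
    ℕ→ℚ (suc N) ℚ.* f₀ ℚ.+ (d′ ℚ.- ℕ→ℚ (suc N)) ℚ.* f₂             ≡⟨ cong (λ n → n ℚ.* f₀ ℚ.+ (d′ ℚ.- n) ℚ.* f₂) (ℕ→ℚ-suc N) ⟩
    (1ℚ ℚ.+ N′) ℚ.* f₀ ℚ.+ (d′ ℚ.- (1ℚ ℚ.+ N′)) ℚ.* f₂             ∎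

Σ-C-F-zero : ∀ d → Σℚ (suc d) (λ i → Cℚ d i ℚ.* F d i 0) ≡ ℕ→ℚ (2 ℕ.^ d)
Σ-C-F-zero d = trans
  (Σℚ-cong (suc d) λ i _ → trans (cong (Cℚ d i ℚ.*_) (F-zeroʳ d i)) (ℚ.*-identityʳ (Cℚ d i)))
  (Σ-Cℚ d)

-- With `Σ-C-F-zero` this says that every other column is orthogonal to the constant column `0`
-- under binomial weights. It removes all rungs but the lowest in `x-expansion`.
Σ-C-F-suc : ∀ d j → suc j ≤ d → Σℚ (suc d) (λ i → Cℚ d i ℚ.* F d i (suc j)) ≡ 0ℚ
-- `2 ℕ.* suc j` unfolds to the successor of `j ℕ.+ suc (j ℕ.+ 0)`.
Σ-C-F-suc d j j<d = ℚ-cancel (ℕ→ℚ-suc≢0 (j ℕ.+ suc (j ℕ.+ 0)) ∘ trans (ℕ→ℚ-* 2 (suc j))) (begin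
  two ℚ.* ℕ→ℚ (suc j) ℚ.* s               ≡⟨ Σ-C-F-partial d (suc j) d ℕ.≤-refl j<d ⟩
  (ℕ→ℚ d ℚ.- ℕ→ℚ d) ℚ.* Cℚ d d ℚ.* x        ≡⟨ solve 3 (λ d c x → (d :- d) :* c :* x := con 0ℚ) refl (ℕ→ℚ d) (Cℚ d d) x ⟩
  0ℚ                                        ∎)
  where
  open ≡-Reasoning
  open ℚS
  s = Σℚ (suc d) (λ i → Cℚ d i ℚ.* F d i (suc j))
  x = F d d (suc j) ℚ.- F d (suc d) (suc j)

-- Vectors and the action of 𝔤𝔩₂

module ≈-Reasoning where
  open import Relation.Binary.Reasoning.Setoid R.setoid public

nat : ℕ → ℂ
nat n = ι (ℕ→ℚ n)

nat-suc : ∀ k → nat (suc k) ≈ 1# + nat k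
nat-suc k = R.trans (ι-cong (ℕ→ℚ-suc k)) (ι-+ 1ℚ (ℕ→ℚ k))

Σᶜ : ℕ → (ℕ → ℂ) → ℂ
Σᶜ zero    f = 0#
Σᶜ (suc n) f = Σᶜ n f + f n

Σᶜ-cong : ∀ n {f g} → (∀ k → k ℕ.< n → f k ≈ g k) → Σᶜ n f ≈ Σᶜ n g
Σᶜ-cong zero    h = R.refl
Σᶜ-cong (suc n) h = R.+-cong (Σᶜ-cong n λ k k<n → h k (ℕ.m<n⇒m<1+n k<n)) (h n ℕ.≤-refl)

Σᶜ-zero : ∀ n {f} → (∀ k → k ℕ.< n → f k ≈ 0#) → Σᶜ n f ≈ 0#
Σᶜ-zero zero    h = R.refl
Σᶜ-zero (suc n) h = R.trans (R.+-cong (Σᶜ-zero n λ k k<n → h k (ℕ.m<n⇒m<1+n k<n)) (h n ℕ.≤-refl)) (R.+-identityʳ 0#)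

Σᶜ-only : ∀ n {f} j → j ℕ.< n → (∀ k → k ≢ j → f k ≈ 0#) → Σᶜ n f ≈ f j
Σᶜ-only (suc n) {f} j j<1+n h with j ℕ.≟ n
... | yes refl = R.trans (R.+-congʳ (Σᶜ-zero n λ k k<n → h k (ℕ.<⇒≢ k<n))) (R.+-identityˡ (f n))
... | no j≢n   = R.trans (R.+-cong (Σᶜ-only n j (ℕ.≤∧≢⇒< (ℕ.≤-pred j<1+n) j≢n) h) (h n (j≢n ∘ sym))) (R.+-identityʳ (f j))

Σᶜ-*ˡ : ∀ n c f → c * Σᶜ n f ≈ Σᶜ n (λ k → c * f k)
Σᶜ-*ˡ zero    c f = R.zeroʳ c
Σᶜ-*ˡ (suc n) c f = R.trans (R.distribˡ c _ _) (R.+-congʳ (Σᶜ-*ˡ n c f))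

Σᶜ-*ʳ : ∀ n c f → Σᶜ n f * c ≈ Σᶜ n (λ k → f k * c)
Σᶜ-*ʳ zero    c f = R.zeroˡ c
Σᶜ-*ʳ (suc n) c f = R.trans (R.distribʳ c _ _) (R.+-congʳ (Σᶜ-*ʳ n c f))

Σᶜ-+ : ∀ n f g → Σᶜ n (λ k → f k + g k) ≈ Σᶜ n f + Σᶜ n g
Σᶜ-+ zero    f g = R.sym (R.+-identityʳ 0#)
Σᶜ-+ (suc n) f g = R.trans (R.+-congʳ (Σᶜ-+ n f g))
  (solve 4 (λ a b c d → (a :+ b) :+ (c :+ d) := (a :+ c) :+ (b :+ d)) R.refl (Σᶜ n f) (Σᶜ n g) (f n) (g n))
  where open ℂS

Σᶜ-comm : ∀ m n (f : ℕ → ℕ → ℂ) → Σᶜ m (λ i → Σᶜ n (f i)) ≈ Σᶜ n (λ j → Σᶜ m (λ i → f i j))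
Σᶜ-comm zero    n f = R.sym (Σᶜ-zero n λ _ _ → R.refl)
Σᶜ-comm (suc m) n f = R.trans (R.+-congʳ (Σᶜ-comm m n f)) (R.sym (Σᶜ-+ n (λ j → Σᶜ m (λ i → f i j)) (f m)))

ι-Σ : ∀ n f → ι (Σℚ n f) ≈ Σᶜ n (ι ∘ f)
ι-Σ zero    f = R.refl
ι-Σ (suc n) f = R.trans (ι-+ (Σℚ n f) (f n)) (R.+-congʳ (ι-Σ n f))

sum-toℕ : ∀ n (f : ℕ → ℂ) → sum {n} (f ∘ toℕ) ≈ Σᶜ n f
sum-toℕ zero    f = R.refl
sum-toℕ (suc n) f = begin
  sum {suc n} (f ∘ toℕ)                               ≈⟨ MonoidSum.sum-init-last R.+-monoid (f ∘ toℕ {suc n}) ⟩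
  sum {n} (f ∘ toℕ ∘ inject₁) + f (toℕ (fromℕ n))     ≡⟨ cong₂ _+_ (MonoidSum.sum-cong-≗ R.+-monoid {n} (cong f ∘ Fin.toℕ-inject₁)) (cong f (Fin.toℕ-fromℕ n)) ⟩
  sum {n} (f ∘ toℕ) + f n                             ≈⟨ R.+-congʳ (sum-toℕ n f) ⟩
  Σᶜ n f + f n                                        ∎
  where open ≈-Reasoning

-- The quotients in `₂F₁` carry a proof of nonzeroness attached to an element of `Fin`. Passing to
-- the total `inv` turns the terms into a function on ℕ.
₂F₁-F : ∀ i j d → ₂F₁ i j d ≈ ι (F d i j)
₂F₁-F i j d = begin
  ₂F₁ i j d                              ≈⟨ MonoidSum.sum-cong-≋ R.+-monoid (λ n → ι-cong (cong (λ e → -[ i ] toℕ n ℚ.* -[ j ] toℕ n ℚ.* e ℚ.* ℕ→ℚ (2 ℕ.^ toℕ n))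
                                              (sym (inv-1/ (denominator d (toℕ n)) {{denominator-nz d n}})))) ⟩
  sum {suc d} (ι ∘ F-term d i j ∘ toℕ)   ≈⟨ sum-toℕ (suc d) (ι ∘ F-term d i j) ⟩
  Σᶜ (suc d) (ι ∘ F-term d i j)          ≈⟨ ι-Σ (suc d) (F-term d i j) ⟨
  ι (F d i j)                            ∎
  where open ≈-Reasoning

-- A property of bare functions, so that matrices, `δ M`, `κ M` and `Ω` share the consequences
-- below.
record IsLinear {D} (f : V D → V D) : Set where
  field
    ▹-cong : ∀ {v w} → v ≈ᵥ w → f v ≈ᵥ f w
    ▹-+    : ∀ v w → f (v +ᵥ w) ≈ᵥ f v +ᵥ f w
    ▹-•    : ∀ c v → f (c •ᵥ v) ≈ᵥ c •ᵥ f v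

  ▹-0 : f 0ᵥ ≈ᵥ 0ᵥ
  ▹-0 y = R.trans (▹-cong {0ᵥ} {0# •ᵥ 0ᵥ} (λ _ → R.sym (R.zeroˡ 0#)) y) (R.trans (▹-• 0# 0ᵥ y) (R.zeroˡ _))

  ▹-kills : ∀ {v} → v ≈ᵥ 0ᵥ → f v ≈ᵥ 0ᵥ
  ▹-kills v≈0 y = R.trans (▹-cong v≈0 y) (▹-0 y)

  ▹-combo : ∀ a v b w → f (a •ᵥ v +ᵥ b •ᵥ w) ≈ᵥ a •ᵥ f v +ᵥ b •ᵥ f w
  ▹-combo a v b w y = R.trans (▹-+ (a •ᵥ v) (b •ᵥ w) y) (R.+-cong (▹-• a v y) (▹-• b w y))

  ▹-Σ : ∀ n (c : ℕ → ℂ) (x : ℕ → V D) →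
        f (λ y → Σᶜ n (λ k → c k * x k y)) ≈ᵥ (λ y → Σᶜ n (λ k → c k * f (x k) y))
  ▹-Σ zero    c x y = ▹-0 y
  ▹-Σ (suc n) c x y = R.trans (▹-+ (λ y → Σᶜ n (λ k → c k * x k y)) (c n •ᵥ x n) y)
                              (R.+-cong (▹-Σ n c x y) (▹-• (c n) (x n) y))

open IsLinear

-- Sums over the vertices and the action of matrices.

∑ₓ-cong : ∀ {D} {f g : X D → ℂ} → (∀ y → f y ≈ g y) → ∑ₓ f ≈ ∑ₓ g
∑ₓ-cong {zero}  p = p []
∑ₓ-cong {suc D} p = R.+-cong (∑ₓ-cong (p ∘ (0F ∷_))) (R.+-congʳ (∑ₓ-cong (p ∘ (1F ∷_))))

∑ₓ-+ : ∀ {D} (f g : X D → ℂ) → ∑ₓ (λ y → f y + g y) ≈ ∑ₓ f + ∑ₓ g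
∑ₓ-+ {zero}  f g = R.refl
∑ₓ-+ {suc D} f g = R.trans (R.+-cong (∑ₓ-+ (f ∘ (0F ∷_)) (g ∘ (0F ∷_))) (R.+-congʳ (∑ₓ-+ (f ∘ (1F ∷_)) (g ∘ (1F ∷_)))))
  (solve 4 (λ a b c d → (a :+ b) :+ ((c :+ d) :+ con 0ℚ) := (a :+ (c :+ con 0ℚ)) :+ (b :+ (d :+ con 0ℚ))) R.refl
    (∑ₓ (f ∘ (0F ∷_))) (∑ₓ (g ∘ (0F ∷_))) (∑ₓ (f ∘ (1F ∷_))) (∑ₓ (g ∘ (1F ∷_))))
  where open ℂS

∑ₓ-*ˡ : ∀ {D} c (f : X D → ℂ) → ∑ₓ (λ y → c * f y) ≈ c * ∑ₓ f
∑ₓ-*ˡ {zero}  c f = R.refl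
∑ₓ-*ˡ {suc D} c f = R.trans (R.+-cong (∑ₓ-*ˡ c (f ∘ (0F ∷_))) (R.+-congʳ (∑ₓ-*ˡ c (f ∘ (1F ∷_)))))
  (solve 3 (λ c a b → c :* a :+ (c :* b :+ con 0ℚ) := c :* (a :+ (b :+ con 0ℚ))) R.refl c
    (∑ₓ (f ∘ (0F ∷_))) (∑ₓ (f ∘ (1F ∷_))))
  where open ℂS

∑ₓ-0 : ∀ {D} {f : X D → ℂ} → (∀ y → f y ≈ 0#) → ∑ₓ f ≈ 0#
∑ₓ-0 {D} {f} p = R.trans (∑ₓ-cong {D} {g = λ _ → 0# * 0#} λ y → R.trans (p y) (R.sym (R.zeroˡ 0#)))
  (R.trans (∑ₓ-*ˡ {D} 0# (λ _ → 0#)) (R.zeroˡ _))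

∑ₓ-comm : ∀ {D D′} (f : X D → X D′ → ℂ) → ∑ₓ (λ y → ∑ₓ (f y)) ≈ ∑ₓ (λ z → ∑ₓ (λ y → f y z))
∑ₓ-comm {zero}  {D′} f = R.refl
∑ₓ-comm {suc D} {D′} f = R.trans (R.+-cong (∑ₓ-comm (f ∘ (0F ∷_))) (R.+-congʳ (∑ₓ-comm (f ∘ (1F ∷_)))))
  (R.trans (R.+-congˡ (R.+-identityʳ _))
  (R.trans (R.sym (∑ₓ-+ (λ z → ∑ₓ λ y → f (0F ∷ y) z) (λ z → ∑ₓ λ y → f (1F ∷ y) z)))
           (∑ₓ-cong {D′} λ z → R.+-congˡ (R.sym (R.+-identityʳ _)))))

▹-linear : ∀ {D} (M : Mat D) → IsLinear (M ▹_)
▹-linear M .▹-cong p y = ∑ₓ-cong λ z → R.*-congˡ (p z)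
▹-linear M .▹-+ v w y = R.trans (∑ₓ-cong λ z → R.distribˡ (M y z) (v z) (w z)) (∑ₓ-+ (λ z → M y z * v z) (λ z → M y z * w z))
▹-linear M .▹-• c v y = R.trans (∑ₓ-cong λ z → solve 3 (λ m c v → m :* (c :* v) := c :* (m :* v)) R.refl (M y z) c (v z))
                                (∑ₓ-*ˡ c (λ z → M y z * v z))
  where open ℂS

·-▹ : ∀ {D} (M N : Mat D) v → (M ·ₘ N) ▹ v ≈ᵥ M ▹ N ▹ v
·-▹ M N v y = begin
  ∑ₓ (λ z → ∑ₓ (λ w → M y w * N w z) * v z)
    ≈⟨ ∑ₓ-cong (λ z → R.trans (R.*-comm _ (v z)) (R.trans (R.sym (∑ₓ-*ˡ (v z) (λ w → M y w * N w z)))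
         (∑ₓ-cong λ w → solve 3 (λ v m n → v :* (m :* n) := m :* (n :* v)) R.refl (v z) (M y w) (N w z)))) ⟩
  ∑ₓ (λ z → ∑ₓ (λ w → M y w * (N w z * v z)))
    ≈⟨ ∑ₓ-comm (λ z w → M y w * (N w z * v z)) ⟩
  ∑ₓ (λ w → ∑ₓ (λ z → M y w * (N w z * v z)))
    ≈⟨ ∑ₓ-cong (λ w → ∑ₓ-*ˡ (M y w) (λ z → N w z * v z)) ⟩
  ∑ₓ (λ w → M y w * ∑ₓ (λ z → N w z * v z)) ∎
  where
  open ≈-Reasoning
  open ℂS

∑ₓ-diagonal : ∀ {D} (y : X D) c (v : V D) →
              ∑ₓ (λ z → (if does (y ≟ₓ z) then c else 0#) * v z) ≈ c * v y
∑ₓ-diagonal []       c v = R.refl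
∑ₓ-diagonal (0F ∷ y) c v = R.trans
  (R.+-cong (∑ₓ-diagonal y c (v ∘ (0F ∷_))) (R.+-congʳ (∑ₓ-0 {f = λ z → 0# * v (1F ∷ z)} λ z → R.zeroˡ _)))
  (solve 1 (λ x → x :+ (con 0ℚ :+ con 0ℚ) := x) R.refl (c * v (0F ∷ y)))
  where open ℂS
∑ₓ-diagonal (1F ∷ y) c v = R.trans
  (R.+-cong (∑ₓ-0 {f = λ z → 0# * v (0F ∷ z)} λ z → R.zeroˡ _) (R.+-congʳ (∑ₓ-diagonal y c (v ∘ (1F ∷_)))))
  (solve 1 (λ x → con 0ℚ :+ (x :+ con 0ℚ) := x) R.refl (c * v (1F ∷ y)))
  where open ℂS

I-▹ : ∀ {D} (v : V D) → Iₘ ▹ v ≈ᵥ v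
I-▹ v y = R.trans (∑ₓ-diagonal y 1# v) (R.*-identityˡ (v y))

weight : ∀ {D} → X D → ℕ
weight = ∂ 𝟎ₓ

A*-▹ : ∀ {D} (v : V D) y → (A* ▹ v) y ≈ ι (θ D (weight y)) * v y
A*-▹ {D} v y = ∑ₓ-diagonal y (ι (θ D (weight y))) v

-- The action of M ∈ Mat₂(ℂ) on the D-fold tensor power of ℂ² as a derivation,
-- and as a group-like element.
δ : (Fin 2 → Fin 2 → ℂ) → ∀ {D} → V D → V D
δ M {zero}  v y       = 0#
δ M {suc D} v (a ∷ y) = M a 0F * v (0F ∷ y) + M a 1F * v (1F ∷ y) + δ M (v ∘ (a ∷_)) y

κ : (Fin 2 → Fin 2 → ℂ) → ∀ {D} → V D → V D
κ M {zero}  v y       = v y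
κ M {suc D} v (a ∷ y) = M a 0F * κ M (v ∘ (0F ∷_)) y + M a 1F * κ M (v ∘ (1F ∷_)) y

δ-linear : ∀ M {D} → IsLinear (δ M {D})
δ-linear M {zero}  .▹-cong p y = R.refl
δ-linear M {suc D} .▹-cong p (a ∷ y) =
  R.+-cong (R.+-cong (R.*-congˡ (p (0F ∷ y))) (R.*-congˡ (p (1F ∷ y)))) (δ-linear M .▹-cong (p ∘ (a ∷_)) y)
δ-linear M {zero}  .▹-+ v w y = R.sym (R.+-identityʳ 0#)
δ-linear M {suc D} .▹-+ v w (a ∷ y) = R.trans (R.+-congˡ (δ-linear M .▹-+ (v ∘ (a ∷_)) (w ∘ (a ∷_)) y))
  (solve 8 (λ m n v v′ w w′ x x′ → m :* (v :+ w) :+ n :* (v′ :+ w′) :+ (x :+ x′) := (m :* v :+ n :* v′ :+ x) :+ (m :* w :+ n :* w′ :+ x′)) R.refl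
    (M a 0F) (M a 1F) (v (0F ∷ y)) (v (1F ∷ y)) (w (0F ∷ y)) (w (1F ∷ y)) (δ M (v ∘ (a ∷_)) y) (δ M (w ∘ (a ∷_)) y))
  where open ℂS
δ-linear M {zero}  .▹-• c v y = R.sym (R.zeroʳ c)
δ-linear M {suc D} .▹-• c v (a ∷ y) = R.trans (R.+-congˡ (δ-linear M .▹-• c (v ∘ (a ∷_)) y))
  (solve 6 (λ m n c v v′ x → m :* (c :* v) :+ n :* (c :* v′) :+ c :* x := c :* (m :* v :+ n :* v′ :+ x)) R.refl
    (M a 0F) (M a 1F) c (v (0F ∷ y)) (v (1F ∷ y)) (δ M (v ∘ (a ∷_)) y))
  where open ℂS

κ-linear : ∀ M {D} → IsLinear (κ M {D})
κ-linear M {zero}  .▹-cong p y = p y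
κ-linear M {suc D} .▹-cong p (a ∷ y) =
  R.+-cong (R.*-congˡ (κ-linear M .▹-cong (p ∘ (0F ∷_)) y)) (R.*-congˡ (κ-linear M .▹-cong (p ∘ (1F ∷_)) y))
κ-linear M {zero}  .▹-+ v w y = R.refl
κ-linear M {suc D} .▹-+ v w (a ∷ y) = R.trans
  (R.+-cong (R.*-congˡ (κ-linear M .▹-+ (v ∘ (0F ∷_)) (w ∘ (0F ∷_)) y)) (R.*-congˡ (κ-linear M .▹-+ (v ∘ (1F ∷_)) (w ∘ (1F ∷_)) y)))
  (solve 6 (λ m n v v′ w w′ → m :* (v :+ w) :+ n :* (v′ :+ w′) := (m :* v :+ n :* v′) :+ (m :* w :+ n :* w′)) R.refl
    (M a 0F) (M a 1F) (κ M (v ∘ (0F ∷_)) y) (κ M (v ∘ (1F ∷_)) y) (κ M (w ∘ (0F ∷_)) y) (κ M (w ∘ (1F ∷_)) y))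
  where open ℂS
κ-linear M {zero}  .▹-• c v y = R.refl
κ-linear M {suc D} .▹-• c v (a ∷ y) = R.trans
  (R.+-cong (R.*-congˡ (κ-linear M .▹-• c (v ∘ (0F ∷_)) y)) (R.*-congˡ (κ-linear M .▹-• c (v ∘ (1F ∷_)) y)))
  (solve 5 (λ m n c v v′ → m :* (c :* v) :+ n :* (c :* v′) := c :* (m :* v :+ n :* v′)) R.refl
    (M a 0F) (M a 1F) c (κ M (v ∘ (0F ∷_)) y) (κ M (v ∘ (1F ∷_)) y))
  where open ℂS

module δ M {D} = IsLinear (δ-linear M {D})
module κ M {D} = IsLinear (κ-linear M {D})

δ-expand : ∀ N M {D} (v : V (suc D)) a y →
  δ N (δ M v ∘ (a ∷_)) y ≈
  M a 0F * δ N (v ∘ (0F ∷_)) y + M a 1F * δ N (v ∘ (1F ∷_)) y + δ N (δ M (v ∘ (a ∷_))) y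
δ-expand N M v a y = R.trans (δ.▹-+ N (M a 0F •ᵥ (v ∘ (0F ∷_)) +ᵥ M a 1F •ᵥ (v ∘ (1F ∷_))) (δ M (v ∘ (a ∷_))) y)
  (R.+-congʳ (δ.▹-combo N (M a 0F) (v ∘ (0F ∷_)) (M a 1F) (v ∘ (1F ∷_)) y))

-- Contributions of `M` and `N` in different tensor factors commute, so the commutator of the
-- derivations is the derivation of the 2×2 commutator, and `h` is all there is to check.
δ-commute : ∀ M N k K →
  (∀ a c → M a 0F * N 0F c + M a 1F * N 1F c ≈ (N a 0F * M 0F c + N a 1F * M 1F c) + k * K a c) →
  ∀ {D} (v : V D) → δ M (δ N v) ≈ᵥ δ N (δ M v) +ᵥ k •ᵥ δ K v
δ-commute M N k K h {zero}  v y = R.sym (R.trans (R.+-congˡ (R.zeroʳ k)) (R.+-identityʳ 0#))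
δ-commute M N k K h {suc D} v (a ∷ y) = begin
  m₀ * (N 0F 0F * v₀ + N 0F 1F * v₁ + x₀) + m₁ * (N 1F 0F * v₀ + N 1F 1F * v₁ + x₁) + δ M (δ N v ∘ (a ∷_)) y
    ≈⟨ R.+-congˡ (R.trans (δ-expand M N v a y) (R.+-congˡ (δ-commute M N k K h (v ∘ (a ∷_)) y))) ⟩
  m₀ * (N 0F 0F * v₀ + N 0F 1F * v₁ + x₀) + m₁ * (N 1F 0F * v₀ + N 1F 1F * v₁ + x₁) + (n₀ * z₀ + n₁ * z₁ + (t + k * s))
    ≈⟨ collect m₀ m₁ (N 0F 0F) (N 0F 1F) (N 1F 0F) (N 1F 1F) v₀ v₁ x₀ x₁ _ ⟩
  (m₀ * N 0F 0F + m₁ * N 1F 0F) * v₀ + (m₀ * N 0F 1F + m₁ * N 1F 1F) * v₁ + (m₀ * x₀ + m₁ * x₁ + (n₀ * z₀ + n₁ * z₁ + (t + k * s)))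
    ≈⟨ R.+-congʳ (R.+-cong (R.*-congʳ (h a 0F)) (R.*-congʳ (h a 1F))) ⟩
  (p₀ + k * K a 0F) * v₀ + (p₁ + k * K a 1F) * v₁ + (m₀ * x₀ + m₁ * x₁ + (n₀ * z₀ + n₁ * z₁ + (t + k * s)))
    ≈⟨ solve 11 (λ p₀ p₁ k c₀ c₁ v₀ v₁ x z t s →
         (p₀ :+ k :* c₀) :* v₀ :+ (p₁ :+ k :* c₁) :* v₁ :+ (x :+ (z :+ (t :+ k :* s)))
         := (p₀ :* v₀ :+ p₁ :* v₁ :+ (z :+ (x :+ t))) :+ k :* (c₀ :* v₀ :+ c₁ :* v₁ :+ s)) R.refl
         p₀ p₁ k (K a 0F) (K a 1F) v₀ v₁ (m₀ * x₀ + m₁ * x₁) (n₀ * z₀ + n₁ * z₁) t s ⟩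
  (p₀ * v₀ + p₁ * v₁ + (n₀ * z₀ + n₁ * z₁ + (m₀ * x₀ + m₁ * x₁ + t))) + k * (K a 0F * v₀ + K a 1F * v₁ + s)
    ≈⟨ R.+-congʳ (collect n₀ n₁ (M 0F 0F) (M 0F 1F) (M 1F 0F) (M 1F 1F) v₀ v₁ z₀ z₁ _) ⟨
  (n₀ * (M 0F 0F * v₀ + M 0F 1F * v₁ + z₀) + n₁ * (M 1F 0F * v₀ + M 1F 1F * v₁ + z₁) + (m₀ * x₀ + m₁ * x₁ + t)) + k * (K a 0F * v₀ + K a 1F * v₁ + s)
    ≈⟨ R.+-congʳ (R.+-congˡ (δ-expand N M v a y)) ⟨
  (n₀ * (M 0F 0F * v₀ + M 0F 1F * v₁ + z₀) + n₁ * (M 1F 0F * v₀ + M 1F 1F * v₁ + z₁) + δ N (δ M v ∘ (a ∷_)) y) + k * (K a 0F * v₀ + K a 1F * v₁ + s) ∎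
  where
  open ≈-Reasoning
  open ℂS
  m₀ = M a 0F
  m₁ = M a 1F
  n₀ = N a 0F
  n₁ = N a 1F
  v₀ = v (0F ∷ y)
  v₁ = v (1F ∷ y)
  x₀ = δ N (v ∘ (0F ∷_)) y
  x₁ = δ N (v ∘ (1F ∷_)) y
  z₀ = δ M (v ∘ (0F ∷_)) y
  z₁ = δ M (v ∘ (1F ∷_)) y
  t  = δ N (δ M (v ∘ (a ∷_))) y
  s  = δ K (v ∘ (a ∷_)) y
  p₀ = n₀ * M 0F 0F + n₁ * M 1F 0F
  p₁ = n₀ * M 0F 1F + n₁ * M 1F 1F
  collect : ∀ m₀ m₁ a b c d v₀ v₁ x₀ x₁ w →
    m₀ * (a * v₀ + b * v₁ + x₀) + m₁ * (c * v₀ + d * v₁ + x₁) + w ≈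
    (m₀ * a + m₁ * c) * v₀ + (m₀ * b + m₁ * d) * v₁ + (m₀ * x₀ + m₁ * x₁ + w)
  collect = solve 11 (λ m₀ m₁ a b c d v₀ v₁ x₀ x₁ w →
    m₀ :* (a :* v₀ :+ b :* v₁ :+ x₀) :+ m₁ :* (c :* v₀ :+ d :* v₁ :+ x₁) :+ w :=
    (m₀ :* a :+ m₁ :* c) :* v₀ :+ (m₀ :* b :+ m₁ :* d) :* v₁ :+ (m₀ :* x₀ :+ m₁ :* x₁ :+ w)) R.refl

δ-combo : ∀ M a N b K → (∀ i j → M i j ≈ a * N i j + b * K i j) →
          ∀ {D} (v : V D) → δ M v ≈ᵥ a •ᵥ δ N v +ᵥ b •ᵥ δ K v
δ-combo M a N b K h {zero}  v y = solve 2 (λ a b → con 0ℚ := a :* con 0ℚ :+ b :* con 0ℚ) R.refl a b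
  where open ℂS
δ-combo M a N b K h {suc D} v (i ∷ y) = R.trans
  (R.+-cong (R.+-cong (R.*-congʳ (h i 0F)) (R.*-congʳ (h i 1F))) (δ-combo M a N b K h (v ∘ (i ∷_)) y))
  (solve 10 (λ a b n n′ c c′ v v′ x z →
     (a :* n :+ b :* c) :* v :+ (a :* n′ :+ b :* c′) :* v′ :+ (a :* x :+ b :* z)
     := a :* (n :* v :+ n′ :* v′ :+ x) :+ b :* (c :* v :+ c′ :* v′ :+ z)) R.refl
     a b (N i 0F) (N i 1F) (K i 0F) (K i 1F) (v (0F ∷ y)) (v (1F ∷ y)) (δ N (v ∘ (i ∷_)) y) (δ K (v ∘ (i ∷_)) y))
  where open ℂS

-- A derivation acts in one tensor factor at a time. There the relation `M N = N M′` applies, while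
-- `κ N` acts alike on both sides in the other factors.
δ-κ : ∀ M N M′ → (∀ a c → M a 0F * N 0F c + M a 1F * N 1F c ≈ N a 0F * M′ 0F c + N a 1F * M′ 1F c) →
      ∀ {D} (v : V D) → δ M (κ N v) ≈ᵥ κ N (δ M′ v)
δ-κ M N M′ h {zero}  v y = R.refl
δ-κ M N M′ h {suc D} v (a ∷ y) = begin
  m₀ * (N 0F 0F * v₀ + N 0F 1F * v₁) + m₁ * (N 1F 0F * v₀ + N 1F 1F * v₁) + δ M (κ N v ∘ (a ∷_)) y
    ≈⟨ R.+-congˡ (R.trans (δ.▹-combo M n₀ (κ N (v ∘ (0F ∷_))) n₁ (κ N (v ∘ (1F ∷_))) y)
         (R.+-cong (R.*-congˡ (δ-κ M N M′ h (v ∘ (0F ∷_)) y)) (R.*-congˡ (δ-κ M N M′ h (v ∘ (1F ∷_)) y)))) ⟩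
  m₀ * (N 0F 0F * v₀ + N 0F 1F * v₁) + m₁ * (N 1F 0F * v₀ + N 1F 1F * v₁) + (n₀ * x₀ + n₁ * x₁)
    ≈⟨ collect m₀ m₁ (N 0F 0F) (N 0F 1F) (N 1F 0F) (N 1F 1F) v₀ v₁ _ ⟩
  (m₀ * N 0F 0F + m₁ * N 1F 0F) * v₀ + (m₀ * N 0F 1F + m₁ * N 1F 1F) * v₁ + (n₀ * x₀ + n₁ * x₁)
    ≈⟨ R.+-congʳ (R.+-cong (R.*-congʳ (h a 0F)) (R.*-congʳ (h a 1F))) ⟩
  (n₀ * M′ 0F 0F + n₁ * M′ 1F 0F) * v₀ + (n₀ * M′ 0F 1F + n₁ * M′ 1F 1F) * v₁ + (n₀ * x₀ + n₁ * x₁)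
    ≈⟨ collect n₀ n₁ (M′ 0F 0F) (M′ 0F 1F) (M′ 1F 0F) (M′ 1F 1F) v₀ v₁ _ ⟨
  n₀ * (M′ 0F 0F * v₀ + M′ 0F 1F * v₁) + n₁ * (M′ 1F 0F * v₀ + M′ 1F 1F * v₁) + (n₀ * x₀ + n₁ * x₁)
    ≈⟨ solve 6 (λ n n′ s t x x′ → n :* s :+ n′ :* t :+ (n :* x :+ n′ :* x′) := n :* (s :+ x) :+ n′ :* (t :+ x′)) R.refl n₀ n₁ _ _ x₀ x₁ ⟩
  n₀ * (M′ 0F 0F * v₀ + M′ 0F 1F * v₁ + x₀) + n₁ * (M′ 1F 0F * v₀ + M′ 1F 1F * v₁ + x₁)
    ≈⟨ R.+-cong (R.*-congˡ (expand 0F)) (R.*-congˡ (expand 1F)) ⟨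
  n₀ * κ N (δ M′ v ∘ (0F ∷_)) y + n₁ * κ N (δ M′ v ∘ (1F ∷_)) y ∎
  where
  open ≈-Reasoning
  open ℂS
  m₀ = M a 0F
  m₁ = M a 1F
  n₀ = N a 0F
  n₁ = N a 1F
  v₀ = κ N (v ∘ (0F ∷_)) y
  v₁ = κ N (v ∘ (1F ∷_)) y
  x₀ = κ N (δ M′ (v ∘ (0F ∷_))) y
  x₁ = κ N (δ M′ (v ∘ (1F ∷_))) y
  expand : ∀ b → κ N (δ M′ v ∘ (b ∷_)) y ≈ M′ b 0F * v₀ + M′ b 1F * v₁ + κ N (δ M′ (v ∘ (b ∷_))) y
  expand b = R.trans (κ.▹-+ N (M′ b 0F •ᵥ (v ∘ (0F ∷_)) +ᵥ M′ b 1F •ᵥ (v ∘ (1F ∷_))) (δ M′ (v ∘ (b ∷_))) y)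
    (R.+-congʳ (κ.▹-combo N (M′ b 0F) (v ∘ (0F ∷_)) (M′ b 1F) (v ∘ (1F ∷_)) y))
  collect : ∀ m₀ m₁ a b c d v₀ v₁ w →
    m₀ * (a * v₀ + b * v₁) + m₁ * (c * v₀ + d * v₁) + w ≈ (m₀ * a + m₁ * c) * v₀ + (m₀ * b + m₁ * d) * v₁ + w
  collect = solve 9 (λ m₀ m₁ a b c d v₀ v₁ w →
    m₀ :* (a :* v₀ :+ b :* v₁) :+ m₁ :* (c :* v₀ :+ d :* v₁) :+ w := (m₀ :* a :+ m₁ :* c) :* v₀ :+ (m₀ :* b :+ m₁ :* d) :* v₁ :+ w) R.refl

-- The given matrices as derivations and group-like maps.

KronPower-▹ : ∀ M {D} (v : V D) → KronPower M ▹ v ≈ᵥ κ M v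
KronPower-▹ M {zero}  v [] = R.*-identityˡ (v [])
KronPower-▹ M {suc D} v (a ∷ y) = R.trans (R.+-congˡ (R.+-identityʳ _)) (R.+-cong (part 0F) (part 1F))
  where
  part : ∀ b → ∑ₓ (λ z → M a b * KronPower M y z * v (b ∷ z)) ≈ M a b * κ M (v ∘ (b ∷_)) y
  part b = R.trans (∑ₓ-cong {D} λ z → R.*-assoc (M a b) (KronPower M y z) (v (b ∷ z)))
    (R.trans (∑ₓ-*ˡ {D} (M a b) (λ z → KronPower M y z * v (b ∷ z))) (R.*-congˡ (KronPower-▹ M (v ∘ (b ∷_)) y)))

-- An equation of booleans, since the entries of `A` and `Iₘ` branch on `does`. It identifies the
-- off-diagonal blocks of `A` with identity matrices.
differences-zero : ∀ {D} (y z : X D) → does (differences y z ℕ.≟ 0) ≡ does (y ≟ₓ z)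
differences-zero []       []       = refl
differences-zero (0F ∷ y) (0F ∷ z) = differences-zero y z
differences-zero (0F ∷ y) (1F ∷ z) = refl
differences-zero (1F ∷ y) (0F ∷ z) = refl
differences-zero (1F ∷ y) (1F ∷ z) = differences-zero y z

-- `σA` and `σA*` are the Pauli matrices X and Z, and `σAᵋ` is minus Y. `σL` and `σR` are elementary
-- matrices that lower and raise the number of ones in a vertex by one.
σA σA* σAᵋ σL σR σI : Fin 2 → Fin 2 → ℂ
σA 0F 0F = 0#
σA 0F 1F = 1#
σA 1F 0F = 1#
σA 1F 1F = 0#
σA* 0F 0F = 1#
σA* 0F 1F = 0#
σA* 1F 0F = 0#
σA* 1F 1F = - 1#
σAᵋ 0F 0F = 0#
σAᵋ 0F 1F = 𝐢
σAᵋ 1F 0F = - 𝐢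
σAᵋ 1F 1F = 0#
σL 0F 0F = 0#
σL 0F 1F = 1#
σL 1F _  = 0#
σR 0F _  = 0#
σR 1F 0F = 1#
σR 1F 1F = 0#
σI 0F 0F = 1#
σI 0F 1F = 0#
σI 1F 0F = 0#
σI 1F 1F = 1#

-- Split by the first coordinate: the diagonal blocks are the adjacency matrix of the smaller cube,
-- the other two are identity matrices.
A-▹ : ∀ {D} (v : V D) → A ▹ v ≈ᵥ δ σA v
A-▹ {zero}  v []       = R.zeroˡ (v [])
A-▹ {suc D} v (a ∷ y) = R.trans (R.+-congˡ (R.+-identityʳ _)) (go a)
  where
  open ℂS
  off : ∀ b → ∑ₓ (λ z → (if does (differences y z ℕ.≟ 0) then 1# else 0#) * v (b ∷ z)) ≈ v (b ∷ y)
  off b = R.trans (∑ₓ-cong {D} λ z → R.*-congʳ (R.reflexive (cong (λ t → if t then 1# else 0#) (differences-zero y z))))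
                  (I-▹ (v ∘ (b ∷_)) y)
  go : ∀ a → ∑ₓ (λ z → A (a ∷ y) (0F ∷ z) * v (0F ∷ z)) + ∑ₓ (λ z → A (a ∷ y) (1F ∷ z) * v (1F ∷ z))
           ≈ δ σA v (a ∷ y)
  go 0F = R.trans (R.+-cong (A-▹ (v ∘ (0F ∷_)) y) (off 1F))
    (solve 3 (λ x v w → x :+ w := con 0ℚ :* v :+ con 1ℚ :* w :+ x) R.refl (δ σA (v ∘ (0F ∷_)) y) (v (0F ∷ y)) (v (1F ∷ y)))
  go 1F = R.trans (R.+-cong (off 0F) (A-▹ (v ∘ (1F ∷_)) y))
    (solve 3 (λ x v w → v :+ x := con 1ℚ :* v :+ con 0ℚ :* w :+ x) R.refl (δ σA (v ∘ (1F ∷_)) y) (v (0F ∷ y)) (v (1F ∷ y)))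

θ-suc : ∀ D i → ι (θ (suc D) i) ≈ 1# + ι (θ D i)
θ-suc D i = R.trans (ι-cong eq) (ι-+ 1ℚ (θ D i))
  where
  open ℚS
  eq : θ (suc D) i ≡ 1ℚ ℚ.+ θ D i
  eq rewrite θ-ℕ (suc D) i | θ-ℕ D i | ℕ→ℚ-suc D = solve 2 (λ d i → (con 1ℚ :+ d) :- con two :* i := con 1ℚ :+ (d :- con two :* i)) refl (ℕ→ℚ D) (ℕ→ℚ i)

θ-suc-suc : ∀ D i → ι (θ (suc D) (suc i)) ≈ - 1# + ι (θ D i)
θ-suc-suc D i = R.trans (ι-cong eq) (R.trans (ι-+ (ℚ.- 1ℚ) (θ D i)) (R.+-congʳ (ι-neg 1ℚ)))
  where
  open ℚS
  eq : θ (suc D) (suc i) ≡ ℚ.- 1ℚ ℚ.+ θ D i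
  eq rewrite θ-ℕ (suc D) (suc i) | θ-ℕ D i | ℕ→ℚ-suc D | ℕ→ℚ-suc i = solve 2 (λ d i → (con 1ℚ :+ d) :- con two :* (con 1ℚ :+ i) := :- con 1ℚ :+ (d :- con two :* i)) refl (ℕ→ℚ D) (ℕ→ℚ i)

-- Every coordinate `0` contributes `1` and every coordinate `1` contributes `-1`.
σA*-weight : ∀ {D} (v : V D) y → δ σA* v y ≈ ι (θ D (weight y)) * v y
σA*-weight {zero}  v []       = R.sym (R.zeroˡ (v []))
σA*-weight {suc D} v (0F ∷ y) = R.trans (R.+-congˡ (σA*-weight (v ∘ (0F ∷_)) y))
  (R.trans (solve 3 (λ t v w → con 1ℚ :* v :+ con 0ℚ :* w :+ t :* v := (con 1ℚ :+ t) :* v) R.refl (ι (θ D (weight y))) (v (0F ∷ y)) (v (1F ∷ y)))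
           (R.*-congʳ (R.sym (θ-suc D (weight y)))))
  where open ℂS
σA*-weight {suc D} v (1F ∷ y) = R.trans (R.+-congˡ (σA*-weight (v ∘ (1F ∷_)) y))
  (R.trans (solve 3 (λ t v w → con 0ℚ :* w :+ :- con 1ℚ :* v :+ t :* v := (:- con 1ℚ :+ t) :* v) R.refl (ι (θ D (weight y))) (v (1F ∷ y)) (v (0F ∷ y)))
           (R.*-congʳ (R.sym (θ-suc-suc D (weight y)))))
  where open ℂS

A*-▹-δ : ∀ {D} (v : V D) → A* ▹ v ≈ᵥ δ σA* v
A*-▹-δ v y = R.trans (A*-▹ v y) (R.sym (σA*-weight v y))


2𝐢 : ℂ
2𝐢 = ι two * 𝐢


-- The three commutators follow one cyclic order with one constant, so that the single lemma
-- `commute-square` can serve each generator in turn.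
[A,A*] : ∀ {D} (v : V D) → δ σA (δ σA* v) ≈ᵥ δ σA* (δ σA v) +ᵥ 2𝐢 •ᵥ δ σAᵋ v
[A,A*] = δ-commute σA σA* 2𝐢 σAᵋ λ where
  0F 0F → ≈-pointwise (λ _ → refl) (λ _ → refl)
  0F 1F → ≈-pointwise (λ _ → refl) (λ _ → refl)
  1F 0F → ≈-pointwise (λ _ → refl) (λ _ → refl)
  1F 1F → ≈-pointwise (λ _ → refl) (λ _ → refl)

[Aᵋ,A] : ∀ {D} (v : V D) → δ σAᵋ (δ σA v) ≈ᵥ δ σA (δ σAᵋ v) +ᵥ 2𝐢 •ᵥ δ σA* v
[Aᵋ,A] = δ-commute σAᵋ σA 2𝐢 σA* λ where
  0F 0F → ≈-pointwise (λ _ → refl) (λ _ → refl)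
  0F 1F → ≈-pointwise (λ _ → refl) (λ _ → refl)
  1F 0F → ≈-pointwise (λ _ → refl) (λ _ → refl)
  1F 1F → ≈-pointwise (λ _ → refl) (λ _ → refl)

[A*,Aᵋ] : ∀ {D} (v : V D) → δ σA* (δ σAᵋ v) ≈ᵥ δ σAᵋ (δ σA* v) +ᵥ 2𝐢 •ᵥ δ σA v
[A*,Aᵋ] = δ-commute σA* σAᵋ 2𝐢 σA λ where
  0F 0F → ≈-pointwise (λ _ → refl) (λ _ → refl)
  0F 1F → ≈-pointwise (λ _ → refl) (λ _ → refl)
  1F 0F → ≈-pointwise (λ _ → refl) (λ _ → refl)
  1F 1F → ≈-pointwise (λ _ → refl) (λ _ → refl)

[L,R] : ∀ {D} (v : V D) → δ σL (δ σR v) ≈ᵥ δ σR (δ σL v) +ᵥ 1# •ᵥ δ σA* v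
[L,R] = δ-commute σL σR 1# σA* λ where
  0F 0F → ≈-pointwise (λ _ → refl) (λ _ → refl)
  0F 1F → ≈-pointwise (λ _ → refl) (λ _ → refl)
  1F 0F → ≈-pointwise (λ _ → refl) (λ _ → refl)
  1F 1F → ≈-pointwise (λ _ → refl) (λ _ → refl)

A-split : ∀ {D} (v : V D) → δ σA v ≈ᵥ 1# •ᵥ δ σL v +ᵥ 1# •ᵥ δ σR v
A-split = δ-combo σA 1# σL 1# σR λ where
  0F 0F → ≈-pointwise (λ _ → refl) (λ _ → refl)
  0F 1F → ≈-pointwise (λ _ → refl) (λ _ → refl)
  1F 0F → ≈-pointwise (λ _ → refl) (λ _ → refl)
  1F 1F → ≈-pointwise (λ _ → refl) (λ _ → refl)

L-split : ∀ {D} (v : V D) → δ σL v ≈ᵥ ι ½ •ᵥ δ σA v +ᵥ (ι ½ * - 𝐢) •ᵥ δ σAᵋ v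
L-split = δ-combo σL (ι ½) σA (ι ½ * - 𝐢) σAᵋ λ where
  0F 0F → ≈-pointwise (λ _ → refl) (λ _ → refl)
  0F 1F → ≈-pointwise (λ _ → refl) (λ _ → refl)
  1F 0F → ≈-pointwise (λ _ → refl) (λ _ → refl)
  1F 1F → ≈-pointwise (λ _ → refl) (λ _ → refl)

R-split : ∀ {D} (v : V D) → δ σR v ≈ᵥ ι ½ •ᵥ δ σA v +ᵥ (ι ½ * 𝐢) •ᵥ δ σAᵋ v
R-split = δ-combo σR (ι ½) σA (ι ½ * 𝐢) σAᵋ λ where
  0F 0F → ≈-pointwise (λ _ → refl) (λ _ → refl)
  0F 1F → ≈-pointwise (λ _ → refl) (λ _ → refl)
  1F 0F → ≈-pointwise (λ _ → refl) (λ _ → refl)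
  1F 1F → ≈-pointwise (λ _ → refl) (λ _ → refl)

-- Conjugation by `P` sends `A` to `A*`, `A*` to `Aᵋ` and `Aᵋ` to `A`. This and the next five
-- identities record it for `P` and its inverse.
A*P≈PA : ∀ {D} (v : V D) → δ σA* (κ P₁ v) ≈ᵥ κ P₁ (δ σA v)
A*P≈PA = δ-κ σA* P₁ σA λ where
  0F 0F → ≈-pointwise (λ _ → refl) (λ _ → refl)
  0F 1F → ≈-pointwise (λ _ → refl) (λ _ → refl)
  1F 0F → ≈-pointwise (λ _ → refl) (λ _ → refl)
  1F 1F → ≈-pointwise (λ _ → refl) (λ _ → refl)

AP≈PAᵋ : ∀ {D} (v : V D) → δ σA (κ P₁ v) ≈ᵥ κ P₁ (δ σAᵋ v)
AP≈PAᵋ = δ-κ σA P₁ σAᵋ λ where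
  0F 0F → ≈-pointwise (λ _ → refl) (λ _ → refl)
  0F 1F → ≈-pointwise (λ _ → refl) (λ _ → refl)
  1F 0F → ≈-pointwise (λ _ → refl) (λ _ → refl)
  1F 1F → ≈-pointwise (λ _ → refl) (λ _ → refl)

AᵋP≈PA* : ∀ {D} (v : V D) → δ σAᵋ (κ P₁ v) ≈ᵥ κ P₁ (δ σA* v)
AᵋP≈PA* = δ-κ σAᵋ P₁ σA* λ where
  0F 0F → ≈-pointwise (λ _ → refl) (λ _ → refl)
  0F 1F → ≈-pointwise (λ _ → refl) (λ _ → refl)
  1F 0F → ≈-pointwise (λ _ → refl) (λ _ → refl)
  1F 1F → ≈-pointwise (λ _ → refl) (λ _ → refl)

AP⁻¹≈P⁻¹A* : ∀ {D} (v : V D) → δ σA (κ P₁⁻¹ v) ≈ᵥ κ P₁⁻¹ (δ σA* v)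
AP⁻¹≈P⁻¹A* = δ-κ σA P₁⁻¹ σA* λ where
  0F 0F → ≈-pointwise (λ _ → refl) (λ _ → refl)
  0F 1F → ≈-pointwise (λ _ → refl) (λ _ → refl)
  1F 0F → ≈-pointwise (λ _ → refl) (λ _ → refl)
  1F 1F → ≈-pointwise (λ _ → refl) (λ _ → refl)

AᵋP⁻¹≈P⁻¹A : ∀ {D} (v : V D) → δ σAᵋ (κ P₁⁻¹ v) ≈ᵥ κ P₁⁻¹ (δ σA v)
AᵋP⁻¹≈P⁻¹A = δ-κ σAᵋ P₁⁻¹ σA λ where
  0F 0F → ≈-pointwise (λ _ → refl) (λ _ → refl)
  0F 1F → ≈-pointwise (λ _ → refl) (λ _ → refl)
  1F 0F → ≈-pointwise (λ _ → refl) (λ _ → refl)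
  1F 1F → ≈-pointwise (λ _ → refl) (λ _ → refl)

A*P⁻¹≈P⁻¹Aᵋ : ∀ {D} (v : V D) → δ σA* (κ P₁⁻¹ v) ≈ᵥ κ P₁⁻¹ (δ σAᵋ v)
A*P⁻¹≈P⁻¹Aᵋ = δ-κ σA* P₁⁻¹ σAᵋ λ where
  0F 0F → ≈-pointwise (λ _ → refl) (λ _ → refl)
  0F 1F → ≈-pointwise (λ _ → refl) (λ _ → refl)
  1F 0F → ≈-pointwise (λ _ → refl) (λ _ → refl)
  1F 1F → ≈-pointwise (λ _ → refl) (λ _ → refl)

P-▹ : ∀ {D} (v : V D) → P ▹ v ≈ᵥ κ P₁ v
P-▹ = KronPower-▹ P₁

P⁻¹-▹ : ∀ {D} (v : V D) → P⁻¹ ▹ v ≈ᵥ κ P₁⁻¹ v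
P⁻¹-▹ = KronPower-▹ P₁⁻¹

≈ₘ-▹ : ∀ {D} {M N : Mat D} → M ≈ₘ N → ∀ v → M ▹ v ≈ᵥ N ▹ v
≈ₘ-▹ p v y = ∑ₓ-cong λ z → R.*-congʳ (p y z)

PP⁻¹ : ∀ {D} (v : V D) → κ P₁ (κ P₁⁻¹ v) ≈ᵥ v
PP⁻¹ v y = begin
  κ P₁ (κ P₁⁻¹ v) y   ≈⟨ P-▹ (κ P₁⁻¹ v) y ⟨
  (P ▹ κ P₁⁻¹ v) y    ≈⟨ ▹-linear P .▹-cong (P⁻¹-▹ v) y ⟨
  (P ▹ P⁻¹ ▹ v) y     ≈⟨ ·-▹ P P⁻¹ v y ⟨
  ((P ·ₘ P⁻¹) ▹ v) y   ≈⟨ ≈ₘ-▹ P-inverseʳ v y ⟩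
  (Iₘ ▹ v) y          ≈⟨ I-▹ v y ⟩
  v y                 ∎
  where open ≈-Reasoning

P⁻¹P : ∀ {D} (v : V D) → κ P₁⁻¹ (κ P₁ v) ≈ᵥ v
P⁻¹P v y = begin
  κ P₁⁻¹ (κ P₁ v) y   ≈⟨ P⁻¹-▹ (κ P₁ v) y ⟨
  (P⁻¹ ▹ κ P₁ v) y    ≈⟨ ▹-linear P⁻¹ .▹-cong (P-▹ v) y ⟨
  (P⁻¹ ▹ P ▹ v) y     ≈⟨ ·-▹ P⁻¹ P v y ⟨
  ((P⁻¹ ·ₘ P) ▹ v) y   ≈⟨ ≈ₘ-▹ P-inverseˡ v y ⟩
  (Iₘ ▹ v) y          ≈⟨ I-▹ v y ⟩
  v y                 ∎
  where open ≈-Reasoning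

-- The Hermitian form, adjoints and isometries.

conj-cong : ∀ {z w} → z ≈ w → conj z ≈ conj w
conj-cong (mk≈ᶜ p q) = mk≈ᶜ p (-ᵣ-cong q)

conj-+ : ∀ z w → conj (z + w) ≈ conj z + conj w
conj-+ z w = ≈-pointwise (λ _ → refl) (λ n → ℚ.neg-distrib-+ (seq (im z) n) (seq (im w) n))

conj-* : ∀ z w → conj (z * w) ≈ conj z * conj w
conj-* z w = ≈-pointwise
  (λ n → solve 4 (λ a b c d → a :* c :- b :* d := a :* c :- (:- b) :* (:- d)) refl (seq (re z) n) (seq (im z) n) (seq (re w) n) (seq (im w) n))
  (λ n → solve 4 (λ a b c d → :- (a :* d :+ b :* c) := a :* (:- d) :+ (:- b) :* c) refl (seq (re z) n) (seq (im z) n) (seq (re w) n) (seq (im w) n))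
  where open ℚS

conj-ι : ∀ q → conj (ι q) ≈ ι q
conj-ι q = ≈-pointwise (λ _ → refl) (λ _ → refl)

⟨⟩-cong : ∀ {D} {v v′ w w′ : V D} → v ≈ᵥ v′ → w ≈ᵥ w′ → ⟨ v , w ⟩ ≈ ⟨ v′ , w′ ⟩
⟨⟩-cong {D} p q = ∑ₓ-cong {D} λ y → R.*-cong (p y) (conj-cong (q y))

⟨⟩-+ˡ : ∀ {D} (v v′ w : V D) → ⟨ v +ᵥ v′ , w ⟩ ≈ ⟨ v , w ⟩ + ⟨ v′ , w ⟩
⟨⟩-+ˡ {D} v v′ w = R.trans (∑ₓ-cong {D} λ y → R.distribʳ (conj (w y)) (v y) (v′ y)) (∑ₓ-+ {D} _ _)

⟨⟩-•ˡ : ∀ {D} c (v w : V D) → ⟨ c •ᵥ v , w ⟩ ≈ c * ⟨ v , w ⟩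
⟨⟩-•ˡ {D} c v w = R.trans (∑ₓ-cong {D} λ y → R.*-assoc c (v y) (conj (w y))) (∑ₓ-*ˡ {D} c _)

⟨⟩-+ʳ : ∀ {D} (v w w′ : V D) → ⟨ v , w +ᵥ w′ ⟩ ≈ ⟨ v , w ⟩ + ⟨ v , w′ ⟩
⟨⟩-+ʳ {D} v w w′ = R.trans (∑ₓ-cong {D} λ y → R.trans (R.*-congˡ (conj-+ (w y) (w′ y))) (R.distribˡ (v y) _ _)) (∑ₓ-+ {D} _ _)

⟨⟩-•ʳ : ∀ {D} c (v w : V D) → ⟨ v , c •ᵥ w ⟩ ≈ conj c * ⟨ v , w ⟩
⟨⟩-•ʳ {D} c v w = R.trans
  (∑ₓ-cong {D} λ y → R.trans (R.*-congˡ (conj-* c (w y))) (solve 3 (λ v c w → v :* (c :* w) := c :* (v :* w)) R.refl (v y) (conj c) (conj (w y))))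
  (∑ₓ-*ˡ {D} (conj c) _)
  where open ℂS

δ-adjoint : ∀ M N → (∀ a b → M a b ≈ conj (N b a)) → ∀ {D} (v w : V D) → ⟨ δ M v , w ⟩ ≈ ⟨ v , δ N w ⟩
δ-adjoint M N h {zero}  v w = R.trans (R.zeroˡ (conj (w []))) (R.sym (R.trans (R.*-congˡ (conj-ι 0ℚ)) (R.zeroʳ (v []))))
δ-adjoint M N h {suc D} v w = begin
  ⟨ δ M v ∘ (0F ∷_) , w₀ ⟩ + (⟨ δ M v ∘ (1F ∷_) , w₁ ⟩ + 0#)
    ≈⟨ R.+-cong (expandˡ 0F) (R.+-congʳ (expandˡ 1F)) ⟩
  (M 0F 0F * ⟨ v₀ , w₀ ⟩ + M 0F 1F * ⟨ v₁ , w₀ ⟩ + x₀) + ((M 1F 0F * ⟨ v₀ , w₁ ⟩ + M 1F 1F * ⟨ v₁ , w₁ ⟩ + x₁) + 0#)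
    ≈⟨ R.+-cong (R.+-congʳ (R.+-cong (R.*-congʳ (h 0F 0F)) (R.*-congʳ (h 0F 1F)))) (R.+-congʳ (R.+-congʳ (R.+-cong (R.*-congʳ (h 1F 0F)) (R.*-congʳ (h 1F 1F))))) ⟩
  (conj (N 0F 0F) * ⟨ v₀ , w₀ ⟩ + conj (N 1F 0F) * ⟨ v₁ , w₀ ⟩ + x₀) + ((conj (N 0F 1F) * ⟨ v₀ , w₁ ⟩ + conj (N 1F 1F) * ⟨ v₁ , w₁ ⟩ + x₁) + 0#)
    ≈⟨ solve 6 (λ a b c d x x′ → (a :+ b :+ x) :+ ((c :+ d :+ x′) :+ con 0ℚ) := (a :+ c :+ x) :+ ((b :+ d :+ x′) :+ con 0ℚ)) R.refl _ _ _ _ x₀ x₁ ⟩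
  (conj (N 0F 0F) * ⟨ v₀ , w₀ ⟩ + conj (N 0F 1F) * ⟨ v₀ , w₁ ⟩ + x₀) + ((conj (N 1F 0F) * ⟨ v₁ , w₀ ⟩ + conj (N 1F 1F) * ⟨ v₁ , w₁ ⟩ + x₁) + 0#)
    ≈⟨ R.+-cong (expandʳ 0F) (R.+-congʳ (expandʳ 1F)) ⟨
  ⟨ v₀ , δ N w ∘ (0F ∷_) ⟩ + (⟨ v₁ , δ N w ∘ (1F ∷_) ⟩ + 0#) ∎
  where
  open ≈-Reasoning
  open ℂS
  v₀ = v ∘ (0F ∷_)
  v₁ = v ∘ (1F ∷_)
  w₀ = w ∘ (0F ∷_)
  w₁ = w ∘ (1F ∷_)
  x₀ = ⟨ v₀ , δ N w₀ ⟩
  x₁ = ⟨ v₁ , δ N w₁ ⟩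
  expandˡ : ∀ a → ⟨ δ M v ∘ (a ∷_) , w ∘ (a ∷_) ⟩ ≈ M a 0F * ⟨ v₀ , w ∘ (a ∷_) ⟩ + M a 1F * ⟨ v₁ , w ∘ (a ∷_) ⟩ + ⟨ v ∘ (a ∷_) , δ N (w ∘ (a ∷_)) ⟩
  expandˡ a = R.trans (⟨⟩-+ˡ (M a 0F •ᵥ v₀ +ᵥ M a 1F •ᵥ v₁) (δ M (v ∘ (a ∷_))) (w ∘ (a ∷_)))
    (R.+-cong (R.trans (⟨⟩-+ˡ (M a 0F •ᵥ v₀) (M a 1F •ᵥ v₁) (w ∘ (a ∷_)))
                       (R.+-cong (⟨⟩-•ˡ (M a 0F) v₀ (w ∘ (a ∷_))) (⟨⟩-•ˡ (M a 1F) v₁ (w ∘ (a ∷_)))))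
              (δ-adjoint M N h (v ∘ (a ∷_)) (w ∘ (a ∷_))))
  expandʳ : ∀ a → ⟨ v ∘ (a ∷_) , δ N w ∘ (a ∷_) ⟩ ≈ conj (N a 0F) * ⟨ v ∘ (a ∷_) , w₀ ⟩ + conj (N a 1F) * ⟨ v ∘ (a ∷_) , w₁ ⟩ + ⟨ v ∘ (a ∷_) , δ N (w ∘ (a ∷_)) ⟩
  expandʳ a = R.trans (⟨⟩-+ʳ (v ∘ (a ∷_)) (N a 0F •ᵥ w₀ +ᵥ N a 1F •ᵥ w₁) (δ N (w ∘ (a ∷_))))
    (R.+-congʳ (R.trans (⟨⟩-+ʳ (v ∘ (a ∷_)) (N a 0F •ᵥ w₀) (N a 1F •ᵥ w₁))
                        (R.+-cong (⟨⟩-•ʳ (N a 0F) (v ∘ (a ∷_)) w₀) (⟨⟩-•ʳ (N a 1F) (v ∘ (a ∷_)) w₁))))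

A-adjoint : ∀ {D} (v w : V D) → ⟨ δ σA v , w ⟩ ≈ ⟨ v , δ σA w ⟩
A-adjoint = δ-adjoint σA σA λ where
  0F 0F → ≈-pointwise (λ _ → refl) (λ _ → refl)
  0F 1F → ≈-pointwise (λ _ → refl) (λ _ → refl)
  1F 0F → ≈-pointwise (λ _ → refl) (λ _ → refl)
  1F 1F → ≈-pointwise (λ _ → refl) (λ _ → refl)

-- The hypothesis says that the columns of `M` are orthogonal of squared length `k`, and each tensor
-- factor multiplies the form by `k`. The scalar is kept because `P₁` becomes unitary only after
-- division by the square root of 2.
κ-isometry : ∀ M k → (∀ b c → M 0F b * conj (M 0F c) + M 1F b * conj (M 1F c) ≈ k * σI b c) →
             ∀ {D} (v w : V D) → ⟨ κ M v , κ M w ⟩ ≈ k ^ D * ⟨ v , w ⟩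
κ-isometry M k h {zero}  v w = R.sym (R.*-identityˡ _)
κ-isometry M k h {suc D} v w = begin
  ⟨ κ M v ∘ (0F ∷_) , κ M w ∘ (0F ∷_) ⟩ + (⟨ κ M v ∘ (1F ∷_) , κ M w ∘ (1F ∷_) ⟩ + 0#)
    ≈⟨ R.+-cong (expand 0F) (R.+-congʳ (expand 1F)) ⟩
  _
    ≈⟨ solve 12 (λ m₀₀ m₀₁ m₁₀ m₁₁ n₀₀ n₀₁ n₁₀ n₁₁ g₀₀ g₀₁ g₁₀ g₁₁ →
         (m₀₀ :* (n₀₀ :* g₀₀ :+ n₀₁ :* g₀₁) :+ m₀₁ :* (n₀₀ :* g₁₀ :+ n₀₁ :* g₁₁)) :+ ((m₁₀ :* (n₁₀ :* g₀₀ :+ n₁₁ :* g₀₁) :+ m₁₁ :* (n₁₀ :* g₁₀ :+ n₁₁ :* g₁₁)) :+ con 0ℚ)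
         := (m₀₀ :* n₀₀ :+ m₁₀ :* n₁₀) :* g₀₀ :+ (m₀₀ :* n₀₁ :+ m₁₀ :* n₁₁) :* g₀₁ :+ (m₀₁ :* n₀₀ :+ m₁₁ :* n₁₀) :* g₁₀ :+ (m₀₁ :* n₀₁ :+ m₁₁ :* n₁₁) :* g₁₁) R.refl
         (M 0F 0F) (M 0F 1F) (M 1F 0F) (M 1F 1F) (conj (M 0F 0F)) (conj (M 0F 1F)) (conj (M 1F 0F)) (conj (M 1F 1F)) (g v₀ w₀) (g v₀ w₁) (g v₁ w₀) (g v₁ w₁) ⟩
  _
    ≈⟨ R.+-cong (R.+-cong (R.+-cong (R.*-cong (h 0F 0F) (κ-isometry M k h v₀ w₀)) (R.*-congʳ (h 0F 1F))) (R.*-congʳ (h 1F 0F))) (R.*-cong (h 1F 1F) (κ-isometry M k h v₁ w₁)) ⟩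
  (k * 1#) * (k ^ D * ⟨ v₀ , w₀ ⟩) + (k * 0#) * g v₀ w₁ + (k * 0#) * g v₁ w₀ + (k * 1#) * (k ^ D * ⟨ v₁ , w₁ ⟩)
    ≈⟨ solve 6 (λ k p a b c d → (k :* con 1ℚ) :* (p :* a) :+ (k :* con 0ℚ) :* b :+ (k :* con 0ℚ) :* c :+ (k :* con 1ℚ) :* (p :* d) := k :* p :* (a :+ (d :+ con 0ℚ))) R.refl
         k (k ^ D) ⟨ v₀ , w₀ ⟩ (g v₀ w₁) (g v₁ w₀) ⟨ v₁ , w₁ ⟩ ⟩
  k * k ^ D * (⟨ v₀ , w₀ ⟩ + (⟨ v₁ , w₁ ⟩ + 0#)) ∎
  where
  open ≈-Reasoning
  open ℂS
  v₀ = v ∘ (0F ∷_)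
  v₁ = v ∘ (1F ∷_)
  w₀ = w ∘ (0F ∷_)
  w₁ = w ∘ (1F ∷_)
  g : V D → V D → ℂ
  g v w = ⟨ κ M v , κ M w ⟩
  expandʳ : ∀ a x → ⟨ x , κ M w ∘ (a ∷_) ⟩ ≈ conj (M a 0F) * ⟨ x , κ M w₀ ⟩ + conj (M a 1F) * ⟨ x , κ M w₁ ⟩
  expandʳ a x = R.trans (⟨⟩-+ʳ x (M a 0F •ᵥ κ M w₀) (M a 1F •ᵥ κ M w₁)) (R.+-cong (⟨⟩-•ʳ (M a 0F) x (κ M w₀)) (⟨⟩-•ʳ (M a 1F) x (κ M w₁)))
  expand : ∀ a → ⟨ κ M v ∘ (a ∷_) , κ M w ∘ (a ∷_) ⟩ ≈
    M a 0F * (conj (M a 0F) * g v₀ w₀ + conj (M a 1F) * g v₀ w₁) + M a 1F * (conj (M a 0F) * g v₁ w₀ + conj (M a 1F) * g v₁ w₁)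
  expand a = R.trans (⟨⟩-+ˡ (M a 0F •ᵥ κ M v₀) (M a 1F •ᵥ κ M v₁) (κ M w ∘ (a ∷_)))
    (R.+-cong (R.trans (⟨⟩-•ˡ (M a 0F) (κ M v₀) (κ M w ∘ (a ∷_))) (R.*-congˡ (expandʳ a (κ M v₀))))
              (R.trans (⟨⟩-•ˡ (M a 1F) (κ M v₁) (κ M w ∘ (a ∷_))) (R.*-congˡ (expandʳ a (κ M v₁)))))

P-isometry : ∀ {D} (v w : V D) → ⟨ κ P₁ v , κ P₁ w ⟩ ≈ ι two ^ D * ⟨ v , w ⟩
P-isometry = κ-isometry P₁ (ι two) λ where
  0F 0F → ≈-pointwise (λ _ → refl) (λ _ → refl)
  0F 1F → ≈-pointwise (λ _ → refl) (λ _ → refl)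
  1F 0F → ≈-pointwise (λ _ → refl) (λ _ → refl)
  1F 1F → ≈-pointwise (λ _ → refl) (λ _ → refl)

P⁻¹-isometry : ∀ {D} (v w : V D) → ⟨ κ P₁⁻¹ v , κ P₁⁻¹ w ⟩ ≈ ι ½ ^ D * ⟨ v , w ⟩
P⁻¹-isometry = κ-isometry P₁⁻¹ (ι ½) λ where
  0F 0F → ≈-pointwise (λ _ → refl) (λ _ → refl)
  0F 1F → ≈-pointwise (λ _ → refl) (λ _ → refl)
  1F 0F → ≈-pointwise (λ _ → refl) (λ _ → refl)
  1F 1F → ≈-pointwise (λ _ → refl) (λ _ → refl)

-- `δ σL v` at `y` is the sum of `v` over the vertices that arise from `y` by turning one `0` into
-- `1`.
L-support : ∀ {D} (v : V D) y → (∀ z → weight z ≡ suc (weight y) → v z ≈ 0#) → δ σL v y ≈ 0#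
L-support {zero}  v y        h = R.refl
L-support {suc D} v (0F ∷ y) h = R.trans
  (R.+-cong (R.+-cong (R.zeroˡ _) (R.trans (R.*-identityˡ _) (h (1F ∷ y) refl))) (L-support (v ∘ (0F ∷_)) y λ z → h (0F ∷ z)))
  (solve 0 (con 0ℚ :+ con 0ℚ :+ con 0ℚ := con 0ℚ) R.refl)
  where open ℂS
L-support {suc D} v (1F ∷ y) h = R.trans
  (R.+-cong (R.+-cong (R.zeroˡ _) (R.zeroˡ _)) (L-support (v ∘ (1F ∷_)) y λ z e → h (1F ∷ z) (cong suc e)))
  (solve 0 (con 0ℚ :+ con 0ℚ :+ con 0ℚ := con 0ℚ) R.refl)
  where open ℂS

R-support : ∀ {D} (v : V D) y → (∀ z → suc (weight z) ≡ weight y → v z ≈ 0#) → δ σR v y ≈ 0#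
R-support {zero}  v y        h = R.refl
R-support {suc D} v (1F ∷ y) h = R.trans
  (R.+-cong (R.+-cong (R.trans (R.*-identityˡ _) (h (0F ∷ y) refl)) (R.zeroˡ _)) (R-support (v ∘ (1F ∷_)) y λ z e → h (1F ∷ z) (cong suc e)))
  (solve 0 (con 0ℚ :+ con 0ℚ :+ con 0ℚ := con 0ℚ) R.refl)
  where open ℂS
R-support {suc D} v (0F ∷ y) h = R.trans
  (R.+-cong (R.+-cong (R.zeroˡ _) (R.zeroˡ _)) (R-support (v ∘ (0F ∷_)) y λ z → h (0F ∷ z)))
  (solve 0 (con 0ℚ :+ con 0ℚ :+ con 0ℚ := con 0ℚ) R.refl)
  where open ℂS

weight-≤ : ∀ {D} (y : X D) → weight y ≤ D
weight-≤ []       = ℕ.z≤n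
weight-≤ (0F ∷ y) = ℕ.m≤n⇒m≤1+n (weight-≤ y)
weight-≤ (1F ∷ y) = ℕ.s≤s (weight-≤ y)

[A*,R] : ∀ {D} (v : V D) → δ σA* (δ σR v) ≈ᵥ δ σR (δ σA* v) +ᵥ ι (ℚ.- two) •ᵥ δ σR v
[A*,R] = δ-commute σA* σR (ι (ℚ.- two)) σR λ where
  0F 0F → ≈-pointwise (λ _ → refl) (λ _ → refl)
  0F 1F → ≈-pointwise (λ _ → refl) (λ _ → refl)
  1F 0F → ≈-pointwise (λ _ → refl) (λ _ → refl)
  1F 1F → ≈-pointwise (λ _ → refl) (λ _ → refl)

≈ᵥ-sym : ∀ {D} {v w : V D} → v ≈ᵥ w → w ≈ᵥ v
≈ᵥ-sym p y = R.sym (p y)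

≈ᵥ-trans : ∀ {D} {u v w : V D} → u ≈ᵥ v → v ≈ᵥ w → u ≈ᵥ w
≈ᵥ-trans p q y = R.trans (p y) (q y)

-- The Casimir operator

-- Moving `f` through `g²` and through `h²` produces `k (g h + h g)` with opposite signs.
commute-square : ∀ {D} {f g h : V D → V D} {k} → IsLinear f → IsLinear g → IsLinear h →
  (∀ v → f (g v) ≈ᵥ g (f v) +ᵥ k •ᵥ h v) → (∀ v → h (f v) ≈ᵥ f (h v) +ᵥ k •ᵥ g v) →
  ∀ v → g (g (f v)) +ᵥ h (h (f v)) ≈ᵥ f (g (g v) +ᵥ h (h v))
commute-square {f = f} {g} {h} {k} F-lin G-lin H-lin fg hf v y = begin
  g (g (f v)) y + h (h (f v)) y
    ≈⟨ R.+-congˡ (R.trans (H-lin .▹-cong (hf v) y) (R.trans (H-lin .▹-+ (f (h v)) (k •ᵥ g v) y) (R.+-cong (hf (h v) y) (H-lin .▹-• k (g v) y)))) ⟩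
  g (g (f v)) y + (f (h (h v)) y + k * g (h v) y + k * h (g v) y)
    ≈⟨ solve 5 (λ k a b c d → a :+ (b :+ k :* c :+ k :* d) := (a :+ k :* c :+ k :* d) :+ b) R.refl k (g (g (f v)) y) (f (h (h v)) y) (g (h v) y) (h (g v) y) ⟩
  g (g (f v)) y + k * g (h v) y + k * h (g v) y + f (h (h v)) y
    ≈⟨ R.+-congʳ (R.trans (fg (g v) y) (R.+-congʳ (R.trans (G-lin .▹-cong (fg v) y) (R.trans (G-lin .▹-+ (g (f v)) (k •ᵥ h v) y) (R.+-congˡ (G-lin .▹-• k (h v) y)))))) ⟨
  f (g (g v)) y + f (h (h v)) y
    ≈⟨ F-lin .▹-+ (g (g v)) (h (h v)) y ⟨
  f (g (g v) +ᵥ h (h v)) y ∎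
  where
  open ≈-Reasoning
  open ℂS

-- The shape that evaluates Ω on vectors killed by the lowering operator; Ω-LR is the
-- one for vectors killed by the raising operator.
Ω : ∀ {D} → V D → V D
Ω v = δ σA* (δ σA* v) +ᵥ (nat 2 •ᵥ δ σA* v +ᵥ nat 4 •ᵥ δ σR (δ σL v))

Ω-LR : ∀ {D} (v : V D) → Ω v ≈ᵥ δ σA* (δ σA* v) +ᵥ (ι (ℚ.- two) •ᵥ δ σA* v +ᵥ nat 4 •ᵥ δ σL (δ σR v))
Ω-LR v y = R.sym (R.trans (R.+-congˡ (R.+-congˡ (R.*-congˡ ([L,R] v y))))
  (solve 3 (λ a b c → a :+ (con (ℚ.- two) :* b :+ con (ℕ→ℚ 4) :* (c :+ con 1ℚ :* b)) := a :+ (con two :* b :+ con (ℕ→ℚ 4) :* c))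
    R.refl (δ σA* (δ σA* v) y) (δ σA* v y) (δ σR (δ σL v) y)))
  where open ℂS

𝐢*𝐢 : 𝐢 * 𝐢 ≈ ι (ℚ.- 1ℚ)
𝐢*𝐢 = ≈-pointwise (λ _ → refl) (λ _ → refl)

-- `4RL = (A + 𝐢Aᵋ)(A - 𝐢Aᵋ) = A² + (Aᵋ)² - 2A*`, where the last term is the commutator from the
-- cross terms and cancels the `2A*` in `Ω`. This form is symmetric in the three operators, as the
-- commutation lemmas require.
Ω-squares : ∀ {D} (v : V D) → Ω v ≈ᵥ δ σA* (δ σA* v) +ᵥ (δ σAᵋ (δ σAᵋ v) +ᵥ δ σA (δ σA v))
Ω-squares v y = R.+-congˡ (begin
  nat 2 * h + nat 4 * δ σR (δ σL v) y
    ≈⟨ R.+-congˡ (R.*-congˡ (R.trans (R-split (δ σL v) y) (R.+-cong (R.*-congˡ a[L]) (R.*-congˡ c[L])))) ⟩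
  nat 2 * h + nat 4 * (ι ½ * (ι ½ * aa + ι ½ * - 𝐢 * ac) + ι ½ * 𝐢 * (ι ½ * (ac + ι two * 𝐢 * h) + ι ½ * - 𝐢 * cc))
    -- The solver treats `𝐢` as a variable, so its square is collected here and evaluated in the
    -- next step.
    ≈⟨ solve 5 (λ i h aa ac cc → let ½′ = con ½; 2′ = con two in
         2′ :* h :+ con (ℕ→ℚ 4) :* (½′ :* (½′ :* aa :+ ½′ :* :- i :* ac) :+ ½′ :* i :* (½′ :* (ac :+ 2′ :* i :* h) :+ ½′ :* :- i :* cc))
         := 2′ :* h :+ aa :+ (i :* i) :* (2′ :* h :- cc)) R.refl 𝐢 h aa ac cc ⟩
  nat 2 * h + aa + (𝐢 * 𝐢) * (nat 2 * h - cc)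
    ≈⟨ R.+-congˡ (R.*-congʳ 𝐢*𝐢) ⟩
  nat 2 * h + aa + ι (ℚ.- 1ℚ) * (nat 2 * h - cc)
    ≈⟨ solve 3 (λ h aa cc → con two :* h :+ aa :+ con (ℚ.- 1ℚ) :* (con two :* h :- cc) := cc :+ aa) R.refl h aa cc ⟩
  cc + aa ∎)
  where
  open ≈-Reasoning
  open ℂS
  h  = δ σA* v y
  aa = δ σA (δ σA v) y
  ac = δ σA (δ σAᵋ v) y
  cc = δ σAᵋ (δ σAᵋ v) y
  a[L] : δ σA (δ σL v) y ≈ ι ½ * aa + ι ½ * - 𝐢 * ac
  a[L] = R.trans (δ.▹-cong σA (L-split v) y) (δ.▹-combo σA (ι ½) (δ σA v) (ι ½ * - 𝐢) (δ σAᵋ v) y)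
  c[L] : δ σAᵋ (δ σL v) y ≈ ι ½ * (ac + ι two * 𝐢 * h) + ι ½ * - 𝐢 * cc
  c[L] = R.trans (δ.▹-cong σAᵋ (L-split v) y) (R.trans (δ.▹-combo σAᵋ (ι ½) (δ σA v) (ι ½ * - 𝐢) (δ σAᵋ v) y)
    (R.+-congʳ (R.*-congˡ ([Aᵋ,A] v y))))

Ω-linear : ∀ {D} → IsLinear (Ω {D})
Ω-linear .▹-cong p y = R.+-cong (δ.▹-cong σA* (δ.▹-cong σA* p) y)
  (R.+-cong (R.*-congˡ (δ.▹-cong σA* p y)) (R.*-congˡ (δ.▹-cong σR (δ.▹-cong σL p) y)))
Ω-linear .▹-+ v w y = R.trans
  (R.+-cong (twice σA* σA*) (R.+-cong (R.*-congˡ (δ.▹-+ σA* v w y)) (R.*-congˡ (twice σR σL))))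
  (solve 8 (λ a a′ b b′ c c′ k l → (a :+ a′) :+ (k :* (b :+ b′) :+ l :* (c :+ c′)) := (a :+ (k :* b :+ l :* c)) :+ (a′ :+ (k :* b′ :+ l :* c′))) R.refl
    _ _ _ _ _ _ (nat 2) (nat 4))
  where
  open ℂS
  twice : ∀ M N → δ M (δ N (v +ᵥ w)) y ≈ δ M (δ N v) y + δ M (δ N w) y
  twice M N = R.trans (δ.▹-cong M (δ.▹-+ N v w) y) (δ.▹-+ M (δ N v) (δ N w) y)
Ω-linear .▹-• k v y = R.trans
  (R.+-cong (twice σA* σA*) (R.+-cong (R.*-congˡ (δ.▹-• σA* k v y)) (R.*-congˡ (twice σR σL))))
  (solve 6 (λ a b c k l m → k :* a :+ (l :* (k :* b) :+ m :* (k :* c)) := k :* (a :+ (l :* b :+ m :* c))) R.refl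
    _ _ _ k (nat 2) (nat 4))
  where
  open ℂS
  twice : ∀ M N → δ M (δ N (k •ᵥ v)) y ≈ k * δ M (δ N v) y
  twice M N = R.trans (δ.▹-cong M (δ.▹-• N k v) y) (δ.▹-• M k (δ N v) y)

module Ω {D} = IsLinear (Ω-linear {D})

-- `A` commutes with its own square, and with the sum of the other two squares by `commute-square`.
-- `Ω-A*` and `Ω-Aᵋ` rotate the roles.
Ω-A : ∀ {D} (v : V D) → Ω (δ σA v) ≈ᵥ δ σA (Ω v)
Ω-A v y = begin
  Ω (δ σA v) y
    ≈⟨ Ω-squares (δ σA v) y ⟩
  δ σA* (δ σA* (δ σA v)) y + (δ σAᵋ (δ σAᵋ (δ σA v)) y + δ σA (δ σA (δ σA v)) y)
    ≈⟨ R.+-assoc _ _ _ ⟨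
  δ σA* (δ σA* (δ σA v)) y + δ σAᵋ (δ σAᵋ (δ σA v)) y + δ σA (δ σA (δ σA v)) y
    ≈⟨ R.+-congʳ (commute-square (δ-linear σA) (δ-linear σA*) (δ-linear σAᵋ) [A,A*] [Aᵋ,A] v y) ⟩
  δ σA (δ σA* (δ σA* v) +ᵥ δ σAᵋ (δ σAᵋ v)) y + δ σA (δ σA (δ σA v)) y
    ≈⟨ δ.▹-+ σA (δ σA* (δ σA* v) +ᵥ δ σAᵋ (δ σAᵋ v)) (δ σA (δ σA v)) y ⟨
  δ σA ((δ σA* (δ σA* v) +ᵥ δ σAᵋ (δ σAᵋ v)) +ᵥ δ σA (δ σA v)) y
    ≈⟨ δ.▹-cong σA (λ z → R.trans (R.+-assoc _ _ _) (R.sym (Ω-squares v z))) y ⟩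
  δ σA (Ω v) y ∎
  where open ≈-Reasoning

Ω-A* : ∀ {D} (v : V D) → Ω (δ σA* v) ≈ᵥ δ σA* (Ω v)
Ω-A* v y = begin
  Ω (δ σA* v) y
    ≈⟨ Ω-squares (δ σA* v) y ⟩
  δ σA* (δ σA* (δ σA* v)) y + (δ σAᵋ (δ σAᵋ (δ σA* v)) y + δ σA (δ σA (δ σA* v)) y)
    ≈⟨ R.+-congˡ (commute-square (δ-linear σA*) (δ-linear σAᵋ) (δ-linear σA) [A*,Aᵋ] [A,A*] v y) ⟩
  δ σA* (δ σA* (δ σA* v)) y + δ σA* (δ σAᵋ (δ σAᵋ v) +ᵥ δ σA (δ σA v)) y
    ≈⟨ δ.▹-+ σA* (δ σA* (δ σA* v)) (δ σAᵋ (δ σAᵋ v) +ᵥ δ σA (δ σA v)) y ⟨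
  δ σA* (δ σA* (δ σA* v) +ᵥ (δ σAᵋ (δ σAᵋ v) +ᵥ δ σA (δ σA v))) y
    ≈⟨ δ.▹-cong σA* (≈ᵥ-sym (Ω-squares v)) y ⟩
  δ σA* (Ω v) y ∎
  where open ≈-Reasoning

-- A map that permutes A, A*, Aᵋ cyclically preserves the sum of their squares.
Ω-cyclic : ∀ {D} {f : V D → V D} → IsLinear f → ∀ α β γ → (∀ v → Ω v ≈ᵥ δ α (δ α v) +ᵥ (δ β (δ β v) +ᵥ δ γ (δ γ v))) →
  (∀ v → δ σA* (f v) ≈ᵥ f (δ α v)) → (∀ v → δ σAᵋ (f v) ≈ᵥ f (δ β v)) → (∀ v → δ σA (f v) ≈ᵥ f (δ γ v)) →
  ∀ v → Ω (f v) ≈ᵥ f (Ω v)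
Ω-cyclic {f = f} f-lin α β γ sq p q s v y = begin
  Ω (f v) y
    ≈⟨ Ω-squares (f v) y ⟩
  δ σA* (δ σA* (f v)) y + (δ σAᵋ (δ σAᵋ (f v)) y + δ σA (δ σA (f v)) y)
    ≈⟨ R.+-cong (twice σA* α p) (R.+-cong (twice σAᵋ β q) (twice σA γ s)) ⟩
  f (δ α (δ α v)) y + (f (δ β (δ β v)) y + f (δ γ (δ γ v)) y)
    ≈⟨ R.+-congˡ (f-lin .▹-+ (δ β (δ β v)) (δ γ (δ γ v)) y) ⟨
  f (δ α (δ α v)) y + f (δ β (δ β v) +ᵥ δ γ (δ γ v)) y
    ≈⟨ f-lin .▹-+ (δ α (δ α v)) (δ β (δ β v) +ᵥ δ γ (δ γ v)) y ⟨
  f (δ α (δ α v) +ᵥ (δ β (δ β v) +ᵥ δ γ (δ γ v))) y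
    ≈⟨ f-lin .▹-cong (≈ᵥ-sym (sq v)) y ⟩
  f (Ω v) y ∎
  where
  open ≈-Reasoning
  twice : ∀ M N → (∀ v → δ M (f v) ≈ᵥ f (δ N v)) → δ M (δ M (f v)) y ≈ f (δ N (δ N v)) y
  twice M N r = R.trans (δ.▹-cong M (r v) y) (r (δ N v) y)

Ω-P : ∀ {D} (v : V D) → Ω (κ P₁ v) ≈ᵥ κ P₁ (Ω v)
Ω-P = Ω-cyclic (κ-linear P₁) σA σA* σAᵋ
  (λ v y → R.trans (Ω-squares v y) (solve 3 (λ a b c → a :+ (b :+ c) := c :+ (a :+ b)) R.refl _ _ _))
  A*P≈PA AᵋP≈PA* AP≈PAᵋ
  where open ℂS

Ω-P⁻¹ : ∀ {D} (v : V D) → Ω (κ P₁⁻¹ v) ≈ᵥ κ P₁⁻¹ (Ω v)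
Ω-P⁻¹ = Ω-cyclic (κ-linear P₁⁻¹) σAᵋ σA σA*
  (λ v y → R.trans (Ω-squares v y) (solve 3 (λ a b c → a :+ (b :+ c) := b :+ (c :+ a)) R.refl _ _ _))
  A*P⁻¹≈P⁻¹Aᵋ AᵋP⁻¹≈P⁻¹A AP⁻¹≈P⁻¹A*
  where open ℂS

Ω-T : ∀ {D} {B : Mat D} → T B → ∀ v → Ω (B ▹ v) ≈ᵥ B ▹ Ω v
Ω-T A∈T v y = R.trans (Ω.▹-cong (A-▹ v) y) (R.trans (Ω-A v y) (R.sym (A-▹ (Ω v) y)))
Ω-T A*∈T v y = R.trans (Ω.▹-cong (A*-▹-δ v) y) (R.trans (Ω-A* v y) (R.sym (A*-▹-δ (Ω v) y)))
Ω-T I∈T v y = R.trans (Ω.▹-cong (I-▹ v) y) (R.sym (I-▹ (Ω v) y))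
Ω-T (+-clos {M} {N} p q) v y = R.trans (Ω.▹-cong (+ₘ-▹ M N v) y)
  (R.trans (Ω.▹-+ (M ▹ v) (N ▹ v) y) (R.trans (R.+-cong (Ω-T p v y) (Ω-T q v y)) (R.sym (+ₘ-▹ M N (Ω v) y))))
  where
  +ₘ-▹ : ∀ {D} (M N : Mat D) v → (M +ₘ N) ▹ v ≈ᵥ M ▹ v +ᵥ N ▹ v
  +ₘ-▹ {D} M N v y = R.trans (∑ₓ-cong {D} λ z → R.distribʳ (v z) (M y z) (N y z)) (∑ₓ-+ {D} _ _)
Ω-T (•-clos c {M} p) v y = R.trans (Ω.▹-cong (•ₘ-▹ c M v) y)
  (R.trans (Ω.▹-• c (M ▹ v) y) (R.trans (R.*-congˡ (Ω-T p v y)) (R.sym (•ₘ-▹ c M (Ω v) y))))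
  where
  •ₘ-▹ : ∀ {D} c (M : Mat D) v → (c •ₘ M) ▹ v ≈ᵥ c •ᵥ M ▹ v
  •ₘ-▹ {D} c M v y = R.trans (∑ₓ-cong {D} λ z → R.*-assoc c (M y z) (v z)) (∑ₓ-*ˡ {D} c _)
Ω-T (·-clos {M} {N} p q) v y = R.trans (Ω.▹-cong (·-▹ M N v) y)
  (R.trans (Ω-T p (N ▹ v) y) (R.trans (▹-linear M .▹-cong (Ω-T q v) y) (R.sym (·-▹ M N (Ω v) y))))
Ω-T (≈-clos {M} {N} e p) v y = R.trans (Ω.▹-cong (≈ᵥ-sym (≈ₘ-▹ e v)) y) (R.trans (Ω-T p v y) (≈ₘ-▹ e (Ω v) y))

-- Supports, divided powers and eigenvalues of the Casimir operator.

Supp : ∀ {D} → (ℕ → Set) → V D → Set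
Supp S v = ∀ y → ¬ S (weight y) → v y ≈ 0#

Supp-eigen : ∀ {D} S {μ} {v : V D} → Supp S v → (∀ n → S n → θ D n ≡ μ) → δ σA* v ≈ᵥ ι μ •ᵥ v
-- `S` may be undecidable. If the equation failed at `y`, then `S` would fail there too, and both
-- sides would vanish.
Supp-eigen {D} S {μ} {v} supp h y = ≈-stable λ k → k (R.trans (σA*-weight v y)
  (R.trans (R.*-congˡ (supp y λ s → k (R.trans (σA*-weight v y) (R.*-congʳ (ι-cong (h (weight y) s))))))
  (R.trans (R.zeroʳ _) (R.sym (R.trans (R.*-congˡ (supp y λ s → k (R.trans (σA*-weight v y) (R.*-congʳ (ι-cong (h (weight y) s)))))) (R.zeroʳ _))))))

Supp-L : ∀ {D} S {v : V D} → Supp S v → Supp (S ∘ suc) (δ σL v)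
Supp-L S {v} supp y ¬s = L-support v y λ z e → supp z (¬s ∘ subst S e)

Supp-R : ∀ {D} S S′ {v : V D} → (∀ n → S n → S′ (suc n)) → Supp S v → Supp S′ (δ σR v)
Supp-R S S′ {v} h supp y ¬s = R-support v y λ z e → supp z λ s → ¬s (subst S′ e (h (weight z) s))

Supp-• : ∀ {D} (S : ℕ → Set) c {v : V D} → Supp S v → Supp S (c •ᵥ v)
Supp-• S c supp y ¬s = R.trans (R.*-congˡ (supp y ¬s)) (R.zeroʳ c)

Supp-∅ : ∀ {D} S {v : V D} → Supp S v → (∀ n → n ≤ D → ¬ S n) → v ≈ᵥ 0ᵥ
Supp-∅ S supp h y = supp y (h (weight y) (weight-≤ y))

-- The divided powers `fᵏ v / k!`, for which the ladder relations have coefficients linear in `k`.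
divided : ∀ {D} → (V D → V D) → V D → ℕ → V D
divided f v zero    = v
divided f v (suc k) = ι (inv (ℕ→ℚ (suc k))) •ᵥ f (divided f v k)

nat*inv : ∀ k → nat (suc k) * ι (inv (ℕ→ℚ (suc k))) ≈ 1#
nat*inv k = R.trans (R.sym (ι-* (ℕ→ℚ (suc k)) (inv (ℕ→ℚ (suc k))))) (ι-cong (*-inv (ℕ→ℚ (suc k)) (ℚ.≢-nonZero (ℕ→ℚ-suc≢0 k))))

divided-step : ∀ {D} (f : V D → V D) v k → f (divided f v k) ≈ᵥ nat (suc k) •ᵥ divided f v (suc k)
divided-step f v k y = R.sym (R.trans (R.sym (R.*-assoc _ _ _)) (R.trans (R.*-congʳ (nat*inv k)) (R.*-identityˡ _)))

divided-closed : ∀ {D} {f : V D → V D} (S : ℕ → Pred (V D) 0ℓ) → (∀ k c {v} → v ∈ S k → c •ᵥ f v ∈ S (suc k)) →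
                 ∀ {v} → v ∈ S 0 → ∀ k → divided f v k ∈ S k
divided-closed S h s zero    = s
divided-closed S h s (suc k) = h k _ (divided-closed S h s k)

-- Equality with `0ᵥ` is not decidable, hence the double negation. If no such `k` existed,
-- nonvanishing would spread by induction from `0` up to `N`.
first-zero : ∀ {D} (x : ℕ → V D) N → x N ≈ᵥ 0ᵥ → ¬ (x 0 ≈ᵥ 0ᵥ) →
             ¬ ¬ (∃ λ k → ¬ (x k ≈ᵥ 0ᵥ) × x (suc k) ≈ᵥ 0ᵥ)
first-zero x N x[N]≈0 x[0]≉0 ¬∃ = x≉0 N x[N]≈0
  where
  x≉0 : ∀ k → ¬ (x k ≈ᵥ 0ᵥ)
  x≉0 zero    = x[0]≉0
  x≉0 (suc k) = λ p → ¬∃ (k , x≉0 k , p)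

Ω-Aᵋ : ∀ {D} (v : V D) → Ω (δ σAᵋ v) ≈ᵥ δ σAᵋ (Ω v)
Ω-Aᵋ v y = begin
  Ω (δ σAᵋ v) y
    ≈⟨ Ω-squares (δ σAᵋ v) y ⟩
  δ σA* (δ σA* (δ σAᵋ v)) y + (δ σAᵋ (δ σAᵋ (δ σAᵋ v)) y + δ σA (δ σA (δ σAᵋ v)) y)
    ≈⟨ rotate _ _ _ ⟩
  δ σA (δ σA (δ σAᵋ v)) y + δ σA* (δ σA* (δ σAᵋ v)) y + δ σAᵋ (δ σAᵋ (δ σAᵋ v)) y
    ≈⟨ R.+-congʳ (commute-square (δ-linear σAᵋ) (δ-linear σA) (δ-linear σA*) [Aᵋ,A] [A*,Aᵋ] v y) ⟩
  δ σAᵋ (δ σA (δ σA v) +ᵥ δ σA* (δ σA* v)) y + δ σAᵋ (δ σAᵋ (δ σAᵋ v)) y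
    ≈⟨ δ.▹-+ σAᵋ (δ σA (δ σA v) +ᵥ δ σA* (δ σA* v)) (δ σAᵋ (δ σAᵋ v)) y ⟨
  δ σAᵋ ((δ σA (δ σA v) +ᵥ δ σA* (δ σA* v)) +ᵥ δ σAᵋ (δ σAᵋ v)) y
    ≈⟨ δ.▹-cong σAᵋ (λ z → R.trans (R.sym (rotate _ _ _)) (R.sym (Ω-squares v z))) y ⟩
  δ σAᵋ (Ω v) y ∎
  where
  open ≈-Reasoning
  open ℂS
  rotate : ∀ a b c → a + (b + c) ≈ c + a + b
  rotate = solve 3 (λ a b c → a :+ (b :+ c) := c :+ a :+ b) R.refl

Ω-combo : ∀ {D} M a b → (∀ (v : V D) → δ M v ≈ᵥ a •ᵥ δ σA v +ᵥ b •ᵥ δ σAᵋ v) →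
          ∀ (v : V D) → Ω (δ M v) ≈ᵥ δ M (Ω v)
Ω-combo M a b split v y = begin
  Ω (δ M v) y                                   ≈⟨ Ω.▹-cong (split v) y ⟩
  Ω (a •ᵥ δ σA v +ᵥ b •ᵥ δ σAᵋ v) y             ≈⟨ Ω.▹-combo a (δ σA v) b (δ σAᵋ v) y ⟩
  a * Ω (δ σA v) y + b * Ω (δ σAᵋ v) y          ≈⟨ R.+-cong (R.*-congˡ (Ω-A v y)) (R.*-congˡ (Ω-Aᵋ v y)) ⟩
  a * δ σA (Ω v) y + b * δ σAᵋ (Ω v) y          ≈⟨ split (Ω v) y ⟨
  δ M (Ω v) y                                   ∎
  where open ≈-Reasoning

Ω-L : ∀ {D} (v : V D) → Ω (δ σL v) ≈ᵥ δ σL (Ω v)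
Ω-L = Ω-combo σL (ι ½) (ι ½ * - 𝐢) L-split

Ω-R : ∀ {D} (v : V D) → Ω (δ σR v) ≈ᵥ δ σR (Ω v)
Ω-R = Ω-combo σR (ι ½) (ι ½ * 𝐢) R-split

eigen-map : ∀ {D} {f g : V D → V D} {c v} → IsLinear f → IsLinear g → (∀ v → f (g v) ≈ᵥ g (f v)) →
            f v ≈ᵥ c •ᵥ v → ∀ k → f (k •ᵥ g v) ≈ᵥ c •ᵥ (k •ᵥ g v)
eigen-map {g = g} {c} {v} f-lin g-lin comm e k y = R.trans (f-lin .▹-• k (g v) y)
  (R.trans (R.*-congˡ (R.trans (comm v y) (R.trans (g-lin .▹-cong e y) (g-lin .▹-• c v y))))
  (solve 3 (λ k c g → k :* (c :* g) := c :* (k :* g)) R.refl k c (g v y)))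
  where open ℂS

Ω-highest : ∀ {D μ} {v : V D} → δ σA* v ≈ᵥ ι μ •ᵥ v → δ σL v ≈ᵥ 0ᵥ → Ω v ≈ᵥ ι (μ ℚ.* (μ ℚ.+ two)) •ᵥ v
Ω-highest {μ = μ} {v} e l y = begin
  δ σA* (δ σA* v) y + (nat 2 * δ σA* v y + nat 4 * δ σR (δ σL v) y)
    ≈⟨ R.+-cong (R.trans (δ.▹-cong σA* e y) (R.trans (δ.▹-• σA* (ι μ) v y) (R.*-congˡ (e y)))) (R.+-cong (R.*-congˡ (e y)) (R.*-congˡ (δ.▹-kills σR l y))) ⟩
  ι μ * (ι μ * v y) + (nat 2 * (ι μ * v y) + nat 4 * 0#)
    ≈⟨ solve 2 (λ m v → m :* (m :* v) :+ (con two :* (m :* v) :+ con (ℕ→ℚ 4) :* con 0ℚ) := m :* (m :+ con two) :* v) R.refl (ι μ) (v y) ⟩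
  ι μ * (ι μ + ι two) * v y
    ≈⟨ R.*-congʳ (R.trans (ι-* μ (μ ℚ.+ two)) (R.*-congˡ (ι-+ μ two))) ⟨
  ι (μ ℚ.* (μ ℚ.+ two)) * v y ∎
  where
  open ≈-Reasoning
  open ℂS

Ω-lowest : ∀ {D μ} {v : V D} → δ σA* v ≈ᵥ ι μ •ᵥ v → δ σR v ≈ᵥ 0ᵥ → Ω v ≈ᵥ ι (μ ℚ.* (μ ℚ.- two)) •ᵥ v
Ω-lowest {μ = μ} {v} e l y = begin
  Ω v y
    ≈⟨ Ω-LR v y ⟩
  δ σA* (δ σA* v) y + (ι (ℚ.- two) * δ σA* v y + nat 4 * δ σL (δ σR v) y)
    ≈⟨ R.+-cong (R.trans (δ.▹-cong σA* e y) (R.trans (δ.▹-• σA* (ι μ) v y) (R.*-congˡ (e y)))) (R.+-cong (R.*-congˡ (e y)) (R.*-congˡ (δ.▹-kills σL l y))) ⟩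
  ι μ * (ι μ * v y) + (ι (ℚ.- two) * (ι μ * v y) + nat 4 * 0#)
    ≈⟨ solve 2 (λ m v → m :* (m :* v) :+ (con (ℚ.- two) :* (m :* v) :+ con (ℕ→ℚ 4) :* con 0ℚ) := m :* (m :+ con (ℚ.- two)) :* v) R.refl (ι μ) (v y) ⟩
  ι μ * (ι μ + ι (ℚ.- two)) * v y
    ≈⟨ R.*-congʳ (R.trans (ι-* μ (μ ℚ.- two)) (R.*-congˡ (ι-+ μ (ℚ.- two)))) ⟨
  ι (μ ℚ.* (μ ℚ.- two)) * v y ∎
  where
  open ≈-Reasoning
  open ℂS

distinct-eigenvalues : ∀ {D} {f : V D → V D} {p q v} → f v ≈ᵥ ι p •ᵥ v → f v ≈ᵥ ι q •ᵥ v → p ℚ.- q ≢ 0ℚ → v ≈ᵥ 0ᵥ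
distinct-eigenvalues {f = f} {p} {q} {v} e e′ p-q≢0 y = ι-cancel p-q≢0 (begin
  ι (p ℚ.- q) * v y         ≈⟨ R.*-congʳ (R.trans (ι-+ p (ℚ.- q)) (R.+-congˡ (ι-neg q))) ⟩
  (ι p - ι q) * v y         ≈⟨ solve 3 (λ p q v → (p :- q) :* v := p :* v :- q :* v) R.refl (ι p) (ι q) (v y) ⟩
  ι p * v y - ι q * v y     ≈⟨ R.+-cong (e y) (R.-‿cong (e′ y)) ⟨
  f v y - f v y             ≈⟨ R.-‿inverseʳ (f v y) ⟩
  0#                        ∎)
  where
  open ≈-Reasoning
  open ℂS

-- Ladders

raise : ∀ {D} → V D → ℕ → V D
raise = divided (δ σR)

raise-0 : ∀ {D} {v : V D} k → v ≈ᵥ 0ᵥ → raise v k ≈ᵥ 0ᵥ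
raise-0 zero    p = p
raise-0 (suc k) p y = R.trans (R.*-congˡ (δ.▹-kills σR (raise-0 k p) y)) (R.zeroʳ _)

Supp-raise : ∀ {D s} {v : V D} → Supp (_≡ s) v → ∀ k → Supp (_≡ s ℕ.+ k) (raise v k)
Supp-raise {s = s} {v} supp = divided-closed (λ k → Supp (_≡ s ℕ.+ k))
  (λ k c {v} sv → Supp-• (_≡ s ℕ.+ suc k) c (Supp-R (_≡ s ℕ.+ k) (_≡ s ℕ.+ suc k) (λ n e → trans (cong suc e) (sym (ℕ.+-suc s k))) sv))
  (subst (λ t → Supp (_≡ t) v) (sym (ℕ.+-identityʳ s)) supp)

module Highest {D} {x : V D} {μ} (e : δ σA* x ≈ᵥ ι μ •ᵥ x) (l : δ σL x ≈ᵥ 0ᵥ) where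
  H-raise : ∀ k → δ σA* (raise x k) ≈ᵥ (ι μ - nat 2 * nat k) •ᵥ raise x k
  H-raise zero y = R.trans (e y) (solve 2 (λ m v → m :* v := (m :- con two :* con 0ℚ) :* v) R.refl (ι μ) (x y))
    where open ℂS
  H-raise (suc k) y = begin
    δ σA* (c •ᵥ δ σR (raise x k)) y
      ≈⟨ δ.▹-• σA* c (δ σR (raise x k)) y ⟩
    c * δ σA* (δ σR (raise x k)) y
      ≈⟨ R.*-congˡ (R.trans ([A*,R] (raise x k) y) (R.+-congʳ (R.trans (δ.▹-cong σR (H-raise k) y) (δ.▹-• σR _ (raise x k) y)))) ⟩
    c * ((ι μ - nat 2 * nat k) * w + ι (ℚ.- two) * w)
      ≈⟨ solve 4 (λ c m k w → c :* ((m :- con two :* k) :* w :+ con (ℚ.- two) :* w) := (m :- con two :* (con 1ℚ :+ k)) :* (c :* w)) R.refl c (ι μ) (nat k) w ⟩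
    (ι μ - nat 2 * (1# + nat k)) * (c * w)
      ≈⟨ R.*-congʳ (R.+-congˡ (R.-‿cong (R.*-congˡ (nat-suc k)))) ⟨
    (ι μ - nat 2 * nat (suc k)) * (c * w) ∎
    where
    open ≈-Reasoning
    open ℂS
    c = ι (inv (ℕ→ℚ (suc k)))
    w = δ σR (raise x k) y

  -- Commuting `L` past the last `R` adds the weight `μ - 2(k + 1)`, and `(k + 1)(μ - k) + μ - 2(k +
  -- 1) = (k + 2)(μ - k - 1)`. The unnormalised `LR` at `suc k` calls this lemma at `k`.
  L-raise : ∀ k → δ σL (raise x (suc k)) ≈ᵥ (ι μ - nat k) •ᵥ raise x k
  L-raise k y = begin
    δ σL (c •ᵥ δ σR (raise x k)) y                        ≈⟨ δ.▹-• σL c (δ σR (raise x k)) y ⟩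
    c * δ σL (δ σR (raise x k)) y                         ≈⟨ R.*-congˡ (LR k) ⟩
    c * (nat (suc k) * ((ι μ - nat k) * raise x k y))     ≈⟨ solve 3 (λ c n w → c :* (n :* w) := (n :* c) :* w) R.refl c (nat (suc k)) _ ⟩
    (nat (suc k) * c) * ((ι μ - nat k) * raise x k y)     ≈⟨ R.trans (R.*-congʳ (nat*inv k)) (R.*-identityˡ _) ⟩
    (ι μ - nat k) * raise x k y                           ∎
    where
    open ≈-Reasoning
    open ℂS
    c = ι (inv (ℕ→ℚ (suc k)))
    LR : ∀ k → δ σL (δ σR (raise x k)) y ≈ nat (suc k) * ((ι μ - nat k) * raise x k y)
    LR zero = R.trans ([L,R] x y) (R.trans (R.+-cong (δ.▹-kills σR l y) (R.*-congˡ (e y)))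
      (solve 2 (λ m v → con 0ℚ :+ con 1ℚ :* (m :* v) := con 1ℚ :* ((m :- con 0ℚ) :* v)) R.refl (ι μ) (x y)))
    LR (suc k) = begin
      δ σL (δ σR (raise x (suc k))) y
        ≈⟨ [L,R] (raise x (suc k)) y ⟩
      δ σR (δ σL (raise x (suc k))) y + 1# * δ σA* (raise x (suc k)) y
        ≈⟨ R.+-cong (R.trans (δ.▹-cong σR (L-raise k) y) (R.trans (δ.▹-• σR _ (raise x k) y) (R.*-congˡ (divided-step (δ σR) x k y)))) (R.*-congˡ (H-raise (suc k) y)) ⟩
      (ι μ - nat k) * (nat (suc k) * w) + 1# * ((ι μ - nat 2 * nat (suc k)) * w)
        ≈⟨ R.+-cong (R.*-congˡ (R.*-congʳ s)) (R.*-congˡ (R.*-congʳ (R.+-congˡ (R.-‿cong (R.*-congˡ s))))) ⟩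
      (ι μ - nat k) * ((1# + nat k) * w) + 1# * ((ι μ - nat 2 * (1# + nat k)) * w)
        ≈⟨ solve 3 (λ m k w → (m :- k) :* ((con 1ℚ :+ k) :* w) :+ con 1ℚ :* ((m :- con two :* (con 1ℚ :+ k)) :* w) := (con 1ℚ :+ (con 1ℚ :+ k)) :* ((m :- (con 1ℚ :+ k)) :* w)) R.refl (ι μ) (nat k) w ⟩
      (1# + (1# + nat k)) * ((ι μ - (1# + nat k)) * w)
        ≈⟨ R.*-cong (R.trans (nat-suc (suc k)) (R.+-congˡ s)) (R.*-congʳ (R.+-congˡ (R.-‿cong s))) ⟨
      nat (suc (suc k)) * ((ι μ - nat (suc k)) * w) ∎
      where
      w = raise x (suc k) y
      s = nat-suc k

θ≡ℕ : ∀ D r k → θ D r ≡ ℕ→ℚ k → D ≡ 2 ℕ.* r ℕ.+ k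
θ≡ℕ D r k p = ℤ.+-injective (begin
  + D                                              ≡⟨ ℤ.+-identityʳ (+ D) ⟨
  + D ℤ.+ + 0                                      ≡⟨ cong (λ t → + D ℤ.+ t) (ℤ.+-inverseˡ (+ (2 ℕ.* r))) ⟨
  + D ℤ.+ (ℤ.- + (2 ℕ.* r) ℤ.+ + (2 ℕ.* r))        ≡⟨ ℤ.+-assoc (+ D) (ℤ.- + (2 ℕ.* r)) (+ (2 ℕ.* r)) ⟨
  (+ D ℤ.- + (2 ℕ.* r)) ℤ.+ + (2 ℕ.* r)            ≡⟨ cong (ℤ._+ + (2 ℕ.* r)) (ℤ→ℚ-injective {+ D ℤ.- + (2 ℕ.* r)} {+ k} p) ⟩
  + (k ℕ.+ 2 ℕ.* r)                                ≡⟨ cong +_ (ℕ.+-comm k (2 ℕ.* r)) ⟩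
  + (2 ℕ.* r ℕ.+ k)                                ∎)
  where open ≡-Reasoning

θ-split : ∀ {D r m} k → D ≡ 2 ℕ.* r ℕ.+ m → θ D (r ℕ.+ k) ≡ ℕ→ℚ m ℚ.- two ℚ.* ℕ→ℚ k
θ-split {D} {r} {m} k refl = begin
  θ D (r ℕ.+ k)                                                          ≡⟨ θ-ℕ D (r ℕ.+ k) ⟩
  ℕ→ℚ (2 ℕ.* r ℕ.+ m) ℚ.- two ℚ.* ℕ→ℚ (r ℕ.+ k)                          ≡⟨ cong₂ (λ s t → s ℚ.- two ℚ.* t) (trans (ℕ→ℚ-+ (2 ℕ.* r) m) (cong (ℚ._+ ℕ→ℚ m) (ℕ→ℚ-* 2 r))) (ℕ→ℚ-+ r k) ⟩
  (two ℚ.* ℕ→ℚ r ℚ.+ ℕ→ℚ m) ℚ.- two ℚ.* (ℕ→ℚ r ℚ.+ ℕ→ℚ k)                ≡⟨ solve 3 (λ r m k → (con two :* r :+ m) :- con two :* (r :+ k) := m :- con two :* k) refl (ℕ→ℚ r) (ℕ→ℚ m) (ℕ→ℚ k) ⟩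
  ℕ→ℚ m ℚ.- two ℚ.* ℕ→ℚ k                                                ∎
  where
  open ≡-Reasoning
  open ℚS

θ-endpoint : ∀ {D r m} → D ≡ 2 ℕ.* r ℕ.+ m → θ D r ≡ ℕ→ℚ m
θ-endpoint {D} {r} {m} e = begin
  θ D r                       ≡⟨ cong (θ D) (ℕ.+-identityʳ r) ⟨
  θ D (r ℕ.+ 0)               ≡⟨ θ-split {D} {r} {m} 0 e ⟩
  ℕ→ℚ m ℚ.- two ℚ.* ℕ→ℚ 0     ≡⟨ solve 1 (λ m → m :- con two :* con 0ℚ := m) refl (ℕ→ℚ m) ⟩
  ℕ→ℚ m                       ∎
  where
  open ≡-Reasoning
  open ℚS

θ-below : ∀ {D r m} n k → D ≡ 2 ℕ.* r ℕ.+ m → n ℕ.+ k ≡ r → θ D n ≡ ℕ→ℚ m ℚ.+ two ℚ.* ℕ→ℚ k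
θ-below {D} {r} {m} n k refl refl = begin
  θ D n                                                                  ≡⟨ θ-ℕ D n ⟩
  ℕ→ℚ (2 ℕ.* r ℕ.+ m) ℚ.- two ℚ.* ℕ→ℚ n                                  ≡⟨ cong (λ s → s ℚ.- two ℚ.* ℕ→ℚ n) (trans (ℕ→ℚ-+ (2 ℕ.* r) m) (cong (ℚ._+ ℕ→ℚ m) (trans (ℕ→ℚ-* 2 r) (cong (two ℚ.*_) (ℕ→ℚ-+ n k))))) ⟩
  (two ℚ.* (ℕ→ℚ n ℚ.+ ℕ→ℚ k) ℚ.+ ℕ→ℚ m) ℚ.- two ℚ.* ℕ→ℚ n                ≡⟨ solve 3 (λ n m k → (con two :* (n :+ k) :+ m) :- con two :* n := m :+ con two :* k) refl (ℕ→ℚ n) (ℕ→ℚ m) (ℕ→ℚ k) ⟩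
  ℕ→ℚ m ℚ.+ two ℚ.* ℕ→ℚ k                                                ∎
  where
  open ≡-Reasoning
  open ℚS

nilpotent-R : ∀ {D s} {v : V D} → Supp (_≡ s) v → raise v (suc D) ≈ᵥ 0ᵥ
nilpotent-R {D} {s} supp = Supp-∅ (_≡ s ℕ.+ suc D) (Supp-raise supp (suc D)) λ n n≤D e →
  ℕ.<⇒≢ (ℕ.<-≤-trans (ℕ.s≤s n≤D) (ℕ.m≤n+m (suc D) s)) e

-- At the last nonzero rung `k`, lowering the zero vector above it gives `(θ D r - k)` times that
-- rung, so the weight `θ D r` must be the natural number `k`.
highest-weight : ∀ {D r} {x : V D} → Supp (_≡ r) x → δ σL x ≈ᵥ 0ᵥ → ¬ (x ≈ᵥ 0ᵥ) →
  ¬ ¬ (∃ λ m → D ≡ 2 ℕ.* r ℕ.+ m × ¬ (raise x m ≈ᵥ 0ᵥ) × raise x (suc m) ≈ᵥ 0ᵥ)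
highest-weight {D} {r} {x} supp l x≉0 ¬∃ = first-zero (raise x) (suc D) (nilpotent-R supp) x≉0
  λ (k , p , q) → ¬∃ (k , θ≡ℕ D r k (weight≡ k p q) , p , q)
  where
  open Highest {μ = θ D r} (Supp-eigen (_≡ r) supp λ n e → cong (θ D) e) l
  weight≡ : ∀ k → ¬ (raise x k ≈ᵥ 0ᵥ) → raise x (suc k) ≈ᵥ 0ᵥ → θ D r ≡ ℕ→ℚ k
  weight≡ k p q with θ D r ℚ.≟ ℕ→ℚ k
  ... | yes eq = eq
  ... | no neq = contradiction (distinct-eigenvalues {f = ι (θ D r) •ᵥ_} (λ y → R.refl) (λ y →
          R.trans (solve 3 (λ a b v → a :* v := (a :- b) :* v :+ b :* v) R.refl (ι (θ D r)) (nat k) (raise x k y))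
          (R.trans (R.+-congʳ (R.trans (R.sym (L-raise k y)) (δ.▹-kills σL q y))) (R.+-identityˡ _)))
          (neq ∘ -‿zero)) p
    where
    open ℂS
    -‿zero : ∀ {p q} → p ℚ.- q ≡ 0ℚ → p ≡ q
    -‿zero {p} {q} eq = trans
      (ℚS.solve 2 (λ p q → p ℚS.:= (p ℚS.:- q) ℚS.:+ q) refl p q)
      (trans (cong (ℚ._+ q) eq) (ℚ.+-identityˡ q))

casimir : ℕ → ℚ
casimir m = ℕ→ℚ m ℚ.* (ℕ→ℚ m ℚ.+ two)

-- Otherwise the last nonzero vector among the further lowerings of `x` would be killed by `L` and
-- have an `A*`-eigenvalue `M > m`, so `Ω` would act on it as `M (M + 2)` and not as `m (m + 2)`.
L-kills : ∀ {D r m} {x : V D} → D ≡ 2 ℕ.* r ℕ.+ m → Supp (_≡ r) x → Ω x ≈ᵥ ι (casimir m) •ᵥ x → δ σL x ≈ᵥ 0ᵥ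
L-kills {D} {r} {m} {x} D≡ supp ω y = ≈-stable λ k → first-zero z r z[r]≈0 (λ p → k (p y)) contra
  where
  z : ℕ → V D
  z = divided (δ σL) (δ σL x)
  -- `z k` is `Lᵏ⁺¹x / k!`, of weight `r - (k + 1)`. The additive form avoids truncated subtraction,
  -- so that the predicate has no solutions once `k = r`.
  P′ : ℕ → Pred (V D) 0ℓ
  P′ k v = Supp (λ n → n ℕ.+ suc k ≡ r) v × Ω v ≈ᵥ ι (casimir m) •ᵥ v
  Supp-below : ∀ {S S′ : ℕ → Set} {v : V D} → Supp S v → (∀ n → S n → S′ n) → Supp S′ v
  Supp-below supp h y ¬s = supp y λ s → ¬s (h (weight y) s)
  z∈ : ∀ k → z k ∈ P′ k
  z∈ = divided-closed P′
    (λ k c {v} (s , o) → Supp-below (Supp-• (λ n → suc n ℕ.+ suc k ≡ r) c (Supp-L (λ n → n ℕ.+ suc k ≡ r) s)) (λ n e → trans (ℕ.+-suc n (suc k)) e) , eigen-map Ω-linear (δ-linear σL) Ω-L o c)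
    (Supp-below (Supp-L (_≡ r) supp) (λ n e → trans (ℕ.+-comm n 1) e) , λ y → R.trans (Ω-L x y) (R.trans (δ.▹-cong σL ω y) (δ.▹-• σL _ x y)))
  z[r]≈0 : z r ≈ᵥ 0ᵥ
  z[r]≈0 = Supp-∅ (λ n → n ℕ.+ suc r ≡ r) (proj₁ (z∈ r)) λ n _ e → ℕ.<⇒≢ (ℕ.m≤n+m (suc r) n) (sym e)
  contra : ¬ (∃ λ k → ¬ (z k ≈ᵥ 0ᵥ) × z (suc k) ≈ᵥ 0ᵥ)
  contra (k , p , q) = p (distinct-eigenvalues {f = Ω}
    (Ω-highest {μ = M} (Supp-eigen (λ n → n ℕ.+ suc k ≡ r) (proj₁ (z∈ k)) λ n e → θ-below {r = r} {m} n (suc k) D≡ e)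
      (λ y → R.trans (divided-step (δ σL) (δ σL x) k y) (R.trans (R.*-congˡ (q y)) (R.zeroʳ _))))
    (proj₂ (z∈ k))
    (λ eq → ℕ→ℚ-suc≢0 (ℕ.pred (4 ℕ.* suc k ℕ.* suc (m ℕ.+ suc k))) (trans gap eq)))
    where
    M = ℕ→ℚ m ℚ.+ two ℚ.* ℕ→ℚ (suc k)
    -- For `M = m + 2(k + 1)` the two eigenvalues of `Ω` differ by `4(k + 1)(m + k + 2)`, a positive
    -- integer.
    gap : ℕ→ℚ (4 ℕ.* suc k ℕ.* suc (m ℕ.+ suc k)) ≡ M ℚ.* (M ℚ.+ two) ℚ.- casimir m
    gap = begin
      ℕ→ℚ (4 ℕ.* suc k ℕ.* suc (m ℕ.+ suc k))
        ≡⟨ trans (ℕ→ℚ-* (4 ℕ.* suc k) (suc (m ℕ.+ suc k))) (cong₂ ℚ._*_ (ℕ→ℚ-* 4 (suc k)) (trans (ℕ→ℚ-suc (m ℕ.+ suc k)) (cong (1ℚ ℚ.+_) (ℕ→ℚ-+ m (suc k))))) ⟩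
      ℕ→ℚ 4 ℚ.* ℕ→ℚ (suc k) ℚ.* (1ℚ ℚ.+ (ℕ→ℚ m ℚ.+ ℕ→ℚ (suc k)))
        ≡⟨ solve 2 (λ m k → let M = m :+ con two :* k in con (ℕ→ℚ 4) :* k :* (con 1ℚ :+ (m :+ k)) := M :* (M :+ con two) :- m :* (m :+ con two)) refl (ℕ→ℚ m) (ℕ→ℚ (suc k)) ⟩
      M ℚ.* (M ℚ.+ two) ℚ.- casimir m ∎
      where
      open ≡-Reasoning
      open ℚS

raise-vanishes : ∀ {D r m} {x : V D} → D ≡ 2 ℕ.* r ℕ.+ m → Supp (_≡ r) x → δ σL x ≈ᵥ 0ᵥ → raise x (suc m) ≈ᵥ 0ᵥ
raise-vanishes {D} {r} {m} {x} D≡ supp l y = ≈-stable λ k →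
  highest-weight supp l (λ p → k (raise-0 (suc m) p y)) λ (m′ , D≡′ , _ , q) →
    k (subst (λ m → raise x (suc m) y ≈ 0#) (ℕ.+-cancelˡ-≡ (2 ℕ.* r) m′ m (trans (sym D≡′) D≡)) (q y))

-- The mirror image of `L-kills`: the last nonzero raising of `x` would be killed by `R` at an
-- `A*`-eigenvalue `M < -m`, where `Ω` acts as `M (M - 2)`.
above-vanishes : ∀ {D r m} {x : V D} e → m ℕ.< e → D ≡ 2 ℕ.* r ℕ.+ m → Supp (_≡ r ℕ.+ e) x →
                 Ω x ≈ᵥ ι (casimir m) •ᵥ x → x ≈ᵥ 0ᵥ
above-vanishes {D} {r} {m} {x} e m<e D≡ supp ω y = ≈-stable λ k → first-zero (raise x) (suc D) (nilpotent-R supp) (λ p → k (p y)) contra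
  where
  Ω-raise : ∀ k → Ω (raise x k) ≈ᵥ ι (casimir m) •ᵥ raise x k
  Ω-raise = divided-closed (λ _ v → Ω v ≈ᵥ ι (casimir m) •ᵥ v) (λ k c o → eigen-map Ω-linear (δ-linear σR) Ω-R o c) ω
  contra : ¬ (∃ λ k → ¬ (raise x k ≈ᵥ 0ᵥ) × raise x (suc k) ≈ᵥ 0ᵥ)
  contra (k , p , q) = p (distinct-eigenvalues {f = Ω}
    (Ω-lowest {μ = M} (Supp-eigen (_≡ r ℕ.+ e ℕ.+ k) (Supp-raise supp k) λ n n≡ → trans (cong (θ D) (trans n≡ (ℕ.+-assoc r e k))) (θ-split {r = r} {m} (e ℕ.+ k) D≡))
      (λ y → R.trans (divided-step (δ σR) x k y) (R.trans (R.*-congˡ (q y)) (R.zeroʳ _))))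
    (Ω-raise k)
    (λ eq → ℕ→ℚ-suc≢0 (ℕ.pred (4 ℕ.* suc g ℕ.* suc (m ℕ.+ suc g))) (trans gap eq)))
    where
    -- `suc g` is the excess of `e + k` over `m`, so that `M = -(m + 2 suc g)`.
    g = e ℕ.∸ suc m ℕ.+ k
    e+k≡ : e ℕ.+ k ≡ m ℕ.+ suc g
    e+k≡ = trans (cong (ℕ._+ k) (sym (ℕ.m+[n∸m]≡n m<e))) (trans (ℕ.+-assoc (suc m) _ k) (sym (ℕ.+-suc m g)))
    M = ℕ→ℚ m ℚ.- two ℚ.* ℕ→ℚ (e ℕ.+ k)
    gap : ℕ→ℚ (4 ℕ.* suc g ℕ.* suc (m ℕ.+ suc g)) ≡ M ℚ.* (M ℚ.- two) ℚ.- casimir m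
    gap = begin
      ℕ→ℚ (4 ℕ.* suc g ℕ.* suc (m ℕ.+ suc g))
        ≡⟨ trans (ℕ→ℚ-* (4 ℕ.* suc g) (suc (m ℕ.+ suc g))) (cong₂ ℚ._*_ (ℕ→ℚ-* 4 (suc g)) (trans (ℕ→ℚ-suc (m ℕ.+ suc g)) (cong (1ℚ ℚ.+_) (ℕ→ℚ-+ m (suc g))))) ⟩
      ℕ→ℚ 4 ℚ.* ℕ→ℚ (suc g) ℚ.* (1ℚ ℚ.+ (ℕ→ℚ m ℚ.+ ℕ→ℚ (suc g)))
        ≡⟨ solve 2 (λ m g → let M = m :- con two :* (m :+ g) in con (ℕ→ℚ 4) :* g :* (con 1ℚ :+ (m :+ g)) := M :* (M :- con two) :- m :* (m :+ con two)) refl (ℕ→ℚ m) (ℕ→ℚ (suc g)) ⟩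
      M′ ℚ.* (M′ ℚ.- two) ℚ.- casimir m
        ≡⟨ cong (λ t → let M = ℕ→ℚ m ℚ.- two ℚ.* t in M ℚ.* (M ℚ.- two) ℚ.- casimir m) (trans (cong ℕ→ℚ e+k≡) (ℕ→ℚ-+ m (suc g))) ⟨
      M ℚ.* (M ℚ.- two) ℚ.- casimir m ∎
      where
      open ≡-Reasoning
      open ℚS
      M′ = ℕ→ℚ m ℚ.- two ℚ.* (ℕ→ℚ m ℚ.+ ℕ→ℚ (suc g))

-- Primitive idempotents

if-yes : ∀ {P : Set} (P? : Dec P) {a b} → P → (if does P? then a else b) ≈ a
if-yes (yes _) p = R.refl
if-yes (no ¬p) p = contradiction p ¬p

if-no : ∀ {P : Set} (P? : Dec P) {a b} → ¬ P → (if does P? then a else b) ≈ b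
if-no (yes p) ¬p = contradiction p ¬p
if-no (no _)  ¬p = R.refl

E*-▹ : ∀ {D} i (v : V D) y → (E* i ▹ v) y ≈ (if does (weight y ℕ.≟ i) then 1# else 0#) * v y
E*-▹ i v y = ∑ₓ-diagonal y (if does (weight y ℕ.≟ i) then 1# else 0#) v

E*-in : ∀ {D} i (v : V D) y → weight y ≡ i → (E* i ▹ v) y ≈ v y
E*-in i v y e = R.trans (E*-▹ i v y) (R.trans (R.*-congʳ (if-yes (weight y ℕ.≟ i) e)) (R.*-identityˡ (v y)))

Supp-E* : ∀ {D} i (v : V D) → Supp (_≡ i) (E* i ▹ v)
Supp-E* i v y ne = R.trans (E*-▹ i v y) (R.trans (R.*-congʳ (if-no (weight y ℕ.≟ i) ne)) (R.zeroˡ (v y)))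

E*-fix : ∀ {D i} {v : V D} → Supp (_≡ i) v → E* i ▹ v ≈ᵥ v
E*-fix {i = i} {v} supp y with weight y ℕ.≟ i
... | yes e = E*-in i v y e
... | no ne = R.trans (Supp-E* i v y ne) (R.sym (supp y ne))

E*-kill : ∀ {D i k} {v : V D} → k ≢ i → Supp (_≡ k) v → E* i ▹ v ≈ᵥ 0ᵥ
E*-kill {i = i} {k} {v} k≢i supp y with weight y ℕ.≟ i
... | yes e = R.trans (E*-in i v y e) (supp y λ e′ → k≢i (trans (sym e′) e))
... | no ne = Supp-E* i v y ne

E*-selfadjoint : ∀ {D} i (v w : V D) → ⟨ v , E* i ▹ w ⟩ ≈ ⟨ E* i ▹ v , w ⟩
E*-selfadjoint {D} i v w = ∑ₓ-cong {D} λ y → go y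
  where
  go : ∀ y → v y * conj ((E* i ▹ w) y) ≈ (E* i ▹ v) y * conj (w y)
  go y with weight y ℕ.≟ i
  ... | yes e = R.trans (R.*-congˡ (conj-cong (E*-in i w y e))) (R.*-congʳ (R.sym (E*-in i v y e)))
  ... | no ne = R.trans (R.trans (R.*-congˡ (R.trans (conj-cong (Supp-E* i w y ne)) (conj-ι 0ℚ))) (R.zeroʳ (v y)))
                        (R.sym (R.trans (R.*-congʳ (Supp-E* i v y ne)) (R.zeroˡ _)))

-- The factors `1#` give the sum the shape that `▹-Σ` expects.
E*-sum : ∀ {D} (v : V D) → v ≈ᵥ (λ y → Σᶜ (suc D) (λ k → 1# * (E* k ▹ v) y))
E*-sum {D} v y = R.sym (R.trans
  (Σᶜ-only (suc D) (weight y) (ℕ.s≤s (weight-≤ y)) λ k ne → R.trans (R.*-congˡ (Supp-E* k v y (ne ∘ sym))) (R.zeroʳ 1#))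
  (R.trans (R.*-identityˡ _) (E*-in (weight y) v y refl)))

-- By linearity and `E*-sum` it is enough to compare both sides on single weight spaces. This
-- reaches `E i` and `Eᵋ i` through their values on eigenvectors alone.
intertwine-E* : ∀ {D i} {f g : V D → V D} → i ≤ D → IsLinear f → IsLinear g →
  (∀ {v} → Supp (_≡ i) v → f (g v) ≈ᵥ g v) →
  (∀ {k v} → k ≤ D → k ≢ i → Supp (_≡ k) v → f (g v) ≈ᵥ 0ᵥ) →
  ∀ v → f (g v) ≈ᵥ g (E* i ▹ v)
intertwine-E* {D} {i} {f} {g} i≤D f-lin g-lin same other v y = begin
  f (g v) y
    ≈⟨ f-lin .▹-cong (g-lin .▹-cong (E*-sum v)) y ⟩
  f (g (λ y → Σᶜ (suc D) (λ k → 1# * (E* k ▹ v) y))) y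
    ≈⟨ f-lin .▹-cong (▹-Σ g-lin (suc D) (λ _ → 1#) (λ k → E* k ▹ v)) y ⟩
  f (λ y → Σᶜ (suc D) (λ k → 1# * g (E* k ▹ v) y)) y
    ≈⟨ ▹-Σ f-lin (suc D) (λ _ → 1#) (λ k → g (E* k ▹ v)) y ⟩
  Σᶜ (suc D) (λ k → 1# * f (g (E* k ▹ v)) y)
    ≈⟨ Σᶜ-cong (suc D) {g = pick} (λ k k<1+D → R.trans (R.*-identityˡ _) (value k (ℕ.≤-pred k<1+D))) ⟩
  Σᶜ (suc D) pick
    ≈⟨ Σᶜ-only (suc D) i (ℕ.s≤s i≤D) (λ k k≢i → if-no (k ℕ.≟ i) k≢i) ⟩
  pick i
    ≈⟨ if-yes (i ℕ.≟ i) refl ⟩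
  g (E* i ▹ v) y ∎
  where
  open ≈-Reasoning
  pick : ℕ → ℂ
  pick k = if does (k ℕ.≟ i) then g (E* i ▹ v) y else 0#
  value : ∀ k → k ≤ D → f (g (E* k ▹ v)) y ≈ pick k
  value k k≤D with k ℕ.≟ i
  ... | yes refl = R.trans (same (Supp-E* k v) y) (R.sym (if-yes (k ℕ.≟ k) refl))
  ... | no k≢i   = R.trans (other k≤D k≢i (Supp-E* k v) y) (R.sym (if-no (k ℕ.≟ i) k≢i))

A-eigen : ∀ {D} → ℕ → V D → Set
A-eigen {D} k v = δ σA v ≈ᵥ ι (θ D k) •ᵥ v

E-factors : ∀ {D} → ℕ → List ℕ → Mat D
E-factors i js = foldr _·ₘ_ Iₘ (map (E-factor i) js)

A-shift-▹ : ∀ {D} c t (v : V D) → (c •ₘ (A -ₘ t •ₘ Iₘ)) ▹ v ≈ᵥ c •ᵥ (δ σA v +ᵥ (- t) •ᵥ v)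
A-shift-▹ {D} c t v y = begin
  ∑ₓ (λ z → c * (A y z - t * Iₘ y z) * v z)
    ≈⟨ ∑ₓ-cong {D} (λ z → solve 5 (λ c a t i v → c :* (a :- t :* i) :* v := c :* (a :* v) :+ (c :* :- t) :* (i :* v)) R.refl c (A y z) t (Iₘ y z) (v z)) ⟩
  ∑ₓ (λ z → c * (A y z * v z) + (c * - t) * (Iₘ y z * v z))
    ≈⟨ ∑ₓ-+ {D} (λ z → c * (A y z * v z)) (λ z → (c * - t) * (Iₘ y z * v z)) ⟩
  ∑ₓ (λ z → c * (A y z * v z)) + ∑ₓ (λ z → (c * - t) * (Iₘ y z * v z))
    ≈⟨ R.+-cong (∑ₓ-*ˡ {D} c (λ z → A y z * v z)) (∑ₓ-*ˡ {D} (c * - t) (λ z → Iₘ y z * v z)) ⟩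
  c * (A ▹ v) y + (c * - t) * (Iₘ ▹ v) y
    ≈⟨ R.+-cong (R.*-congˡ (A-▹ v y)) (R.*-congˡ (I-▹ v y)) ⟩
  c * δ σA v y + (c * - t) * v y
    ≈⟨ solve 4 (λ c a t v → c :* a :+ (c :* :- t) :* v := c :* (a :+ :- t :* v)) R.refl c (δ σA v y) t (v y) ⟩
  c * (δ σA v y + - t * v y) ∎
  where
  open ≈-Reasoning
  open ℂS

E-factor-scalar : ∀ {D} i j k {v : V D} → A-eigen k v → ∃ λ c → E-factor i j ▹ v ≈ᵥ c •ᵥ v
E-factor-scalar {D} i j k {v} e with i ℕ.≟ j
... | yes _  = 1# , λ y → R.trans (I-▹ v y) (R.sym (R.*-identityˡ (v y)))
... | no i≢j = c * (ι (θ D k) + - ι (θ D j)) , λ y → R.trans (A-shift-▹ c (ι (θ D j)) v y)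
      (R.trans (R.*-congˡ (R.+-congʳ (e y)))
      (solve 4 (λ c s t v → c :* (s :* v :+ :- t :* v) := c :* (s :+ :- t) :* v) R.refl c (ι (θ D k)) (ι (θ D j)) (v y)))
  where
  open ℂS
  c = ι (1/_ (θ D i ℚ.- θ D j) {{θ-gap D i≢j}})

E-factor-same : ∀ {D} i j {v : V D} → A-eigen i v → E-factor i j ▹ v ≈ᵥ v
E-factor-same {D} i j {v} e with i ℕ.≟ j
... | yes _  = I-▹ v
... | no i≢j = λ y → R.trans (A-shift-▹ _ (ι (θ D j)) v y) (R.trans (R.*-congˡ (R.+-congʳ (e y)))
      (R.trans (solve 4 (λ c s t v → c :* (s :* v :+ :- t :* v) := c :* (s :- t) :* v) R.refl _ (ι (θ D i)) (ι (θ D j)) (v y))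
      (R.trans (R.*-congʳ (R.trans (R.*-congˡ (R.sym (R.trans (ι-+ (θ D i) (ℚ.- θ D j)) (R.+-congˡ (ι-neg (θ D j))))))
        (R.trans (R.sym (ι-* (1/_ gap {{nz}}) gap)) (ι-cong (ℚ.*-inverseˡ gap {{nz}}))))) (R.*-identityˡ (v y)))))
  where
  open ℂS
  gap = θ D i ℚ.- θ D j
  nz = θ-gap D i≢j

E-factor-zero : ∀ {D} i k {v : V D} → i ≢ k → A-eigen k v → E-factor i k ▹ v ≈ᵥ 0ᵥ
E-factor-zero {D} i k {v} i≢k e with i ℕ.≟ k
... | yes i≡k = contradiction i≡k i≢k
... | no i≢k = λ y → R.trans (A-shift-▹ _ (ι (θ D k)) v y) (R.trans (R.*-congˡ (R.+-congʳ (e y)))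
      (solve 3 (λ c s v → c :* (s :* v :+ :- s :* v) := con 0ℚ) R.refl _ (ι (θ D k)) (v y)))
  where open ℂS

E-factors-same : ∀ {D} i js {v : V D} → A-eigen i v → E-factors i js ▹ v ≈ᵥ v
E-factors-same i []       e = I-▹ _
E-factors-same i (j ∷ js) {v} e y = R.trans (·-▹ (E-factor i j) (E-factors i js) v y)
  (R.trans (▹-linear (E-factor i j) .▹-cong (E-factors-same i js e) y) (E-factor-same i j e y))

E-factors-scalar : ∀ {D} i k js {v : V D} → A-eigen k v → ∃ λ c → E-factors i js ▹ v ≈ᵥ c •ᵥ v
E-factors-scalar i k []       {v} e = 1# , λ y → R.trans (I-▹ v y) (R.sym (R.*-identityˡ (v y)))
E-factors-scalar i k (j ∷ js) {v} e =
  let c , p = E-factors-scalar i k js e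
      b , q = E-factor-scalar i j k e
  in c * b , λ y → R.trans (·-▹ (E-factor i j) (E-factors i js) v y)
    (R.trans (▹-linear (E-factor i j) .▹-cong p y)
    (R.trans (▹-linear (E-factor i j) .▹-• c v y) (R.trans (R.*-congˡ (q y)) (R.sym (R.*-assoc c b (v y))))))

-- The factors to the right of the one for `k` only rescale `v`, that factor annihilates it, and
-- those to its left preserve zero.
E-factors-zero : ∀ {D} i k js {v : V D} → i ≢ k → k List.∈ js → A-eigen k v → E-factors i js ▹ v ≈ᵥ 0ᵥ
E-factors-zero i k (j ∷ js) {v} i≢k (there k∈js) e y = R.trans (·-▹ (E-factor i j) (E-factors i js) v y)
  (▹-kills (▹-linear (E-factor i j)) (E-factors-zero i k js i≢k k∈js e) y)
E-factors-zero i k (k ∷ js) {v} i≢k (here refl) e y =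
  let c , p = E-factors-scalar i k js e in R.trans (·-▹ (E-factor i k) (E-factors i js) v y)
    (R.trans (▹-linear (E-factor i k) .▹-cong p y)
    (R.trans (▹-linear (E-factor i k) .▹-• c v y) (R.trans (R.*-congˡ (E-factor-zero i k i≢k e y)) (R.zeroʳ c))))

E-same : ∀ {D} i {v : V D} → A-eigen i v → E i ▹ v ≈ᵥ v
E-same {D} i = E-factors-same i (upTo (suc D))

E-other : ∀ {D} i k {v : V D} → k ≤ D → k ≢ i → A-eigen k v → E i ▹ v ≈ᵥ 0ᵥ
E-other {D} i k k≤D k≢i = E-factors-zero i k (upTo (suc D)) (k≢i ∘ sym) (∈-upTo⁺ (ℕ.s≤s k≤D))

Supp-weight : ∀ {D k} {v : V D} → Supp (_≡ k) v → δ σA* v ≈ᵥ ι (θ D k) •ᵥ v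
Supp-weight {D} {k} supp = Supp-eigen (_≡ k) supp λ n e → cong (θ D) e

eigen-transport : ∀ {D} (f : V D → V D) {g h : V D → V D} {c v} → IsLinear g → (∀ v → f (g v) ≈ᵥ g (h v)) →
                  h v ≈ᵥ c •ᵥ v → f (g v) ≈ᵥ c •ᵥ g v
eigen-transport f {c = c} {v} g-lin fg e y = R.trans (fg v y) (R.trans (g-lin .▹-cong e y) (g-lin .▹-• c v y))

E-P⁻¹ : ∀ {D i} → i ≤ D → (v : V D) → E i ▹ κ P₁⁻¹ v ≈ᵥ κ P₁⁻¹ (E* i ▹ v)
E-P⁻¹ {D} {i} i≤D = intertwine-E* i≤D (▹-linear (E i)) (κ-linear P₁⁻¹)
  (λ s → E-same i (eigen i s)) (λ {k} k≤D k≢i s → E-other i k k≤D k≢i (eigen k s))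
  where
  eigen : ∀ k {v : V D} → Supp (_≡ k) v → A-eigen k (κ P₁⁻¹ v)
  eigen k s = eigen-transport (δ σA) (κ-linear P₁⁻¹) AP⁻¹≈P⁻¹A* (Supp-weight s)

Eᵋ-▹ : ∀ {D} i (v : V D) → Eᵋ i ▹ v ≈ᵥ κ P₁⁻¹ (E i ▹ κ P₁ v)
Eᵋ-▹ i v y = R.trans (·-▹ (P⁻¹ ·ₘ E i) P v y) (R.trans (·-▹ P⁻¹ (E i) (P ▹ v) y)
  (R.trans (P⁻¹-▹ (E i ▹ P ▹ v) y) (κ.▹-cong P₁⁻¹ (▹-linear (E i) .▹-cong (P-▹ v)) y)))

Eᵋ-P : ∀ {D i} → i ≤ D → (v : V D) → Eᵋ i ▹ κ P₁ v ≈ᵥ κ P₁ (E* i ▹ v)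
Eᵋ-P {D} {i} i≤D = intertwine-E* i≤D (▹-linear (Eᵋ i)) (κ-linear P₁)
  (λ {v} s y → R.trans (Eᵋ-▹ i (κ P₁ v) y) (R.trans (κ.▹-cong P₁⁻¹ (E-same i (eigen i s)) y) (P⁻¹P (κ P₁ v) y)))
  (λ {k} {v} k≤D k≢i s y → R.trans (Eᵋ-▹ i (κ P₁ v) y) (κ.▹-kills P₁⁻¹ (E-other i k k≤D k≢i (eigen k s)) y))
  where
  -- The first `P` turns the weight vector into an eigenvector of `Aᵋ`. The second one, which comes
  -- from `Eᵋ = P⁻¹ E P`, makes it an eigenvector of `A`.
  eigen : ∀ k {v : V D} → Supp (_≡ k) v → A-eigen k (κ P₁ (κ P₁ v))
  eigen k s = eigen-transport (δ σA) (κ-linear P₁) AP≈PAᵋ (eigen-transport (δ σAᵋ) (κ-linear P₁) AᵋP≈PA* (Supp-weight s))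

½^d*2^d : ∀ d → ι ½ ^ d * nat (2 ℕ.^ d) ≈ 1#
½^d*2^d zero    = R.*-identityˡ 1#
½^d*2^d (suc d) = begin
  ι ½ * ι ½ ^ d * nat (2 ℕ.* 2 ℕ.^ d)           ≈⟨ R.*-congˡ (R.trans (ι-cong (ℕ→ℚ-* 2 (2 ℕ.^ d))) (ι-* two (ℕ→ℚ (2 ℕ.^ d)))) ⟩
  ι ½ * ι ½ ^ d * (ι two * nat (2 ℕ.^ d))       ≈⟨ solve 2 (λ p q → con ½ :* p :* (con two :* q) := p :* q) R.refl (ι ½ ^ d) (nat (2 ℕ.^ d)) ⟩
  ι ½ ^ d * nat (2 ℕ.^ d)                       ≈⟨ ½^d*2^d d ⟩
  1#                                            ∎
  where
  open ≈-Reasoning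
  open ℂS

ι-sub : ∀ p q → ι (p ℚ.- q) ≈ ι p - ι q
ι-sub p q = R.trans (ι-+ p (ℚ.- q)) (R.+-congˡ (ι-neg q))

module Ladder {D r d} {x : V D} (D≡ : D ≡ 2 ℕ.* r ℕ.+ d) (supp : Supp (_≡ r) x) (l : δ σL x ≈ᵥ 0ᵥ) where
  open Highest {x = x} {μ = ℕ→ℚ d} (Supp-eigen (_≡ r) supp λ n e → trans (cong (θ D) e) (θ-endpoint {D} {r} {d} D≡)) l

  r+i≤D : ∀ {i} → i ≤ d → r ℕ.+ i ≤ D
  r+i≤D i≤d = subst (_ ≤_) (sym D≡) (ℕ.+-mono-≤ (ℕ.m≤m+n r (r ℕ.+ 0)) i≤d)

  xs : ℕ → V D
  xs = raise x

  xs-top : xs (suc d) ≈ᵥ 0ᵥ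
  xs-top = raise-vanishes D≡ supp l

  A-xs-zero : ∀ y → δ σA (xs 0) y ≈ xs 1 y
  A-xs-zero y = R.trans (A-split x y) (R.trans (R.+-cong (R.*-congˡ (l y)) (R.*-congˡ (divided-step (δ σR) x 0 y)))
    (solve 1 (λ w → con 1ℚ :* con 0ℚ :+ con 1ℚ :* (con 1ℚ :* w) := w) R.refl (xs 1 y)))
    where open ℂS

  A-xs-suc : ∀ k y → δ σA (xs (suc k)) y ≈ (nat d - nat k) * xs k y + (1# + (1# + nat k)) * xs (suc (suc k)) y
  A-xs-suc k y = R.trans (A-split (xs (suc k)) y) (R.+-cong (R.trans (R.*-identityˡ _) (L-raise k y))
    (R.trans (R.*-identityˡ _) (R.trans (divided-step (δ σR) x (suc k) y) (R.*-congʳ (R.trans (nat-suc (suc k)) (R.+-congˡ (nat-suc k)))))))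

  f : ℕ → ℕ → ℂ
  f i j = ι (F d i j)

  f-recurrence : ∀ i j → i ≤ d → nat j * f i (ℕ.pred j) + (nat d - nat j) * f i (suc j) ≈ (nat d - nat 2 * nat i) * f i j
  f-recurrence i j i≤d = begin
    nat j * f i (ℕ.pred j) + (nat d - nat j) * f i (suc j)
      ≈⟨ R.+-cong (ι-* (ℕ→ℚ j) _) (R.trans (ι-* (ℕ→ℚ d ℚ.- ℕ→ℚ j) _) (R.*-congʳ (ι-sub (ℕ→ℚ d) (ℕ→ℚ j)))) ⟨
    ι (ℕ→ℚ j ℚ.* F d i (ℕ.pred j)) + ι ((ℕ→ℚ d ℚ.- ℕ→ℚ j) ℚ.* F d i (suc j))
      ≈⟨ ι-+ _ _ ⟨
    ι (ℕ→ℚ j ℚ.* F d i (ℕ.pred j) ℚ.+ (ℕ→ℚ d ℚ.- ℕ→ℚ j) ℚ.* F d i (suc j))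
      ≈⟨ ι-cong (F-recurrence d i j i≤d) ⟩
    ι ((ℕ→ℚ d ℚ.- two ℚ.* ℕ→ℚ i) ℚ.* F d i j)
      ≈⟨ R.trans (ι-* _ _) (R.*-congʳ (R.trans (ι-sub (ℕ→ℚ d) (two ℚ.* ℕ→ℚ i)) (R.+-congˡ (R.-‿cong (ι-* two (ℕ→ℚ i)))))) ⟩
    (nat d - nat 2 * nat i) * f i j ∎
    where open ≈-Reasoning

  partial : ℕ → ℕ → V D
  partial i n y = Σᶜ n (λ j → f i j * xs j y)

  v : ℕ → V D
  v i = partial i (suc d)

  -- Truncation after rung `n` spoils the eigenvalue equation only at rungs `n` and `n + 1`, and the
  -- recurrence absorbs each new rung. At `n = d` one error term vanishes with `xs (suc d)`, the
  -- other with `d - n`.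
  A-partial : ∀ i n → i ≤ d → ∀ y → δ σA (partial i (suc n)) y ≈
    (nat d - nat 2 * nat i) * partial i (suc n) y + ((1# + nat n) * f i n * xs (suc n) y - (nat d - nat n) * f i (suc n) * xs n y)
  A-partial i zero i≤d y = begin
    δ σA (partial i 1) y
      ≈⟨ R.trans (▹-Σ (δ-linear σA) 1 (f i) xs y) (R.+-congˡ (R.*-congˡ (A-xs-zero y))) ⟩
    0# + f i 0 * xs 1 y
      ≈⟨ solve 2 (λ g a → con 0ℚ :+ g :* a := (con 1ℚ :+ con 0ℚ) :* g :* a) R.refl (f i 0) (xs 1 y) ⟩
    (1# + nat 0) * f i 0 * xs 1 y
      ≈⟨ solve 2 (λ s t → s := t :+ (s :- t)) R.refl _ (λf * xs 0 y) ⟩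
    λf * xs 0 y + ((1# + nat 0) * f i 0 * xs 1 y - λf * xs 0 y)
      ≈⟨ R.+-cong (solve 3 (λ l g x → l :* g :* x := l :* (con 0ℚ :+ g :* x)) R.refl (nat d - nat 2 * nat i) (f i 0) (xs 0 y))
           (R.+-congˡ (R.-‿cong (R.*-congʳ (R.trans (R.sym (f-recurrence i 0 i≤d))
             (solve 2 (λ a b → con 0ℚ :* a :+ b := b) R.refl (f i 0) ((nat d - nat 0) * f i 1)))))) ⟩
    (nat d - nat 2 * nat i) * partial i 1 y + ((1# + nat 0) * f i 0 * xs 1 y - (nat d - nat 0) * f i 1 * xs 0 y) ∎
    where
    open ≈-Reasoning
    open ℂS
    λf = (nat d - nat 2 * nat i) * f i 0
  A-partial i (suc n) i≤d y = begin
    δ σA (partial i (suc (suc n))) y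
      ≈⟨ δ.▹-+ σA (partial i (suc n)) (f i (suc n) •ᵥ xs (suc n)) y ⟩
    δ σA (partial i (suc n)) y + δ σA (f i (suc n) •ᵥ xs (suc n)) y
      ≈⟨ R.+-cong (A-partial i n i≤d y) (R.trans (δ.▹-• σA (f i (suc n)) (xs (suc n)) y) (R.*-congˡ (A-xs-suc n y))) ⟩
    (Λ * s + ((1# + N) * f₀ * x₁ - (nat d - N) * f₁ * x₀)) + f₁ * ((nat d - N) * x₀ + (1# + (1# + N)) * x₂)
      ≈⟨ solve 9 (λ Λ s n d g h a b c → (Λ :* s :+ ((con 1ℚ :+ n) :* g :* b :- (d :- n) :* h :* a)) :+ h :* ((d :- n) :* a :+ (con 1ℚ :+ (con 1ℚ :+ n)) :* c)
           := (Λ :* s :+ (con 1ℚ :+ n) :* g :* b) :+ (con 1ℚ :+ (con 1ℚ :+ n)) :* h :* c) R.refl Λ s N (nat d) f₀ f₁ x₀ x₁ x₂ ⟩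
    (Λ * s + (1# + N) * f₀ * x₁) + (1# + (1# + N)) * f₁ * x₂
      ≈⟨ R.+-congʳ (R.+-congˡ (R.*-congʳ (R.trans (solve 2 (λ p q → p := (p :+ q) :- q) R.refl _ ((nat d - (1# + N)) * f₂)) (R.+-congʳ rec)))) ⟩
    (Λ * s + (Λ * f₁ - (nat d - (1# + N)) * f₂) * x₁) + (1# + (1# + N)) * f₁ * x₂
      ≈⟨ solve 8 (λ Λ s n d g h b c → (Λ :* s :+ (Λ :* g :- (d :- (con 1ℚ :+ n)) :* h) :* b) :+ (con 1ℚ :+ (con 1ℚ :+ n)) :* g :* c
           := Λ :* (s :+ g :* b) :+ ((con 1ℚ :+ (con 1ℚ :+ n)) :* g :* c :- (d :- (con 1ℚ :+ n)) :* h :* b)) R.refl Λ s N (nat d) f₁ f₂ x₁ x₂ ⟩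
    Λ * (s + f₁ * x₁) + ((1# + (1# + N)) * f₁ * x₂ - (nat d - (1# + N)) * f₂ * x₁)
      ≈⟨ R.+-congˡ (R.+-cong (R.*-congʳ (R.*-congʳ (R.+-congˡ (nat-suc n)))) (R.-‿cong (R.*-congʳ (R.*-congʳ (R.+-congˡ (R.-‿cong (nat-suc n))))))) ⟨
    Λ * (s + f₁ * x₁) + ((1# + nat (suc n)) * f₁ * x₂ - (nat d - nat (suc n)) * f₂ * x₁) ∎
    where
    open ≈-Reasoning
    open ℂS
    Λ = nat d - nat 2 * nat i
    N = nat n
    s = partial i (suc n) y
    f₀ = f i n
    f₁ = f i (suc n)
    f₂ = f i (suc (suc n))
    x₀ = xs n y
    x₁ = xs (suc n) y
    x₂ = xs (suc (suc n)) y
    rec : (1# + N) * f₀ + (nat d - (1# + N)) * f₂ ≈ Λ * f₁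
    rec = R.trans (R.sym (R.+-cong (R.*-congʳ (nat-suc n)) (R.*-congʳ (R.+-congˡ (R.-‿cong (nat-suc n)))))) (f-recurrence i (suc n) i≤d)

  v-eigen : ∀ i → i ≤ d → A-eigen (r ℕ.+ i) (v i)
  v-eigen i i≤d y = begin
    δ σA (v i) y
      ≈⟨ A-partial i d i≤d y ⟩
    (nat d - nat 2 * nat i) * v i y + ((1# + nat d) * f i d * xs (suc d) y - (nat d - nat d) * f i (suc d) * xs d y)
      ≈⟨ R.+-congˡ (R.+-congʳ (R.*-congˡ (xs-top y))) ⟩
    (nat d - nat 2 * nat i) * v i y + ((1# + nat d) * f i d * 0# - (nat d - nat d) * f i (suc d) * xs d y)
      ≈⟨ solve 6 (λ t v d f f′ x → t :* v :+ ((con 1ℚ :+ d) :* f :* con 0ℚ :- (d :- d) :* f′ :* x) := t :* v) R.refl (nat d - nat 2 * nat i) (v i y) (nat d) (f i d) (f i (suc d)) (xs d y) ⟩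
    (nat d - nat 2 * nat i) * v i y
      ≈⟨ R.*-congʳ (R.trans (ι-cong (θ-split {D} {r} {d} i D≡)) (R.trans (ι-sub (ℕ→ℚ d) (two ℚ.* ℕ→ℚ i)) (R.+-congˡ (R.-‿cong (ι-* two (ℕ→ℚ i)))))) ⟨
    ι (θ D (r ℕ.+ i)) * v i y ∎
    where
    open ≈-Reasoning
    open ℂS

  c : ℕ → ℂ
  c i = ι ½ ^ d * ι (Cℚ d i)

  Σ-c-f : ∀ j → Σᶜ (suc d) (λ i → c i * f i j) ≈ ι ½ ^ d * ι (Σℚ (suc d) (λ i → Cℚ d i ℚ.* F d i j))
  Σ-c-f j = R.trans (Σᶜ-cong (suc d) λ i _ → R.trans (R.*-assoc _ _ _) (R.*-congˡ (R.sym (ι-* (Cℚ d i) (F d i j)))))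
    (R.trans (R.sym (Σᶜ-*ˡ (suc d) (ι ½ ^ d) (λ i → ι (Cℚ d i ℚ.* F d i j)))) (R.*-congˡ (R.sym (ι-Σ (suc d) (λ i → Cℚ d i ℚ.* F d i j)))))

  -- After interchanging the sums, the coefficient of rung `j` is a binomial column sum of `F`,
  -- equal to `2^d` at `j = 0` and to zero elsewhere.
  x-expansion : x ≈ᵥ (λ y → Σᶜ (suc d) (λ i → c i * v i y))
  x-expansion y = R.sym (begin
    Σᶜ (suc d) (λ i → c i * Σᶜ (suc d) (λ j → f i j * xs j y))
      ≈⟨ Σᶜ-cong (suc d) (λ i _ → R.trans (Σᶜ-*ˡ (suc d) (c i) (λ j → f i j * xs j y)) (Σᶜ-cong (suc d) λ j _ → R.sym (R.*-assoc (c i) (f i j) (xs j y)))) ⟩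
    Σᶜ (suc d) (λ i → Σᶜ (suc d) (λ j → c i * f i j * xs j y))
      ≈⟨ Σᶜ-comm (suc d) (suc d) (λ i j → c i * f i j * xs j y) ⟩
    Σᶜ (suc d) (λ j → Σᶜ (suc d) (λ i → c i * f i j * xs j y))
      ≈⟨ Σᶜ-cong (suc d) {g = pick} (λ j j<1+d → R.trans (R.sym (Σᶜ-*ʳ (suc d) (xs j y) (λ i → c i * f i j))) (value j (ℕ.≤-pred j<1+d))) ⟩
    Σᶜ (suc d) pick
      ≈⟨ Σᶜ-only (suc d) 0 (ℕ.s≤s ℕ.z≤n) (λ { zero ne → contradiction refl ne ; (suc j) _ → R.refl }) ⟩
    x y ∎)
    where
    open ≈-Reasoning
    pick : ℕ → ℂ
    pick zero    = x y
    pick (suc j) = 0#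
    value : ∀ j → j ≤ d → Σᶜ (suc d) (λ i → c i * f i j) * xs j y ≈ pick j
    value zero    _   = R.trans (R.*-congʳ (R.trans (Σ-c-f 0) (R.trans (R.*-congˡ (ι-cong (Σ-C-F-zero d))) (½^d*2^d d)))) (R.*-identityˡ (x y))
    value (suc j) j<d = R.trans (R.*-congʳ (R.trans (Σ-c-f (suc j)) (R.trans (R.*-congˡ (ι-cong (Σ-C-F-suc d j j<d))) (R.zeroʳ _)))) (R.zeroˡ _)

  E-x : ∀ i → i ≤ d → E (r ℕ.+ i) ▹ x ≈ᵥ c i •ᵥ v i
  E-x i i≤d y = begin
    (E (r ℕ.+ i) ▹ x) y
      ≈⟨ ▹-linear (E (r ℕ.+ i)) .▹-cong x-expansion y ⟩
    (E (r ℕ.+ i) ▹ (λ y → Σᶜ (suc d) (λ k → c k * v k y))) y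
      ≈⟨ ▹-Σ (▹-linear (E (r ℕ.+ i))) (suc d) c v y ⟩
    Σᶜ (suc d) (λ k → c k * (E (r ℕ.+ i) ▹ v k) y)
      ≈⟨ Σᶜ-cong (suc d) {g = λ k → c k * pick k} (λ k k<1+d → R.*-congˡ (value k (ℕ.≤-pred k<1+d))) ⟩
    Σᶜ (suc d) (λ k → c k * pick k)
      ≈⟨ Σᶜ-only (suc d) i (ℕ.s≤s i≤d) (λ k k≢i → R.trans (R.*-congˡ (if-no (k ℕ.≟ i) k≢i)) (R.zeroʳ _)) ⟩
    c i * pick i
      ≈⟨ R.*-congˡ (if-yes (i ℕ.≟ i) refl) ⟩
    c i * v i y ∎
    where
    open ≈-Reasoning
    pick : ℕ → ℂ
    pick k = if does (k ℕ.≟ i) then v i y else 0#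
    value : ∀ k → k ≤ d → (E (r ℕ.+ i) ▹ v k) y ≈ pick k
    value k k≤d with k ℕ.≟ i
    ... | yes refl = R.trans (E-same (r ℕ.+ k) (v-eigen k k≤d) y) (R.sym (if-yes (k ℕ.≟ k) refl))
    ... | no k≢i   = R.trans (E-other (r ℕ.+ i) (r ℕ.+ k) (r+i≤D k≤d) (k≢i ∘ ℕ.+-cancelˡ-≡ r k i) (v-eigen k k≤d) y) (R.sym (if-no (k ℕ.≟ i) k≢i))

  E*-E-x : ∀ i j → i ≤ d → j ≤ d → E* (r ℕ.+ j) ▹ E (r ℕ.+ i) ▹ x ≈ᵥ (c i * f i j) •ᵥ xs j
  E*-E-x i j i≤d j≤d y = begin
    (E* (r ℕ.+ j) ▹ E (r ℕ.+ i) ▹ x) y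
      ≈⟨ R.trans (▹-linear (E* (r ℕ.+ j)) .▹-cong (E-x i i≤d) y) (▹-linear (E* (r ℕ.+ j)) .▹-• (c i) (v i) y) ⟩
    c i * (E* (r ℕ.+ j) ▹ v i) y
      ≈⟨ R.*-congˡ (▹-Σ (▹-linear (E* (r ℕ.+ j))) (suc d) (f i) xs y) ⟩
    c i * Σᶜ (suc d) (λ k → f i k * (E* (r ℕ.+ j) ▹ xs k) y)
      ≈⟨ R.*-congˡ (Σᶜ-only (suc d) j (ℕ.s≤s j≤d) λ k k≢j → R.trans (R.*-congˡ (E*-kill (k≢j ∘ ℕ.+-cancelˡ-≡ r k j) (Supp-raise supp k) y)) (R.zeroʳ _)) ⟩
    c i * (f i j * (E* (r ℕ.+ j) ▹ xs j) y)
      ≈⟨ R.trans (R.sym (R.*-assoc _ _ _)) (R.*-congˡ (E*-fix (Supp-raise supp j) y)) ⟩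
    c i * f i j * xs j y ∎
    where open ≈-Reasoning

  module _ {w : V D} (e : δ σA w ≈ᵥ nat d •ᵥ w) where
    g : ℕ → ℂ
    g j = ⟨ xs j , w ⟩

    ⟨A-xs⟩ : ∀ j → ⟨ δ σA (xs j) , w ⟩ ≈ nat d * g j
    ⟨A-xs⟩ j = R.trans (A-adjoint (xs j) w) (R.trans (⟨⟩-cong (λ y → R.refl {xs j y}) e) (R.trans (⟨⟩-•ʳ (nat d) (xs j) w) (R.*-congʳ (conj-ι (ℕ→ℚ d)))))

    -- Self-adjointness moves `A` onto `w`, which yields `(d - j) g j + (j + 2) g (j + 2) = d g (j +
    -- 1)`. The induction hypothesis replaces the first term and leaves a two-term relation.
    g-step : ∀ j → (1# + nat j) * g (suc j) ≈ (nat d - nat j) * g j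
    g-step zero = begin
      (1# + nat 0) * g 1           ≈⟨ solve 1 (λ g → (con 1ℚ :+ con 0ℚ) :* g := g) R.refl (g 1) ⟩
      g 1                          ≈⟨ ⟨⟩-cong A-xs-zero (λ y → R.refl {w y}) ⟨
      ⟨ δ σA (xs 0) , w ⟩          ≈⟨ ⟨A-xs⟩ 0 ⟩
      nat d * g 0                  ≈⟨ solve 2 (λ d g → d :* g := (d :- con 0ℚ) :* g) R.refl (nat d) (g 0) ⟩
      (nat d - nat 0) * g 0        ∎
      where
      open ≈-Reasoning
      open ℂS
    g-step (suc j) = begin
      (1# + nat (suc j)) * g (suc (suc j))
        ≈⟨ R.*-congʳ (R.+-congˡ (nat-suc j)) ⟩
      (1# + (1# + N)) * g₂
        ≈⟨ solve 3 (λ n a b → n :* b := (a :+ n :* b) :- a) R.refl (1# + (1# + N)) ((nat d - N) * g j) g₂ ⟩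
      ((nat d - N) * g j + (1# + (1# + N)) * g₂) - (nat d - N) * g j
        ≈⟨ R.+-cong expand (R.-‿cong (R.sym (g-step j))) ⟩
      nat d * g₁ - (1# + N) * g₁
        ≈⟨ solve 3 (λ d n g → d :* g :- (con 1ℚ :+ n) :* g := (d :- (con 1ℚ :+ n)) :* g) R.refl (nat d) N g₁ ⟩
      (nat d - (1# + N)) * g₁
        ≈⟨ R.*-congʳ (R.+-congˡ (R.-‿cong (nat-suc j))) ⟨
      (nat d - nat (suc j)) * g₁ ∎
      where
      open ≈-Reasoning
      open ℂS
      N = nat j
      g₁ = g (suc j)
      g₂ = g (suc (suc j))
      expand : (nat d - N) * g j + (1# + (1# + N)) * g₂ ≈ nat d * g₁
      expand = R.trans (R.sym (R.trans (⟨⟩-cong (A-xs-suc j) (λ y → R.refl {w y}))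
        (R.trans (⟨⟩-+ˡ ((nat d - N) •ᵥ xs j) ((1# + (1# + N)) •ᵥ xs (suc (suc j))) w)
                 (R.+-cong (⟨⟩-•ˡ (nat d - N) (xs j) w) (⟨⟩-•ˡ (1# + (1# + N)) (xs (suc (suc j))) w)))))
        (⟨A-xs⟩ (suc j))

    g-binomial : ∀ j → g j ≈ ι (Cℚ d j) * g 0
    g-binomial zero    = R.sym (R.*-identityˡ (g 0))
    g-binomial (suc j) = begin
      g (suc j)                                                ≈⟨ cancel (g (suc j)) ⟨
      k * ((1# + nat j) * g (suc j))                           ≈⟨ R.*-congˡ (R.trans (g-step j) (R.*-congˡ (g-binomial j))) ⟩
      k * ((nat d - nat j) * (ι (Cℚ d j) * g 0))               ≈⟨ R.*-congˡ (R.sym (R.*-assoc _ _ _)) ⟩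
      k * ((nat d - nat j) * ι (Cℚ d j) * g 0)                 ≈⟨ R.*-congˡ (R.*-congʳ absorb) ⟨
      k * ((1# + nat j) * ι (Cℚ d (suc j)) * g 0)              ≈⟨ R.*-congˡ (R.*-assoc _ _ _) ⟩
      k * ((1# + nat j) * (ι (Cℚ d (suc j)) * g 0))            ≈⟨ cancel _ ⟩
      ι (Cℚ d (suc j)) * g 0                                   ∎
      where
      open ≈-Reasoning
      k = ι (inv (ℕ→ℚ (suc j)))
      cancel : ∀ z → k * ((1# + nat j) * z) ≈ z
      cancel z = R.trans (R.sym (R.*-assoc _ _ _)) (R.trans (R.*-congʳ (R.trans (R.*-congˡ (R.sym (nat-suc j))) (R.trans (R.*-comm _ _) (nat*inv j)))) (R.*-identityˡ z))
      absorb : (1# + nat j) * ι (Cℚ d (suc j)) ≈ (nat d - nat j) * ι (Cℚ d j)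
      absorb = R.trans (R.*-congʳ (R.sym (ι-+ 1ℚ (ℕ→ℚ j)))) (R.trans (R.sym (ι-* _ _))
        (R.trans (ι-cong (Cℚ-absorb d j)) (R.trans (ι-* _ _) (R.*-congʳ (ι-sub (ℕ→ℚ d) (ℕ→ℚ j))))))

    -- Moved to the left entry, `E*` picks rung `j` out of the eigenvector, and the value factors as
    -- `c i`, `f i j` and `g j`.
    overlap-formula : ∀ i j → i ≤ d → j ≤ d →
      ⟨ E (r ℕ.+ i) ▹ x , E* (r ℕ.+ j) ▹ w ⟩ ≈ ι ½ ^ d * ⟨ x , w ⟩ * ι (Cℚ d i) * ι (Cℚ d j) * ₂F₁ i j d
    overlap-formula i j i≤d j≤d = begin
      ⟨ E (r ℕ.+ i) ▹ x , E* (r ℕ.+ j) ▹ w ⟩                        ≈⟨ E*-selfadjoint (r ℕ.+ j) (E (r ℕ.+ i) ▹ x) w ⟩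
      ⟨ E* (r ℕ.+ j) ▹ E (r ℕ.+ i) ▹ x , w ⟩                        ≈⟨ ⟨⟩-cong (E*-E-x i j i≤d j≤d) (λ y → R.refl {w y}) ⟩
      ⟨ (c i * f i j) •ᵥ xs j , w ⟩                                 ≈⟨ ⟨⟩-•ˡ (c i * f i j) (xs j) w ⟩
      c i * f i j * g j                                             ≈⟨ R.*-congˡ (g-binomial j) ⟩
      ι ½ ^ d * ι (Cℚ d i) * f i j * (ι (Cℚ d j) * ⟨ x , w ⟩)       ≈⟨ solve 5 (λ h a f b g → h :* a :* f :* (b :* g) := h :* g :* a :* b :* f) R.refl (ι ½ ^ d) (ι (Cℚ d i)) (f i j) (ι (Cℚ d j)) ⟨ x , w ⟩ ⟩
      ι ½ ^ d * ⟨ x , w ⟩ * ι (Cℚ d i) * ι (Cℚ d j) * f i j         ≈⟨ R.*-congˡ (₂F₁-F i j d) ⟨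
      ι ½ ^ d * ⟨ x , w ⟩ * ι (Cℚ d i) * ι (Cℚ d j) * ₂F₁ i j d     ∎
      where
      open ≈-Reasoning
      open ℂS

-- Irreducible modules

E-factor∈T : ∀ {D} i j → T {D} (E-factor i j)
E-factor∈T {D} i j with i ℕ.≟ j
... | yes _  = I∈T
-- `T` has no clause for subtraction, so the factor is presented as `A + (-t) I`.
... | no i≢j = ≈-clos (λ y z → solve 4 (λ c a t i → c :* (a :+ :- t :* i) := c :* (a :- t :* i)) R.refl c (A y z) t (Iₘ y z))
                      (•-clos c (+-clos A∈T (•-clos (- t) I∈T)))
  where
  open ℂS
  c = ι (1/_ (θ D i ℚ.- θ D j) {{θ-gap D i≢j}})
  t = ι (θ D j)

E-factors∈T : ∀ {D} i js → T {D} (E-factors i js)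
E-factors∈T i []       = I∈T
E-factors∈T i (j ∷ js) = ·-clos (E-factor∈T i j) (E-factors∈T i js)

E∈T : ∀ {D} i → T {D} (E i)
E∈T {D} i = E-factors∈T i (upTo (suc D))

-- Lagrange interpolation in A*, whose result visibly stays in a T-module.
weight-projection : ∀ {D} → ℕ → ℕ → V D → V D
weight-projection         r zero    v = v
weight-projection {D} r (suc s) v with r ℕ.≟ s
... | yes _  = weight-projection r s v
... | no r≢s = ι (1/_ (θ D r ℚ.- θ D s) {{θ-gap D r≢s}}) •ᵥ (δ σA* v′ +ᵥ (- ι (θ D s)) •ᵥ v′)
  where v′ = weight-projection r s v

weight-projection-in : ∀ {D} r n (v : V D) y → weight y ≡ r → weight-projection r n v y ≈ v y
weight-projection-in {D} r zero    v y e = R.refl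
weight-projection-in {D} r (suc s) v y e with r ℕ.≟ s
... | yes _  = weight-projection-in r s v y e
... | no r≢s = begin
  g * (δ σA* v′ y + - ι (θ D s) * v′ y)                 ≈⟨ R.*-congˡ (R.+-congʳ (R.trans (σA*-weight v′ y) (R.*-congʳ (ι-cong (cong (θ D) e))))) ⟩
  g * (ι (θ D r) * v′ y + - ι (θ D s) * v′ y)           ≈⟨ solve 4 (λ g a b v → g :* (a :* v :+ :- b :* v) := g :* (a :- b) :* v) R.refl g (ι (θ D r)) (ι (θ D s)) (v′ y) ⟩
  g * (ι (θ D r) - ι (θ D s)) * v′ y                    ≈⟨ R.*-congʳ (R.*-congˡ (ι-sub (θ D r) (θ D s))) ⟨
  g * ι gap * v′ y                                      ≈⟨ R.*-congʳ (R.trans (R.sym (ι-* (1/_ gap {{nz}}) gap)) (ι-cong (ℚ.*-inverseˡ gap {{nz}}))) ⟩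
  1# * v′ y                                             ≈⟨ R.*-identityˡ (v′ y) ⟩
  v′ y                                                  ≈⟨ weight-projection-in r s v y e ⟩
  v y                                                   ∎
  where
  open ≈-Reasoning
  open ℂS
  v′ = weight-projection r s v
  gap = θ D r ℚ.- θ D s
  nz = θ-gap D r≢s
  g = ι (1/_ gap {{nz}})

weight-projection-out : ∀ {D} r n (v : V D) y → weight y ≢ r → weight y ℕ.< n → weight-projection r n v y ≈ 0#
weight-projection-out {D} r (suc s) v y ne lt with r ℕ.≟ s
... | yes r≡s = weight-projection-out r s v y ne (ℕ.≤∧≢⇒< (ℕ.≤-pred lt) λ e → ne (trans e (sym r≡s)))
... | no r≢s  = R.trans (R.*-congˡ (R.trans (R.+-congʳ (σA*-weight v′ y)) vanish)) (R.zeroʳ _)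
  where
  open ℂS
  v′ = weight-projection r s v
  vanish : ι (θ D (weight y)) * v′ y + - ι (θ D s) * v′ y ≈ 0#
  vanish with weight y ℕ.≟ s
  ... | yes e = R.trans (R.+-congʳ (R.*-congʳ (ι-cong (cong (θ D) e)))) (solve 2 (λ a v → a :* v :+ :- a :* v := con 0ℚ) R.refl (ι (θ D s)) (v′ y))
  ... | no ≢s = R.trans (R.+-cong (R.*-congˡ z) (R.*-congˡ z)) (solve 2 (λ a b → a :* con 0ℚ :+ b :* con 0ℚ := con 0ℚ) R.refl (ι (θ D (weight y))) (- ι (θ D s)))
    where z = weight-projection-out r s v y ne (ℕ.≤∧≢⇒< (ℕ.≤-pred lt) ≢s)

weight-projection-E* : ∀ {D} r (v : V D) → weight-projection r (suc D) v ≈ᵥ E* r ▹ v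
weight-projection-E* {D} r v y with weight y ℕ.≟ r
... | yes e = R.trans (weight-projection-in r (suc D) v y e) (R.sym (E*-in r v y e))
... | no ne = R.trans (weight-projection-out r (suc D) v y ne (ℕ.s≤s (weight-≤ y))) (R.sym (Supp-E* r v y ne))

module Module {D} {W : Pred (V D) 0ℓ} (W-mod : IsTModule W) where
  open IsTModule W-mod
  open IsSubspace isSubspace

  A-closed : ∀ {v} → v ∈ W → δ σA v ∈ W
  A-closed {v} p = ≈-closed (A-▹ v) (T-closed A∈T p)

  A*-closed : ∀ {v} → v ∈ W → δ σA* v ∈ W
  A*-closed {v} p = ≈-closed (A*-▹-δ v) (T-closed A*∈T p)

  -- The commutator of `A` and `A*` yields `Aᵋ` with the factor `2𝐢`. Keeping the factor avoids
  -- inverting it, since `L` and `R` contain exactly `-¼` and `¼` of this vector.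
  2𝐢Aᵋ-closed : ∀ {v} → v ∈ W → 2𝐢 •ᵥ δ σAᵋ v ∈ W
  2𝐢Aᵋ-closed {v} p = ≈-closed
    (λ y → R.trans (R.+-congʳ ([A,A*] v y)) (solve 2 (λ a b → (a :+ b) :+ con (ℚ.- 1ℚ) :* a := b) R.refl (δ σA* (δ σA v) y) (2𝐢 * δ σAᵋ v y)))
    (+-closed (A-closed (A*-closed p)) (•-closed (ι (ℚ.- 1ℚ)) (A*-closed (A-closed p))))
    where open ℂS

  L-closed : ∀ {v} → v ∈ W → δ σL v ∈ W
  L-closed {v} p = ≈-closed
    (λ y → R.sym (R.trans (L-split v y) (R.+-congˡ
      (solve 2 (λ i c → con ½ :* :- i :* c := con (ℚ.- (½ ℚ.* ½)) :* (con two :* i :* c)) R.refl 𝐢 (δ σAᵋ v y)))))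
    (+-closed (•-closed (ι ½) (A-closed p)) (•-closed (ι (ℚ.- (½ ℚ.* ½))) (2𝐢Aᵋ-closed p)))
    where open ℂS

  R-closed : ∀ {v} → v ∈ W → δ σR v ∈ W
  R-closed {v} p = ≈-closed
    (λ y → R.sym (R.trans (R-split v y) (R.+-congˡ
      (solve 2 (λ i c → con ½ :* i :* c := con (½ ℚ.* ½) :* (con two :* i :* c)) R.refl 𝐢 (δ σAᵋ v y)))))
    (+-closed (•-closed (ι ½) (A-closed p)) (•-closed (ι (½ ℚ.* ½)) (2𝐢Aᵋ-closed p)))
    where open ℂS

  raise-closed : ∀ {v} → v ∈ W → ∀ k → raise v k ∈ W
  raise-closed = divided-closed (λ _ → W) (λ _ c p → •-closed c (R-closed p))

  E*-closed : ∀ r {v} → v ∈ W → E* r ▹ v ∈ W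
  E*-closed r {v} p = ≈-closed (weight-projection-E* r v) (go (suc D))
    where
    go : ∀ n → weight-projection r n v ∈ W
    go zero    = p
    go (suc s) with r ℕ.≟ s
    ... | yes _ = go s
    ... | no _  = •-closed _ (+-closed (A*-closed (go s)) (•-closed _ (go s)))

module Irreducible {D} {W : Pred (V D) 0ℓ} (W-irr : IsIrreducible W) where
  open IsIrreducible W-irr
  open Module isTModule public
  open IsTModule isTModule
  open IsSubspace isSubspace

  -- The part of `W` on which `Ω` acts as `c` is a `T`-module and contains `x`. Minimality is a
  -- negative statement, so it gives the equation through `≈-stable`.
  schur : ∀ {c x} → x ∈ W → ¬ (x ≈ᵥ 0ᵥ) → Ω x ≈ᵥ c •ᵥ x → ∀ {w} → w ∈ W → Ω w ≈ᵥ c •ᵥ w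
  schur {c} {x} x∈W x≉0 ωx {w} w∈W y = ≈-stable λ k → minimal U U-mod proj₁
    ((λ (U⊆0 , _) → x≉0 (U⊆0 (x∈W , ωx))) , λ (_ , W⊆U) → k (proj₂ (W⊆U w∈W) y))
    where
    open ℂS
    U : Pred (V D) 0ℓ
    U v = v ∈ W × Ω v ≈ᵥ c •ᵥ v
    U-mod : IsTModule U
    U-mod = record
      { isSubspace = record
        { ≈-closed = λ e (p , ω) → ≈-closed e p , λ y → R.trans (Ω.▹-cong (≈ᵥ-sym e) y) (R.trans (ω y) (R.*-congˡ (e y)))
        ; 0-closed = 0-closed , λ y → R.trans (Ω.▹-0 y) (R.sym (R.zeroʳ c))
        ; +-closed = λ {v} {w} (p , ω) (q , ω′) → +-closed p q , λ y → R.trans (Ω.▹-+ v w y) (R.trans (R.+-cong (ω y) (ω′ y)) (R.sym (R.distribˡ c (v y) (w y))))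
        ; •-closed = λ k {v} (p , ω) → •-closed k p , λ y → R.trans (Ω.▹-• k v y) (R.trans (R.*-congˡ (ω y)) (solve 3 (λ k c v → k :* (c :* v) := c :* (k :* v)) R.refl k c (v y)))
        }
      ; T-closed = λ {B} B∈T {v} (p , ω) → T-closed B∈T p , λ y → R.trans (Ω-T B∈T v y)
          (R.trans (▹-linear B .▹-cong ω y) (▹-linear B .▹-• c v y))
      }

  -- At vertices of weight `r - 1`, `δ σL` takes the same value on `w` and on its weight-`r` part
  -- `x`. A nonzero value would make `E* (r - 1) ⟦ W ⟧` nonzero, against the minimality of `r`.
  endpoint-L : ∀ {r x} → IsEndpoint W r → x ∈ E* r ⟦ W ⟧ → δ σL x ≈ᵥ 0ᵥ
  endpoint-L {r} {x} end (w , w∈W , x≈) y with r ℕ.≟ suc (weight y)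
  ... | no ne = L-support x y λ z e → R.trans (x≈ z) (Supp-E* r w z λ e′ → ne (trans (sym e′) e))
  ... | yes refl = ≈-stable λ k → ℕ.<⇒≱ ℕ.≤-refl (IsEndpoint.least end s (weight-≤ y) λ (sub , _) →
      k (R.trans agree (R.trans (R.sym (E*-in s (δ σL w) y refl)) (sub (δ σL w , L-closed w∈W , λ _ → R.refl) y))))
    where
    open ℂS
    s = weight y
    agree : δ σL x y ≈ δ σL w y
    agree = begin
      δ σL x y
        ≈⟨ solve 2 (λ a b → a := (a :+ con (ℚ.- 1ℚ) :* b) :+ b) R.refl (δ σL x y) (δ σL w y) ⟩
      (δ σL x y + ι (ℚ.- 1ℚ) * δ σL w y) + δ σL w y
        ≈⟨ R.+-congʳ (R.trans (δ.▹-+ σL x (ι (ℚ.- 1ℚ) •ᵥ w) y) (R.+-congˡ (δ.▹-• σL (ι (ℚ.- 1ℚ)) w y))) ⟨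
      δ σL (x +ᵥ ι (ℚ.- 1ℚ) •ᵥ w) y + δ σL w y
        ≈⟨ R.+-congʳ (L-support _ y λ z e → R.trans (R.+-congʳ (R.trans (x≈ z) (E*-in r w z e))) (solve 1 (λ a → a :+ con (ℚ.- 1ℚ) :* a := con 0ℚ) R.refl (w z))) ⟩
      0# + δ σL w y
        ≈⟨ R.+-identityˡ _ ⟩
      δ σL w y ∎
      where open ≈-Reasoning

-- The diameter is given as the cardinality of a subset, while the structure theory determines which
-- weights occur. This converts one into the other.
interval-size : ∀ {n} (S : Subset.Subset n) r c → r ℕ.+ c ≤ n →
  (∀ i → i Subset.∈ S ⇔ (r ≤ toℕ i × toℕ i ℕ.< r ℕ.+ c)) → Subset.∣ S ∣ ≡ c
interval-size []                  zero    zero    le h = refl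
interval-size (Subset.inside ∷ S)  (suc r) c       le h with () ← proj₁ (Equivalence.to (h 0F) here)
interval-size (Subset.outside ∷ S) (suc r) c       le h = interval-size S r c (ℕ.≤-pred le) λ i → mk⇔
  (λ i∈ → let p , q = Equivalence.to (h (Fin.suc i)) (there i∈) in ℕ.≤-pred p , ℕ.≤-pred q)
  (λ (p , q) → drop-there (Equivalence.from (h (Fin.suc i)) (ℕ.s≤s p , ℕ.s≤s q)))
interval-size (Subset.inside ∷ S)  zero    zero    le h with () ← proj₂ (Equivalence.to (h 0F) here)
interval-size (Subset.outside ∷ S) zero    zero    le h = interval-size S 0 0 ℕ.z≤n λ i → mk⇔
  (λ i∈ → contradiction (proj₂ (Equivalence.to (h (Fin.suc i)) (there i∈))) λ ())
  (λ (p , q) → contradiction q λ ())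
interval-size (Subset.outside ∷ S) zero    (suc c) le h with () ← Equivalence.from (h 0F) (ℕ.z≤n , ℕ.s≤s ℕ.z≤n)
interval-size (Subset.inside ∷ S)  zero    (suc c) le h = cong suc (interval-size S 0 c (ℕ.≤-pred le) λ i → mk⇔
  (λ i∈ → let p , q = Equivalence.to (h (Fin.suc i)) (there i∈) in ℕ.z≤n , ℕ.≤-pred q)
  (λ (p , q) → drop-there (Equivalence.from (h (Fin.suc i)) (ℕ.z≤n , ℕ.s≤s q))))

raise-zero-after : ∀ {D} {x : V D} k j → raise x k ≈ᵥ 0ᵥ → raise x (j ℕ.+ k) ≈ᵥ 0ᵥ
raise-zero-after k zero    p = p
raise-zero-after k (suc j) p y = R.trans (R.*-congˡ (δ.▹-kills σR (raise-zero-after k j p) y)) (R.zeroʳ _)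

Supp-cong : ∀ {D s} {v w : V D} → v ≈ᵥ w → Supp (_≡ s) v → Supp (_≡ s) w
Supp-cong e supp y ne = R.trans (R.sym (e y)) (supp y ne)

module Structure {D} {W : Pred (V D) 0ℓ} (W-irr : IsIrreducible W) {r d} (end : IsEndpoint W r) (diam : IsDiameter W d)
  {x : V D} (x∈ : x ∈ E* r ⟦ W ⟧) (x≉0 : ¬ (x ≈ᵥ 0ᵥ)) where
  open Irreducible W-irr
  open IsTModule (IsIrreducible.isTModule W-irr)
  open IsSubspace isSubspace
  open IsDiameter diam

  x∈W : x ∈ W
  x∈W = let w , w∈W , x≈ = x∈ in ≈-closed (≈ᵥ-sym x≈) (E*-closed r w∈W)

  Supp-x : Supp (_≡ r) x
  Supp-x = let w , w∈W , x≈ = x∈ in Supp-cong (≈ᵥ-sym x≈) (Supp-E* r w)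

  L-x : δ σL x ≈ᵥ 0ᵥ
  L-x = endpoint-L end x∈

  -- Stated for any admissible `m`, because the identity `m = d` is itself derived from it.
  Ω-W′ : ∀ {m} → D ≡ 2 ℕ.* r ℕ.+ m → ∀ {w} → w ∈ W → Ω w ≈ᵥ ι (casimir m) •ᵥ w
  Ω-W′ {m} D≡ = schur x∈W x≉0 (Ω-highest {μ = ℕ→ℚ m} (Supp-eigen (_≡ r) Supp-x λ n e → trans (cong (θ D) e) (θ-endpoint {D} {r} {m} D≡)) L-x)

  -- The weights of `W` are exactly those from `r` to `r + m`: smaller ones contradict the endpoint,
  -- larger ones contradict the eigenvalue of `Ω`, and each one in between carries a rung, nonzero
  -- because the top rung is.
  diameter≡ : ∀ {m} → D ≡ 2 ℕ.* r ℕ.+ m → ¬ (raise x m ≈ᵥ 0ᵥ) → m ≡ d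
  diameter≡ {m} D≡ top≉0 = ℕ.suc-injective (trans (sym (interval-size support r (suc m) bound λ i → mk⇔ (inside i) (outside i))) size)
    where
    bound : r ℕ.+ suc m ≤ suc D
    bound = subst₂ _≤_ (sym (ℕ.+-suc r m)) (cong suc (sym D≡)) (ℕ.s≤s (ℕ.+-monoˡ-≤ m (ℕ.m≤m+n r (r ℕ.+ 0))))
    inside : ∀ i → i Subset.∈ support → r ≤ toℕ i × toℕ i ℕ.< r ℕ.+ suc m
    inside i i∈ = r≤i , ℕ.≰⇒> λ r+m<i → nonzero (vanish r+m<i)
      where
      nonzero = Equivalence.to (spec i) i∈
      r≤i : r ≤ toℕ i
      r≤i = IsEndpoint.least end (toℕ i) (ℕ.≤-pred (Fin.toℕ<n i)) nonzero
      vanish : r ℕ.+ suc m ≤ toℕ i → E* (toℕ i) ⟦ W ⟧ ≐ 𝟘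
      vanish le = (λ (w , w∈W , v≈) → ≈ᵥ-trans v≈ (above-vanishes e m<e D≡
                     (subst (λ s → Supp (_≡ s) (E* (toℕ i) ▹ w)) (sym r+e≡) (Supp-E* (toℕ i) w)) (Ω-W′ D≡ (E*-closed (toℕ i) w∈W))))
                , (λ v≈0 → 0ᵥ , 0-closed , ≈ᵥ-trans v≈0 (≈ᵥ-sym (▹-0 (▹-linear (E* (toℕ i))))))
        where
        e = toℕ i ℕ.∸ r
        r+e≡ : r ℕ.+ e ≡ toℕ i
        r+e≡ = ℕ.m+[n∸m]≡n r≤i
        m<e : m ℕ.< e
        m<e = ℕ.+-cancelˡ-≤ r (suc m) e (subst (r ℕ.+ suc m ≤_) (sym r+e≡) le)
    outside : ∀ i → r ≤ toℕ i × toℕ i ℕ.< r ℕ.+ suc m → i Subset.∈ support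
    outside i (r≤i , i<) = Equivalence.from (spec i) λ (sub , _) → top≉0 (subst (λ t → raise x t ≈ᵥ 0ᵥ) (ℕ.m∸n+n≡m k≤m)
        (raise-zero-after k (m ℕ.∸ k) (sub (raise x k , raise-closed x∈W k , ≈ᵥ-sym (subst (λ s → E* s ▹ raise x k ≈ᵥ raise x k) r+k≡ (E*-fix (Supp-raise Supp-x k)))))))
      where
      k = toℕ i ℕ.∸ r
      r+k≡ : r ℕ.+ k ≡ toℕ i
      r+k≡ = ℕ.m+[n∸m]≡n r≤i
      k≤m : k ≤ m
      k≤m = ℕ.≤-pred (ℕ.+-cancelˡ-≤ r (suc k) (suc m) (subst (_≤ r ℕ.+ suc m) (trans (cong suc (sym r+k≡)) (sym (ℕ.+-suc r k))) i<))

  D≡ : D ≡ 2 ℕ.* r ℕ.+ d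
  -- Equality in ℕ is decidable, so the double negation of `highest-weight` may be opened.
  D≡ = decidable-stable (D ℕ.≟ 2 ℕ.* r ℕ.+ d) λ ¬D≡ → highest-weight Supp-x L-x x≉0 λ (m , D≡′ , p , _) →
    ¬D≡ (subst (λ m → D ≡ 2 ℕ.* r ℕ.+ m) (diameter≡ D≡′ p) D≡′)

  Ω-W : ∀ {w} → w ∈ W → Ω w ≈ᵥ ι (casimir d) •ᵥ w
  Ω-W = Ω-W′ D≡

-- The three inner product formulas.

theorem11p5 : (D : ℕ) .{{_ : NonZero D}} (W : Pred (V D) 0ℓ) → IsIrreducible W →
    (r d : ℕ) → IsEndpoint W r → IsDiameter W d →
    (i j : ℕ) → i ≤ d → j ≤ d →
    (u u* uᵋ : V D) →
    u ∈ E r ⟦ W ⟧ → ¬ (u ≈ᵥ 0ᵥ) →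
    u* ∈ E* r ⟦ W ⟧ → ¬ (u* ≈ᵥ 0ᵥ) →
    uᵋ ∈ Eᵋ r ⟦ W ⟧ → ¬ (uᵋ ≈ᵥ 0ᵥ) →
    (⟨ E (r ℕ.+ i) ▹ u* , E* (r ℕ.+ j) ▹ u ⟩
    ≈ ι ½ ^ d * ⟨ u* , u ⟩ * ι (ℕ→ℚ (d C i)) * ι (ℕ→ℚ (d C j)) * ₂F₁ i j d)
    × (⟨ E* (r ℕ.+ i) ▹ uᵋ , Eᵋ (r ℕ.+ j) ▹ u* ⟩
    ≈ ι ½ ^ d * ⟨ uᵋ , u* ⟩ * ι (ℕ→ℚ (d C i)) * ι (ℕ→ℚ (d C j)) * ₂F₁ i j d)
    × (⟨ Eᵋ (r ℕ.+ i) ▹ u , E (r ℕ.+ j) ▹ uᵋ ⟩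
    ≈ ι ½ ^ d * ⟨ u , uᵋ ⟩ * ι (ℕ→ℚ (d C i)) * ι (ℕ→ℚ (d C j)) * ₂F₁ i j d)
theorem11p5 D W W-irr r d end diam i j i≤d j≤d u u* uᵋ (w , w∈W , u≈) _ u*∈ u*≉0 (wᵋ , wᵋ∈W , uᵋ≈) _ =
  part-i , part-ii , part-iii
  where
  open Structure W-irr end diam u*∈ u*≉0

  c = ι (casimir d)

  θ-r : θ D r ≡ ℕ→ℚ d
  θ-r = θ-endpoint {D} {r} {d} D≡

  bound : ∀ {i} → i ≤ d → r ℕ.+ i ≤ D
  bound i≤d = subst (_ ≤_) (sym D≡) (ℕ.+-mono-≤ (ℕ.m≤m+n r (r ℕ.+ 0)) i≤d)

  r≤D : r ≤ D
  r≤D = IsEndpoint.r≤D end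

  weight-d : ∀ {v : V D} → Supp (_≡ r) v → δ σA* v ≈ᵥ nat d •ᵥ v
  weight-d supp = Supp-eigen (_≡ r) supp λ n e → trans (cong (θ D) e) θ-r

  eigen-cong : ∀ {f : V D → V D} {k v v′} → IsLinear f → v ≈ᵥ v′ → f v′ ≈ᵥ k •ᵥ v′ → f v ≈ᵥ k •ᵥ v
  eigen-cong f-lin e p y = R.trans (f-lin .▹-cong e y) (R.trans (p y) (R.*-congˡ (R.sym (e y))))

  -- Pulling back to the weight space of `A*`: `u` is the image of `z` under `P⁻¹`, and `uᵋ` is the
  -- image of `zᵋ` under `P`.
  z zᵋ : V D
  z  = E* r ▹ κ P₁ w
  zᵋ = E* r ▹ κ P₁⁻¹ wᵋ

  u≈P⁻¹z : u ≈ᵥ κ P₁⁻¹ z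
  u≈P⁻¹z y = R.trans (u≈ y) (R.trans (▹-linear (E r) .▹-cong (≈ᵥ-sym (P⁻¹P w)) y) (E-P⁻¹ r≤D (κ P₁ w) y))

  uᵋ≈Pzᵋ : uᵋ ≈ᵥ κ P₁ zᵋ
  uᵋ≈Pzᵋ y = R.trans (uᵋ≈ y) (R.trans (▹-linear (Eᵋ r) .▹-cong (≈ᵥ-sym (PP⁻¹ wᵋ)) y) (Eᵋ-P r≤D (κ P₁⁻¹ wᵋ) y))

  Pu≈z : κ P₁ u ≈ᵥ z
  Pu≈z y = R.trans (κ.▹-cong P₁ u≈P⁻¹z y) (PP⁻¹ z y)

  P⁻¹uᵋ≈zᵋ : κ P₁⁻¹ uᵋ ≈ᵥ zᵋ
  P⁻¹uᵋ≈zᵋ y = R.trans (κ.▹-cong P₁⁻¹ uᵋ≈Pzᵋ y) (P⁻¹P zᵋ y)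

  Supp-Pu : Supp (_≡ r) (κ P₁ u)
  Supp-Pu = Supp-cong (≈ᵥ-sym Pu≈z) (Supp-E* r (κ P₁ w))

  Supp-P⁻¹uᵋ : Supp (_≡ r) (κ P₁⁻¹ uᵋ)
  Supp-P⁻¹uᵋ = Supp-cong (≈ᵥ-sym P⁻¹uᵋ≈zᵋ) (Supp-E* r (κ P₁⁻¹ wᵋ))

  Ω-Pu : Ω (κ P₁ u) ≈ᵥ c •ᵥ κ P₁ u
  Ω-Pu = eigen-transport Ω (κ-linear P₁) Ω-P (eigen-cong Ω-linear u≈
    (eigen-transport Ω (▹-linear (E r)) (Ω-T (E∈T r)) (Ω-W w∈W)))

  -- For `E r` membership in `T` is available. For `Eᵋ r` the product `P⁻¹ E P` is followed instead,
  -- each factor of which commutes with `Ω`.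
  Ω-P⁻¹uᵋ : Ω (κ P₁⁻¹ uᵋ) ≈ᵥ c •ᵥ κ P₁⁻¹ uᵋ
  Ω-P⁻¹uᵋ = eigen-transport Ω (κ-linear P₁⁻¹) Ω-P⁻¹ (eigen-cong Ω-linear (λ y → R.trans (uᵋ≈ y) (Eᵋ-▹ r wᵋ y))
    (eigen-transport Ω (κ-linear P₁⁻¹) Ω-P⁻¹ (eigen-transport Ω (▹-linear (E r)) (Ω-T (E∈T r))
      (eigen-transport Ω (κ-linear P₁) Ω-P (Ω-W wᵋ∈W)))))

  A-u : δ σA u ≈ᵥ nat d •ᵥ u
  A-u = eigen-cong (δ-linear σA) u≈P⁻¹z
    (eigen-transport (δ σA) (κ-linear P₁⁻¹) AP⁻¹≈P⁻¹A* (weight-d (Supp-E* r (κ P₁ w))))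

  A-P⁻¹u* : δ σA (κ P₁⁻¹ u*) ≈ᵥ nat d •ᵥ κ P₁⁻¹ u*
  A-P⁻¹u* = eigen-transport (δ σA) (κ-linear P₁⁻¹) AP⁻¹≈P⁻¹A* (weight-d Supp-x)

  A-Puᵋ : δ σA (κ P₁ uᵋ) ≈ᵥ nat d •ᵥ κ P₁ uᵋ
  A-Puᵋ = eigen-transport (δ σA) (κ-linear P₁) AP≈PAᵋ (eigen-cong (δ-linear σAᵋ) uᵋ≈Pzᵋ
    (eigen-transport (δ σAᵋ) (κ-linear P₁) AᵋP≈PA* (weight-d (Supp-E* r (κ P₁⁻¹ wᵋ)))))

  -- The frame change scales both inner products by the same constant, and the formula is
  -- homogeneous in them.
  rescale : ∀ {s s′ t t′} k → s′ ≈ k * s → t′ ≈ k * t →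
    s ≈ ι ½ ^ d * t * ι (Cℚ d i) * ι (Cℚ d j) * ₂F₁ i j d →
    s′ ≈ ι ½ ^ d * t′ * ι (Cℚ d i) * ι (Cℚ d j) * ₂F₁ i j d
  rescale {t = t} k p q e = R.trans p (R.trans (R.*-congˡ e)
    (R.trans (solve 6 (λ k h t a b f → k :* (h :* t :* a :* b :* f) := h :* (k :* t) :* a :* b :* f) R.refl k (ι ½ ^ d) t (ι (Cℚ d i)) (ι (Cℚ d j)) (₂F₁ i j d))
      (R.*-congʳ (R.*-congʳ (R.*-congʳ (R.*-congˡ (R.sym q)))))))
    where open ℂS

  part-i = Ladder.overlap-formula D≡ Supp-x L-x A-u i j i≤d j≤d

  -- Applying `P⁻¹` turns `A*` and `Aᵋ` into `A` and `A*`, so `P⁻¹uᵋ` generates the ladder and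
  -- `P⁻¹u*` is the eigenvector paired with it.
  part-ii = rescale (ι two ^ D)
    (R.trans (⟨⟩-cong
        (λ y → R.trans (R.sym (PP⁻¹ (E* (r ℕ.+ i) ▹ uᵋ) y)) (κ.▹-cong P₁ (≈ᵥ-sym (E-P⁻¹ (bound i≤d) uᵋ)) y))
        (λ y → R.trans (▹-linear (Eᵋ (r ℕ.+ j)) .▹-cong (≈ᵥ-sym (PP⁻¹ u*)) y) (Eᵋ-P (bound j≤d) (κ P₁⁻¹ u*) y)))
      (P-isometry (E (r ℕ.+ i) ▹ κ P₁⁻¹ uᵋ) (E* (r ℕ.+ j) ▹ κ P₁⁻¹ u*)))
    (R.trans (⟨⟩-cong (≈ᵥ-sym (PP⁻¹ uᵋ)) (≈ᵥ-sym (PP⁻¹ u*))) (P-isometry (κ P₁⁻¹ uᵋ) (κ P₁⁻¹ u*)))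
    (Ladder.overlap-formula D≡ Supp-P⁻¹uᵋ (L-kills {m = d} D≡ Supp-P⁻¹uᵋ Ω-P⁻¹uᵋ) A-P⁻¹u* i j i≤d j≤d)

  -- Applying `P` turns `Aᵋ` and `A` into `A` and `A*`. Now `Pu` generates the ladder and `Puᵋ` is
  -- the eigenvector.
  part-iii = rescale (ι ½ ^ D)
    (R.trans (⟨⟩-cong
        (Eᵋ-▹ (r ℕ.+ i) u)
        (λ y → R.trans (▹-linear (E (r ℕ.+ j)) .▹-cong (≈ᵥ-sym (P⁻¹P uᵋ)) y) (E-P⁻¹ (bound j≤d) (κ P₁ uᵋ) y)))
      (P⁻¹-isometry (E (r ℕ.+ i) ▹ κ P₁ u) (E* (r ℕ.+ j) ▹ κ P₁ uᵋ)))
    (R.trans (⟨⟩-cong (≈ᵥ-sym (P⁻¹P u)) (≈ᵥ-sym (P⁻¹P uᵋ))) (P⁻¹-isometry (κ P₁ u) (κ P₁ uᵋ)))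
    (Ladder.overlap-formula D≡ Supp-Pu (L-kills {m = d} D≡ Supp-Pu Ω-Pu) A-Puᵋ i j i≤d j≤d)
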